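{- Let $p\ge 17$ be prime and let $A,B\in\mathbb{N}$. Put $\bar A=A\bmod p$, $\bar B=B\bmod p$, and \[ r=\left(\left\lfloor\frac{\left(2^{3p^2}+\bar A\,2^{p^2}+\bar B\right)^{\lfloor p/2\rfloor}}{2^{p^2(p-1)}}\right\rfloor\bmod 2^{p^2}\right)\bmod p . \] Then the number $N$ of points $(x,y)\in(\mathbb{Z}/p\mathbb{Z})^2$ with $y^2=x^3+Ax+B$ equals \[ N=(p\mathbin{\dot{ - }}r)+p\cdot\Bigl(1\mathbin{\dot{ - }}\bigl((4p+1)\mathbin{\dot{ - }}r^2\bigr)\Bigr). \] Equivalently, the quantity $a_p:=p-N$ equals $r$ if $r^2\le 4p$, and equals $r-p$ otherwise; in the nonsingular case ($4\bar A^3+27\bar B^2\not\equiv 0\pmod p$) this is the trace of Frobenius of the elliptic curve $y^2=x^3+\bar Ax+\bar B$ over $\mathbb{F}_p$. The statement holds for every pair $(A,B)$, including the pairs for which the cubic $x^3+\bar Ax+\bar B$ has a repeated root modulo $p$. The number of projective points of the cubic (points over $\mathbb{F}_p$ of the projective closure of $y^2=x^3+\bar Ax+\bar B$) is $N+1$.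
   Context: $\mathbb{N}$ includes $0$. Truncated subtraction is $x\mathbin{\dot{ - }}y=\max(x-y,0)$. $a\bmod b$ denotes the least nonnegative residue. -}

module Defs where

open import Data.Fin using (Fin; toℕ)
open import Data.Integer using (ℤ; +_; _-_)
open import Data.List using (List; length; filter; allFin; cartesianProduct)
open import Data.Nat using (ℕ; NonZero; _+_; _*_; _∸_; _^_; ⌊_/2⌋; _≟_)
open import Data.Nat.DivMod using (_%_; _/_; %-distribˡ-*; m%n%n≡m%n)
open import Data.Nat.Properties using (m^n≢0; *-comm; *-assoc; *-identityˡ; [m*n]*[o*p]≡[m*o]*[n*p])
open import Data.Product using (∃; _×_; _,_)
open import Function.Bundles using (Inverse)
open import Level using (0ℓ)
open import Relation.Binary.Bundles using (Setoid)
open import Relation.Binary.Structures using (IsEquivalence)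
open import Relation.Binary.PropositionalEquality using (_≡_; refl; sym; trans; cong; cong₂; setoid)
open import Relation.Nullary using (¬_; Dec)

-- ℤ/p is represented by Fin p; natural numbers are also used as
-- representatives of their residue classes.

infix 4 _≡_[mod_]
_≡_[mod_] : ℕ → ℕ → (p : ℕ) .{{_ : NonZero p}} → Set
a ≡ b [mod p ] = a % p ≡ b % p

-- The base-2^(p²) digit that holds the coefficient of T^(p-1) in
-- (T³ + aT + b)^⌊p/2⌋ at T = 2^(p²), reduced mod p.
residue : (p : ℕ) .{{_ : NonZero p}} → ℕ → ℕ → ℕ
residue p a b = (((2 ^ (3 * p ^ 2) + a * 2 ^ (p ^ 2) + b) ^ ⌊ p /2⌋ / D) % M) % p
  where
  D M : ℕ
  D = 2 ^ (p ^ 2 * (p ∸ 1))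
  M = 2 ^ (p ^ 2)
  instance
    D≢0 : NonZero D
    D≢0 = m^n≢0 2 (p ^ 2 * (p ∸ 1))
    M≢0 : NonZero M
    M≢0 = m^n≢0 2 (p ^ 2)

module _ (p : ℕ) .{{_ : NonZero p}} (a b : ℕ) where

  OnCurve : Fin p × Fin p → Set
  OnCurve (x , y) = toℕ y ^ 2 ≡ toℕ x ^ 3 + a * toℕ x + b [mod p ]

  onCurve? : ∀ P → Dec (OnCurve P)
  onCurve? (x , y) = _ ≟ _

  affinePoints : List (Fin p × Fin p)
  affinePoints = filter onCurve? (cartesianProduct (allFin p) (allFin p))

  affineCount : ℕ
  affineCount = length affinePoints

  -- The discriminant is -16 (4a³ + 27b²); for p ≠ 2 the factor -16 is a unit.
  Nonsingular : Set
  Nonsingular = ¬ (4 * a ^ 3 + 27 * b ^ 2 ≡ 0 [mod p ])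

  -- Homogeneous coordinates (X : Y : Z) of a point of the projective closure,
  -- the zero locus of the homogenised equation Y²Z = X³ + aXZ² + bZ³.
  record ProjectivePoint : Set where
    field
      X Y Z   : Fin p
      nonzero : ¬ (toℕ X ≡ 0 × toℕ Y ≡ 0 × toℕ Z ≡ 0)
      onCurve : toℕ Y ^ 2 * toℕ Z
                  ≡ toℕ X ^ 3 + a * toℕ X * toℕ Z ^ 2 + b * toℕ Z ^ 3 [mod p ]

  open ProjectivePoint

  Unit : ℕ → Set
  Unit u = ∃ λ v → u * v ≡ 1 [mod p ]

  infix 4 _∼_
  _∼_ : ProjectivePoint → ProjectivePoint → Set
  P ∼ Q = ∃ λ u → Unit u × Scaled u X × Scaled u Y × Scaled u Z
    where
    Scaled : ℕ → (ProjectivePoint → Fin p) → Set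
    Scaled u c = toℕ (c Q) ≡ u * toℕ (c P) [mod p ]

  private
    *-cong-mod : ∀ {k l m n} → k ≡ l [mod p ] → m ≡ n [mod p ] → k * m ≡ l * n [mod p ]
    *-cong-mod {k} {l} {m} {n} e f = trans (%-distribˡ-* k m p)
      (trans (cong₂ (λ s t → (s * t) % p) e f) (sym (%-distribˡ-* l n p)))

    ≡⇒mod : ∀ {m n} → m ≡ n → m ≡ n [mod p ]
    ≡⇒mod = cong (_% p)

    unscale : ∀ u v {m n} → u * v ≡ 1 [mod p ] → n ≡ u * m [mod p ] → m ≡ v * n [mod p ]
    unscale u v {m} {n} uv e = sym (trans (*-cong-mod {v} {v} {n} {u * m} refl e)
      (trans (≡⇒mod (trans (sym (*-assoc v u m)) (cong (_* m) (*-comm v u))))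
        (trans (*-cong-mod {u * v} {1} {m} {m} uv refl) (≡⇒mod (*-identityˡ m)))))

    rescale : ∀ u v {k m n} → m ≡ u * k [mod p ] → n ≡ v * m [mod p ] → n ≡ v * u * k [mod p ]
    rescale u v {k} {m} {n} e f = trans f
      (trans (*-cong-mod {v} {v} {m} {u * k} refl e) (≡⇒mod (sym (*-assoc v u k))))

    ∼-isEquivalence : IsEquivalence _∼_
    ∼-isEquivalence = record
      { refl  = 1 , (1 , refl) , one , one , one
      ; sym   = λ { (u , (v , uv) , x , y , z) →
          v , (u , trans (≡⇒mod (*-comm v u)) uv) ,
          unscale u v uv x , unscale u v uv y , unscale u v uv z }
      ; trans = λ { (u , (u' , uu') , x , y , z) (v , (v' , vv') , x' , y' , z') →
          v * u ,
          (v' * u' , trans (≡⇒mod ([m*n]*[o*p]≡[m*o]*[n*p] v u v' u'))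
                           (*-cong-mod {v * v'} {1} {u * u'} {1} vv' uu')) ,
          rescale u v x x' , rescale u v y y' , rescale u v z z' }
      }
      where
      one : ∀ {m} → m ≡ 1 * m [mod p ]
      one {m} = ≡⇒mod (sym (*-identityˡ m))

  projectivePoints : Setoid 0ℓ 0ℓ
  projectivePoints = record
    { Carrier = ProjectivePoint ; _≈_ = _∼_ ; isEquivalence = ∼-isEquivalence }

HasCardinality : Setoid 0ℓ 0ℓ → ℕ → Set
HasCardinality S n = Inverse S (setoid (Fin n))

-- The standard definition over 𝔽ₚ: t = p + 1 - #E(𝔽ₚ).  It is meant for
-- nonsingular y² = x³ + ax + b, where E is the projective closure.
IsTraceOfFrobenius : (p : ℕ) .{{_ : NonZero p}} → (a b : ℕ) → ℤ → Set
IsTraceOfFrobenius p a b t =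
  ∃ λ n → HasCardinality (projectivePoints p a b) n × t ≡ + (p + 1) - + n

-- Over 𝔽ₚ put p = 2h + 1 and f = X³ + aX + b. By Euler's criterion N ≡ Σₓ (1 + f(x)^h), and the power sums
-- over 𝔽ₚ turn this into N ≡ -[X^(p-1)] f^h (mod p). The coefficients of f^h over ℕ are smaller than 2^(p²), so
-- r is the residue of that coefficient and aₚ ≡ r (mod p). For p ≥ 17 the bound aₚ² ≤ 4p leaves only one of r
-- and r - p.
--
-- The bound aₚ² ≤ 4p is obtained by Stepanov's method, for the curve and its quadratic twist at once. For
-- n(n+1) ≤ p + 1 one looks for F = Σ x^(pa) u_a(x) + ε y^(p+1) Σ x^(pb) v_b(x) vanishing to order n at all
-- rational points. The derivation 2y d/dx kills x^p and y^p, and at rational points these agree with x and y; so it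
-- suffices that certain polynomials in x that are linear in the u_a and v_b vanish identically. If the degrees of
-- the u_a and v_b are weighted by the pole orders of x^a and x^b y, there are more unknowns than equations, and
-- F is nonzero of degree at most (n+1)(p-1+n)/2. Hence n N ≤ (n+1)(p-1+n); taking n as large as possible gives
-- the bound. Where f has a multiple root, f(x) = (x - x₀)²(x + 2x₀) is counted directly.

module Submission where

open import Defs
open import Algebra.Bundles using (CommutativeMonoid; CommutativeSemiring)
import Algebra.Definitions.RawSemiring as RawExp
import Algebra.Properties.CommutativeMonoid.Sum as MonoidSum
import Algebra.Properties.CommutativeSemigroup as CommutativeSemigroup
import Algebra.Properties.Semiring.Exp as Exp
import Algebra.Properties.Semiring.Sum as SemiringSum
import Algebra.Solver.Ring.NaturalCoefficients.Default as RingSolver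
open import Algebra.Structures using (IsCommutativeSemiring)
open import Data.Bool.Base using (Bool; true; false; not)
open import Data.Empty using (⊥-elim)
open import Data.Fin.Base
  using (Fin; zero; suc; toℕ; fromℕ<; funToFin; finToFun; combine; join; splitAt; _↑ˡ_; _↑ʳ_)
open import Data.Fin.Permutation using (Permutation′; permutation)
open import Data.Fin.Properties as Finₚ using
  ( suc-injective; 0≢1+n; toℕ-fromℕ<; toℕ-injective; toℕ<n; ¬∀⟶∃¬; pigeonhole; funToFin-finToFin
  ; finToFun-funToFin; splitAt-↑ˡ; splitAt-↑ʳ; join-splitAt )
open import Data.List.Base using
  (List; []; _∷_; map; length; lookup; filter; tabulate; zipWith; allFin; cartesianProduct)
open import Data.List.Membership.Propositional using (_∈_)
open import Data.List.Membership.Propositional.Properties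
  using (∈-filter⁺; ∈-filter⁻; ∈-cartesianProduct⁺; ∈-allFin; ∈-lookup)
open import Data.List.Properties using (filter-++; length-++; length-zipWith)
open import Data.List.Relation.Unary.All as All using (All; []; _∷_)
open import Data.List.Relation.Unary.AllPairs using ([]; _∷_)
open import Data.List.Relation.Unary.Any using (here; there; index)
open import Data.List.Relation.Unary.Any.Properties using (lookup-index)
open import Data.List.Relation.Unary.Unique.Propositional using (Unique)
import Data.List.Relation.Unary.Unique.Propositional.Properties as Uniqueₚ
open import Data.Nat.Base as ℕ
  using (ℕ; zero; suc; _≤_; _<_; z≤n; s≤s; NonZero; _∸_; ⌊_/2⌋; ⌈_/2⌉)
open import Data.Nat.Coprimality using (prime⇒coprime; coprime-Bézout)
open import Data.Nat.DivMod
import Data.Nat.Divisibility as ℕᵈ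
open import Data.Nat.GCD using (module Bézout)
open import Data.Nat.Primality using (Prime; euclidsLemma; prime⇒nonTrivial; prime⇒irreducible)
import Data.Nat.Properties as ℕₚ
open import Data.Nat.Tactic.RingSolver using (solve-∀)
open import Data.Product using (∃; ∃₂; _×_; _,_; proj₁; proj₂)
open import Data.Sum.Base using (_⊎_; inj₁; inj₂; [_,_]′)
open import Data.Unit.Base using (⊤; tt)
open import Data.Vec.Functional using (_++_)
open import Data.Vec.Functional.Properties using (lookup-++ˡ; lookup-++ʳ)
open import Function.Base using (_∘_)
open import Level using (0ℓ)
open import Relation.Binary.Bundles using (Setoid)
open import Relation.Binary.Definitions using (DecidableEquality; Tri; tri<; tri≈; tri>)
open import Relation.Binary.PropositionalEquality
import Relation.Binary.Reasoning.Setoid as SetoidReasoning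
open import Relation.Nullary using (¬_; Dec; yes; no; _×-dec_)
import Relation.Nullary.Decidable as Dec
open import Relation.Unary using (Pred; Decidable)
open import Algebra.Properties.Semiring.Sum ℕₚ.+-*-semiring using
  (sum; sum-cong-≗; sum-permute; ∑-comm; ∑-distrib-+; *-distribˡ-sum)

-- The curve is handled through polynomials in x alone. An element of the function field is P or y
-- P, and a Boolean records which. Where f(x)^h = ε, the value of ε y^(p+1) = ε f^(h+1) is f(x).
-- Hence the linear conditions do not contain ε, and one choice of the u_a and v_b serves ε = 1 (the
-- curve) and ε = -1 (the twist). The twist supplies the lower bound for N, because the two counts
-- add up to 2p. There are n conditions and n + 1 unknown polynomials, each with about m
-- coefficients. The shifts in degree cost n(n+1)/2 altogether, whence m = n(n+1)/2 + 1. The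
-- restriction n(n+1) ≤ p + 1 gives m - 1 ≤ (p+1)/2, which keeps the leading terms of the two halves
-- of F in different degrees, so that they cannot cancel. Linear algebra is replaced by the
-- pigeonhole principle: two assignments of coefficients with equal conditions are subtracted. The
-- best n is near the square root of p, where (n+1)(p-1+n)/n = p + n + (p-1)/n is about p plus twice
-- that root.

-- Polynomials as coefficient lists over a commutative semiring.

module Polynomials {A : Set} {_+_ _*_ : A → A → A} {0# 1# : A}
  (isCS : IsCommutativeSemiring _≡_ _+_ _*_ 0# 1#) where

  private
    scalars : CommutativeSemiring 0ℓ 0ℓ
    scalars = record { isCommutativeSemiring = isCS }
    module S = CommutativeSemiring scalars
    open CommutativeSemigroup S.+-commutativeSemigroup using (interchange; x∙yz≈y∙xz)

  open RawExp S.rawSemiring using () renaming (_^_ to _^ˢ_) public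

  Poly : Set
  Poly = List A

  infixl 6 _⊕_
  infixl 7 _⊗_ _·_
  infix 4 _≈_

  coef : Poly → ℕ → A
  coef []      i       = 0#
  coef (c ∷ P) zero    = c
  coef (c ∷ P) (suc i) = coef P i

  -- Lists may end in zeros, so propositional equality would be too fine.
  record _≈_ (P Q : Poly) : Set where
    constructor coefwise
    field at : ∀ i → coef P i ≡ coef Q i
  open _≈_ public

  _⊕_ : Poly → Poly → Poly
  []      ⊕ Q       = Q
  (c ∷ P) ⊕ []      = c ∷ P
  (c ∷ P) ⊕ (d ∷ Q) = (c + d) ∷ (P ⊕ Q)

  _·_ : A → Poly → Poly
  c · P = map (c *_) P

  _⊗_ : Poly → Poly → Poly
  []      ⊗ Q = []
  (c ∷ P) ⊗ Q = c · Q ⊕ (0# ∷ P ⊗ Q)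

  const : A → Poly
  const c = c ∷ []

  X : Poly
  X = 0# ∷ 1# ∷ []

  coef-⊕ : ∀ P Q i → coef (P ⊕ Q) i ≡ coef P i + coef Q i
  coef-⊕ []      Q       i       = sym (S.+-identityˡ _)
  coef-⊕ (c ∷ P) []      i       = sym (S.+-identityʳ _)
  coef-⊕ (c ∷ P) (d ∷ Q) zero    = refl
  coef-⊕ (c ∷ P) (d ∷ Q) (suc i) = coef-⊕ P Q i

  coef-· : ∀ c P i → coef (c · P) i ≡ c * coef P i
  coef-· c []      i       = sym (S.zeroʳ c)
  coef-· c (d ∷ P) zero    = refl
  coef-· c (d ∷ P) (suc i) = coef-· c P i

  ≈-refl : ∀ {P} → P ≈ P
  ≈-refl .at i = refl

  ≈-sym : ∀ {P Q} → P ≈ Q → Q ≈ P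
  ≈-sym e .at i = sym (at e i)

  ≈-trans : ∀ {P Q R} → P ≈ Q → Q ≈ R → P ≈ R
  ≈-trans e f .at i = trans (at e i) (at f i)

  ∷-cong : ∀ {c d P Q} → c ≡ d → P ≈ Q → c ∷ P ≈ d ∷ Q
  ∷-cong e f .at zero    = e
  ∷-cong e f .at (suc i) = at f i

  ≈-tail : ∀ {c d P Q} → c ∷ P ≈ d ∷ Q → P ≈ Q
  ≈-tail e .at i = at e (suc i)

  ⊕-cong : ∀ {P P′ Q Q′} → P ≈ P′ → Q ≈ Q′ → P ⊕ Q ≈ P′ ⊕ Q′
  ⊕-cong {P} {P′} {Q} {Q′} e f .at i = begin
    coef (P ⊕ Q) i         ≡⟨ coef-⊕ P Q i ⟩
    coef P i + coef Q i    ≡⟨ cong₂ _+_ (at e i) (at f i) ⟩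
    coef P′ i + coef Q′ i  ≡⟨ coef-⊕ P′ Q′ i ⟨
    coef (P′ ⊕ Q′) i       ∎
    where open ≡-Reasoning

  ⊕-assoc : ∀ P Q R → (P ⊕ Q) ⊕ R ≈ P ⊕ (Q ⊕ R)
  ⊕-assoc P Q R .at i = begin
    coef ((P ⊕ Q) ⊕ R) i               ≡⟨ coef-⊕ (P ⊕ Q) R i ⟩
    coef (P ⊕ Q) i + coef R i          ≡⟨ cong (_+ coef R i) (coef-⊕ P Q i) ⟩
    (coef P i + coef Q i) + coef R i   ≡⟨ S.+-assoc _ _ _ ⟩
    coef P i + (coef Q i + coef R i)   ≡⟨ cong (coef P i +_) (coef-⊕ Q R i) ⟨
    coef P i + coef (Q ⊕ R) i          ≡⟨ coef-⊕ P (Q ⊕ R) i ⟨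
    coef (P ⊕ (Q ⊕ R)) i               ∎
    where open ≡-Reasoning

  ⊕-comm : ∀ P Q → P ⊕ Q ≈ Q ⊕ P
  ⊕-comm P Q .at i = trans (coef-⊕ P Q i) (trans (S.+-comm _ _) (sym (coef-⊕ Q P i)))

  ⊕-identityʳ : ∀ P → P ⊕ [] ≈ P
  ⊕-identityʳ P .at i = trans (coef-⊕ P [] i) (S.+-identityʳ _)

  ⊕-commutativeMonoid : CommutativeMonoid 0ℓ 0ℓ
  ⊕-commutativeMonoid = record
    { Carrier = Poly ; _≈_ = _≈_ ; _∙_ = _⊕_ ; ε = []
    ; isCommutativeMonoid = record
      { isMonoid = record
        { isSemigroup = record
          { isMagma = record
            { isEquivalence = record { refl = ≈-refl ; sym = ≈-sym ; trans = ≈-trans }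
            ; ∙-cong = ⊕-cong }
          ; assoc = ⊕-assoc }
        ; identity = (λ P → ≈-refl) , ⊕-identityʳ }
      ; comm = ⊕-comm } }

  open SetoidReasoning (CommutativeMonoid.setoid ⊕-commutativeMonoid)
  private module ⊕I = CommutativeSemigroup (CommutativeMonoid.commutativeSemigroup ⊕-commutativeMonoid)

  ·-cong : ∀ {c d P Q} → c ≡ d → P ≈ Q → c · P ≈ d · Q
  ·-cong {c} {d} {P} {Q} e f .at i =
    trans (coef-· c P i) (trans (cong₂ _*_ e (at f i)) (sym (coef-· d Q i)))

  ·-distribˡ : ∀ c P Q → c · (P ⊕ Q) ≈ c · P ⊕ c · Q
  ·-distribˡ c P Q .at i = trans (coef-· c (P ⊕ Q) i) (trans (cong (c *_) (coef-⊕ P Q i))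
    (trans (S.distribˡ c _ _) (sym (trans (coef-⊕ (c · P) (c · Q) i)
      (cong₂ _+_ (coef-· c P i) (coef-· c Q i))))))

  ·-distribʳ : ∀ c d P → (c + d) · P ≈ c · P ⊕ d · P
  ·-distribʳ c d P .at i = trans (coef-· (c + d) P i) (trans (S.distribʳ _ c d)
    (sym (trans (coef-⊕ (c · P) (d · P) i) (cong₂ _+_ (coef-· c P i) (coef-· d P i)))))

  ·-assoc : ∀ c d P → (c * d) · P ≈ c · (d · P)
  ·-assoc c d P .at i = trans (coef-· (c * d) P i) (trans (S.*-assoc c d _)
    (sym (trans (coef-· c (d · P) i) (cong (c *_) (coef-· d P i)))))

  ·-zero : ∀ P → 0# · P ≈ []
  ·-zero P .at i = trans (coef-· 0# P i) (S.zeroˡ _)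

  ·-identity : ∀ P → 1# · P ≈ P
  ·-identity P .at i = trans (coef-· 1# P i) (S.*-identityˡ _)

  shift-⊕ : ∀ P Q → 0# ∷ (P ⊕ Q) ≈ (0# ∷ P) ⊕ (0# ∷ Q)
  shift-⊕ P Q = ∷-cong (sym (S.+-identityˡ 0#)) ≈-refl

  shift-zero : 0# ∷ [] ≈ []
  shift-zero .at zero    = refl
  shift-zero .at (suc i) = refl

  ⊗-distribʳ : ∀ P P′ Q → (P ⊕ P′) ⊗ Q ≈ P ⊗ Q ⊕ P′ ⊗ Q
  ⊗-distribʳ []      P′       Q = ≈-refl
  ⊗-distribʳ (c ∷ P) []       Q = ≈-sym (⊕-identityʳ _)
  ⊗-distribʳ (c ∷ P) (d ∷ P′) Q = begin
    (c + d) · Q ⊕ (0# ∷ (P ⊕ P′) ⊗ Q)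
      ≈⟨ ⊕-cong (·-distribʳ c d Q) (≈-trans (∷-cong refl (⊗-distribʳ P P′ Q)) (shift-⊕ (P ⊗ Q) (P′ ⊗ Q))) ⟩
    (c · Q ⊕ d · Q) ⊕ ((0# ∷ P ⊗ Q) ⊕ (0# ∷ P′ ⊗ Q))
      ≈⟨ ⊕I.interchange (c · Q) (d · Q) (0# ∷ P ⊗ Q) (0# ∷ P′ ⊗ Q) ⟩
    (c · Q ⊕ (0# ∷ P ⊗ Q)) ⊕ (d · Q ⊕ (0# ∷ P′ ⊗ Q)) ∎

  ⊗-zeroʳ : ∀ P → P ⊗ [] ≈ []
  ⊗-zeroʳ []      = ≈-refl
  ⊗-zeroʳ (c ∷ P) = ≈-trans (∷-cong refl (⊗-zeroʳ P)) shift-zero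

  -- The recursion of `_⊗_` transposed to the second factor; commutativity then follows by induction
  -- on the first factor.
  ⊗-shiftʳ : ∀ P d Q → P ⊗ (d ∷ Q) ≈ d · P ⊕ (0# ∷ P ⊗ Q)
  ⊗-shiftʳ []      d Q = ≈-sym shift-zero
  ⊗-shiftʳ (c ∷ P) d Q = ∷-cong (cong (_+ 0#) (S.*-comm c d)) (begin
    c · Q ⊕ P ⊗ (d ∷ Q)             ≈⟨ ⊕-cong (≈-refl {c · Q}) (⊗-shiftʳ P d Q) ⟩
    c · Q ⊕ (d · P ⊕ (0# ∷ P ⊗ Q))  ≈⟨ ⊕I.x∙yz≈y∙xz (c · Q) (d · P) (0# ∷ P ⊗ Q) ⟩
    d · P ⊕ (c · Q ⊕ (0# ∷ P ⊗ Q))  ∎)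

  ⊗-comm : ∀ P Q → P ⊗ Q ≈ Q ⊗ P
  ⊗-comm []      Q = ≈-sym (⊗-zeroʳ Q)
  ⊗-comm (c ∷ P) Q =
    ≈-trans (⊕-cong (≈-refl {c · Q}) (∷-cong refl (⊗-comm P Q))) (≈-sym (⊗-shiftʳ Q c P))

  ⊗-congˡ : ∀ P {Q Q′} → Q ≈ Q′ → P ⊗ Q ≈ P ⊗ Q′
  ⊗-congˡ []      e = ≈-refl
  ⊗-congˡ (c ∷ P) e = ⊕-cong (·-cong refl e) (∷-cong refl (⊗-congˡ P e))

  ⊗-cong : ∀ {P P′ Q Q′} → P ≈ P′ → Q ≈ Q′ → P ⊗ Q ≈ P′ ⊗ Q′
  ⊗-cong {P} {P′} {Q} {Q′} e f = begin
    P ⊗ Q    ≈⟨ ⊗-congˡ P f ⟩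
    P ⊗ Q′   ≈⟨ ⊗-comm P Q′ ⟩
    Q′ ⊗ P   ≈⟨ ⊗-congˡ Q′ e ⟩
    Q′ ⊗ P′  ≈⟨ ⊗-comm Q′ P′ ⟩
    P′ ⊗ Q′  ∎

  shift-⊗ : ∀ P Q → (0# ∷ P) ⊗ Q ≈ 0# ∷ P ⊗ Q
  shift-⊗ P Q = ⊕-cong (·-zero Q) (≈-refl {0# ∷ P ⊗ Q})

  ·-⊗ : ∀ c P Q → (c · P) ⊗ Q ≈ c · (P ⊗ Q)
  ·-⊗ c []      Q = ≈-refl
  ·-⊗ c (d ∷ P) Q = begin
    (c * d) · Q ⊕ (0# ∷ (c · P) ⊗ Q)
      ≈⟨ ⊕-cong (·-assoc c d Q) (∷-cong (sym (S.zeroʳ c)) (·-⊗ c P Q)) ⟩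
    c · (d · Q) ⊕ c · (0# ∷ P ⊗ Q)  ≈⟨ ·-distribˡ c (d · Q) (0# ∷ P ⊗ Q) ⟨
    c · (d · Q ⊕ (0# ∷ P ⊗ Q))      ∎

  ⊗-assoc : ∀ P Q R → (P ⊗ Q) ⊗ R ≈ P ⊗ (Q ⊗ R)
  ⊗-assoc []      Q R = ≈-refl
  ⊗-assoc (c ∷ P) Q R = begin
    (c · Q ⊕ (0# ∷ P ⊗ Q)) ⊗ R        ≈⟨ ⊗-distribʳ (c · Q) (0# ∷ P ⊗ Q) R ⟩
    (c · Q) ⊗ R ⊕ (0# ∷ P ⊗ Q) ⊗ R
      ≈⟨ ⊕-cong (·-⊗ c Q R) (≈-trans (shift-⊗ (P ⊗ Q) R) (∷-cong refl (⊗-assoc P Q R))) ⟩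
    c · (Q ⊗ R) ⊕ (0# ∷ P ⊗ (Q ⊗ R))  ∎

  const-⊗ : ∀ c P → const c ⊗ P ≈ c · P
  const-⊗ c P = ≈-trans (⊕-cong (≈-refl {c · P}) shift-zero) (⊕-identityʳ (c · P))

  ⊗-identityˡ : ∀ P → const 1# ⊗ P ≈ P
  ⊗-identityˡ P = ≈-trans (const-⊗ 1# P) (·-identity P)

  polynomials : CommutativeSemiring 0ℓ 0ℓ
  polynomials = record
    { Carrier = Poly ; _≈_ = _≈_ ; _+_ = _⊕_ ; _*_ = _⊗_ ; 0# = [] ; 1# = const 1#
    ; isCommutativeSemiring = record
      { isSemiring = record
        { isSemiringWithoutAnnihilatingZero = record
          { +-isCommutativeMonoid = CommutativeMonoid.isCommutativeMonoid ⊕-commutativeMonoid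
          ; *-cong = ⊗-cong
          ; *-assoc = ⊗-assoc
          ; *-identity = ⊗-identityˡ , λ P → ≈-trans (⊗-comm P _) (⊗-identityˡ P)
          ; distrib = (λ P Q R → ≈-trans (⊗-comm P (Q ⊕ R)) (≈-trans (⊗-distribʳ Q R P)
                        (⊕-cong (⊗-comm Q P) (⊗-comm R P))))
                    , λ P Q R → ⊗-distribʳ Q R P }
        ; zero = (λ P → ≈-refl) , ⊗-zeroʳ }
      ; *-comm = ⊗-comm } }

  private module PS = CommutativeSemiring polynomials
  open Exp PS.semiring public using (_^_; ^-congˡ; ^-homo-*; ^-assocʳ)

  eval : A → Poly → A
  eval x []      = 0#
  eval x (c ∷ P) = c + (x * eval x P)

  eval-⊕ : ∀ x P Q → eval x (P ⊕ Q) ≡ eval x P + eval x Q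
  eval-⊕ x []      Q       = sym (S.+-identityˡ _)
  eval-⊕ x (c ∷ P) []      = sym (S.+-identityʳ _)
  eval-⊕ x (c ∷ P) (d ∷ Q) =
    trans (cong (λ s → (c + d) + (x * s)) (eval-⊕ x P Q))
      (trans (cong ((c + d) +_) (S.distribˡ x _ _)) (interchange c d _ _))

  eval-· : ∀ x c P → eval x (c · P) ≡ c * eval x P
  eval-· x c []      = sym (S.zeroʳ c)
  eval-· x c (d ∷ P) = trans (cong (λ s → (c * d) + (x * s)) (eval-· x c P))
    (trans (cong ((c * d) +_) (x∙yz≈y∙xz* x c _)) (sym (S.distribˡ c d _)))
    where open CommutativeSemigroup S.*-commutativeSemigroup using () renaming (x∙yz≈y∙xz to x∙yz≈y∙xz*)

  eval-⊗ : ∀ x P Q → eval x (P ⊗ Q) ≡ eval x P * eval x Q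
  eval-⊗ x []      Q = sym (S.zeroˡ _)
  eval-⊗ x (c ∷ P) Q =
    trans (eval-⊕ x (c · Q) (0# ∷ P ⊗ Q)) (trans (cong₂ _+_ (eval-· x c Q)
      (trans (S.+-identityˡ _) (trans (cong (x *_) (eval-⊗ x P Q)) (sym (S.*-assoc x _ _)))))
      (sym (S.distribʳ _ c _)))

  eval-zero : ∀ x {P} → P ≈ [] → eval x P ≡ 0#
  eval-zero x {[]}    e = refl
  eval-zero x {c ∷ P} e = trans (cong₂ _+_ (at e 0)
    (trans (cong (x *_) (eval-zero x {P} (coefwise λ i → at e (suc i)))) (S.zeroʳ x))) (S.+-identityˡ 0#)

  eval-cong : ∀ x {P Q} → P ≈ Q → eval x P ≡ eval x Q
  eval-cong x {[]}    {Q}     e = sym (eval-zero x (≈-sym e))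
  eval-cong x {c ∷ P} {[]}    e = eval-zero x e
  eval-cong x {c ∷ P} {d ∷ Q} e =
    cong₂ (λ s t → s + (x * t)) (at e 0) (eval-cong x (≈-tail e))

  eval-const : ∀ x c → eval x (const c) ≡ c
  eval-const x c = trans (cong (c +_) (S.zeroʳ x)) (S.+-identityʳ c)

  eval-X : ∀ x → eval x X ≡ x
  eval-X x = trans (S.+-identityˡ _) (trans (cong (x *_) (eval-const x 1#)) (S.*-identityʳ x))

  eval-^ : ∀ x P n → eval x (P ^ n) ≡ eval x P ^ˢ n
  eval-^ x P zero    = eval-const x 1#
  eval-^ x P (suc n) = trans (eval-⊗ x P (P ^ n)) (cong (eval x P *_) (eval-^ x P n))

  -- The rule `(c + X P)′ = P + X P′`; the multiples of the coefficients emerge in `coef-∂`.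
  ∂ : Poly → Poly
  ∂ []      = []
  ∂ (c ∷ P) = P ⊕ (0# ∷ ∂ P)

  nat : ℕ → A
  nat zero    = 0#
  nat (suc n) = 1# + nat n

  coef-∂ : ∀ P i → coef (∂ P) i ≡ nat (suc i) * coef P (suc i)
  coef-∂ []      i    = sym (S.zeroʳ _)
  coef-∂ (c ∷ P) zero = trans (coef-⊕ P (0# ∷ ∂ P) 0) (trans (S.+-identityʳ _)
    (sym (trans (cong (_* coef P 0) (S.+-identityʳ 1#)) (S.*-identityˡ _))))
  coef-∂ (c ∷ P) (suc i) = trans (coef-⊕ P (0# ∷ ∂ P) (suc i))
    (trans (cong₂ _+_ (sym (S.*-identityˡ _)) (coef-∂ P i)) (sym (S.distribʳ _ _ _)))

  ∂-cong : ∀ {P Q} → P ≈ Q → ∂ P ≈ ∂ Q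
  ∂-cong {P} {Q} e .at i =
    trans (coef-∂ P i) (trans (cong (nat (suc i) *_) (at e (suc i))) (sym (coef-∂ Q i)))

  ∂-⊕ : ∀ P Q → ∂ (P ⊕ Q) ≈ ∂ P ⊕ ∂ Q
  ∂-⊕ P Q .at i = trans (coef-∂ (P ⊕ Q) i) (trans (cong (nat (suc i) *_) (coef-⊕ P Q (suc i)))
    (trans (S.distribˡ _ _ _) (sym (trans (coef-⊕ (∂ P) (∂ Q) i)
      (cong₂ _+_ (coef-∂ P i) (coef-∂ Q i))))))

  ∂-· : ∀ c P → ∂ (c · P) ≈ c · ∂ P
  ∂-· c P .at i = trans (coef-∂ (c · P) i) (trans (cong (nat (suc i) *_) (coef-· c P (suc i)))
    (trans (x∙yz≈y∙xz* _ c _) (sym (trans (coef-· c (∂ P) i) (cong (c *_) (coef-∂ P i))))))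
    where open CommutativeSemigroup S.*-commutativeSemigroup using () renaming (x∙yz≈y∙xz to x∙yz≈y∙xz*)

  ∂-⊗ : ∀ P Q → ∂ (P ⊗ Q) ≈ ∂ P ⊗ Q ⊕ P ⊗ ∂ Q
  ∂-⊗ []      Q = ≈-refl
  ∂-⊗ (c ∷ P) Q = begin
    ∂ (c · Q ⊕ (0# ∷ P ⊗ Q))
      ≈⟨ ∂-⊕ (c · Q) (0# ∷ P ⊗ Q) ⟩
    ∂ (c · Q) ⊕ (P ⊗ Q ⊕ (0# ∷ ∂ (P ⊗ Q)))
      ≈⟨ ⊕-cong (∂-· c Q) (⊕-cong (≈-refl {P ⊗ Q}) (≈-trans (∷-cong refl (∂-⊗ P Q)) (shift-⊕ (∂ P ⊗ Q) (P ⊗ ∂ Q)))) ⟩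
    c · ∂ Q ⊕ (P ⊗ Q ⊕ ((0# ∷ ∂ P ⊗ Q) ⊕ (0# ∷ P ⊗ ∂ Q)))
      ≈⟨ ⊕-cong (≈-refl {c · ∂ Q}) (⊕-assoc (P ⊗ Q) (0# ∷ ∂ P ⊗ Q) (0# ∷ P ⊗ ∂ Q)) ⟨
    c · ∂ Q ⊕ (P ⊗ Q ⊕ (0# ∷ ∂ P ⊗ Q) ⊕ (0# ∷ P ⊗ ∂ Q))
      ≈⟨ ⊕I.x∙yz≈y∙xz (c · ∂ Q) (P ⊗ Q ⊕ (0# ∷ ∂ P ⊗ Q)) (0# ∷ P ⊗ ∂ Q) ⟩
    (P ⊗ Q ⊕ (0# ∷ ∂ P ⊗ Q)) ⊕ (c · ∂ Q ⊕ (0# ∷ P ⊗ ∂ Q))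
      ≈⟨ ⊕-cong (≈-trans (⊗-distribʳ P (0# ∷ ∂ P) Q) (⊕-cong (≈-refl {P ⊗ Q}) (shift-⊗ (∂ P) Q)))
                (≈-refl {c · ∂ Q ⊕ (0# ∷ P ⊗ ∂ Q)}) ⟨
    (P ⊕ (0# ∷ ∂ P)) ⊗ Q ⊕ (c ∷ P) ⊗ ∂ Q ∎

  ∂-const : ∀ c → ∂ (const c) ≈ []
  ∂-const c = shift-zero

  nat-⊕ : ∀ n P → const (nat (suc n)) ⊗ P ≈ P ⊕ const (nat n) ⊗ P
  nat-⊕ n P = begin
    const (nat (suc n)) ⊗ P        ≈⟨ const-⊗ _ P ⟩
    (1# + nat n) · P               ≈⟨ ·-distribʳ 1# (nat n) P ⟩
    1# · P ⊕ nat n · P             ≈⟨ ⊕-cong (·-identity P) (≈-sym (const-⊗ (nat n) P)) ⟩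
    P ⊕ const (nat n) ⊗ P          ∎

  ∂-^ : ∀ P n → ∂ (P ^ suc n) ≈ const (nat (suc n)) ⊗ (P ^ n ⊗ ∂ P)
  ∂-^ P zero = begin
    ∂ (P ⊗ const 1#)                ≈⟨ ∂-cong (PS.*-identityʳ P) ⟩
    ∂ P                             ≈⟨ PS.*-identityˡ (∂ P) ⟨
    P ^ 0 ⊗ ∂ P                     ≈⟨ PS.+-identityʳ (P ^ 0 ⊗ ∂ P) ⟨
    P ^ 0 ⊗ ∂ P ⊕ []                ≈⟨ PS.+-congˡ {P ^ 0 ⊗ ∂ P} (≈-trans (const-⊗ 0# _) (·-zero (P ^ 0 ⊗ ∂ P))) ⟨
    P ^ 0 ⊗ ∂ P ⊕ const 0# ⊗ (P ^ 0 ⊗ ∂ P) ≈⟨ nat-⊕ 0 (P ^ 0 ⊗ ∂ P) ⟨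
    const (nat 1) ⊗ (P ^ 0 ⊗ ∂ P)   ∎
  ∂-^ P (suc n) = begin
    ∂ (P ⊗ P ^ suc n)                                ≈⟨ ∂-⊗ P (P ^ suc n) ⟩
    ∂ P ⊗ P ^ suc n ⊕ P ⊗ ∂ (P ^ suc n)
      ≈⟨ ⊕-cong (⊗-comm (∂ P) (P ^ suc n)) (PS.*-congˡ {P} (∂-^ P n)) ⟩
    P ^ suc n ⊗ ∂ P ⊕ P ⊗ (const (nat (suc n)) ⊗ (P ^ n ⊗ ∂ P))
      ≈⟨ PS.+-congˡ {P ^ suc n ⊗ ∂ P} (⊗I.x∙yz≈y∙xz P (const (nat (suc n))) (P ^ n ⊗ ∂ P)) ⟩
    P ^ suc n ⊗ ∂ P ⊕ const (nat (suc n)) ⊗ (P ⊗ (P ^ n ⊗ ∂ P))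
      ≈⟨ PS.+-congˡ {P ^ suc n ⊗ ∂ P} (PS.*-congˡ {const (nat (suc n))} (PS.*-assoc P (P ^ n) (∂ P))) ⟨
    P ^ suc n ⊗ ∂ P ⊕ const (nat (suc n)) ⊗ (P ^ suc n ⊗ ∂ P) ≈⟨ nat-⊕ (suc n) (P ^ suc n ⊗ ∂ P) ⟨
    const (nat (suc (suc n))) ⊗ (P ^ suc n ⊗ ∂ P)    ∎
    where module ⊗I = CommutativeSemigroup PS.*-commutativeSemigroup

  Bounded : ℕ → Poly → Set
  Bounded n P = ∀ i → n ≤ i → coef P i ≡ 0#

  bounded-⊕ : ∀ {n} P Q → Bounded n P → Bounded n Q → Bounded n (P ⊕ Q)
  bounded-⊕ P Q p q i n≤i =
    trans (coef-⊕ P Q i) (trans (cong₂ _+_ (p i n≤i) (q i n≤i)) (S.+-identityˡ 0#))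

  bounded-≤ : ∀ {m n} P → m ≤ n → Bounded m P → Bounded n P
  bounded-≤ P m≤n p i n≤i = p i (ℕₚ.≤-trans m≤n n≤i)

  bounded-cong : ∀ {n P Q} → P ≈ Q → Bounded n P → Bounded n Q
  bounded-cong e p i n≤i = trans (sym (at e i)) (p i n≤i)

  bounded-zero : ∀ {P} → Bounded 0 P → P ≈ []
  bounded-zero p .at i = p i z≤n

  -- Only degree bounds are assumed, so the coefficients at `s` and `t` may be zero; over a domain,
  -- nonzero ones give the exact degree of the product.
  coef-⊗-top : ∀ s t P Q → Bounded (suc s) P → Bounded (suc t) Q →
    coef (P ⊗ Q) (s ℕ.+ t) ≡ coef P s * coef Q t × Bounded (suc (s ℕ.+ t)) (P ⊗ Q)
  coef-⊗-top s       t []      Q p q = sym (S.zeroˡ _) , λ i _ → refl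
  coef-⊗-top zero    t (c ∷ P) Q p q =
    trans (at scaled t) (coef-· c Q t) ,
    λ i t<i → trans (at scaled i) (trans (coef-· c Q i) (trans (cong (c *_) (q i t<i)) (S.zeroʳ c)))
    where
    scaled : (c ∷ P) ⊗ Q ≈ c · Q
    scaled = ≈-trans (⊗-cong (∷-cong refl (bounded-zero {P} λ i _ → p (suc i) (s≤s z≤n))) (≈-refl {Q}))
      (const-⊗ c Q)
  coef-⊗-top (suc s) t (c ∷ P) Q p q =
    trans (coef-⊕ (c · Q) (0# ∷ P ⊗ Q) (suc (s ℕ.+ t)))
      (trans (cong₂ _+_ (low (suc (s ℕ.+ t)) (s≤s (ℕₚ.m≤n+m t s))) (proj₁ rec)) (S.+-identityˡ _)) ,
    λ { zero () ; (suc i) (s≤s st<i) → trans (coef-⊕ (c · Q) (0# ∷ P ⊗ Q) (suc i))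
      (trans (cong₂ _+_ (low (suc i) (s≤s (ℕₚ.≤-trans (ℕₚ.m≤n+m t s) (ℕₚ.<⇒≤ st<i)))) (proj₂ rec i st<i))
        (S.+-identityˡ 0#)) }
    where
    low : Bounded (suc t) (c · Q)
    low i t<i = trans (coef-· c Q i) (trans (cong (c *_) (q i t<i)) (S.zeroʳ c))
    rec = coef-⊗-top s t P Q (λ i s<i → p (suc i) (s≤s s<i)) q

-- Degrees, division and multiplicities of roots over a domain.

module DomainPolynomials {A : Set} {_+_ _*_ : A → A → A} {0# 1# : A}
  (isCS : IsCommutativeSemiring _≡_ _+_ _*_ 0# 1#)
  (_≟_ : DecidableEquality A)
  (1≢0 : 1# ≢ 0#)
  (-1# : A) (1+-1≡0 : 1# + -1# ≡ 0#)
  (*-nonzero : ∀ {x y} → x ≢ 0# → y ≢ 0# → x * y ≢ 0#) where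

  open Polynomials isCS public

  private
    scalars : CommutativeSemiring 0ℓ 0ℓ
    scalars = record { isCommutativeSemiring = isCS }
    module S = CommutativeSemiring scalars
    module PS = CommutativeSemiring polynomials
    module SolveS = RingSolver scalars
    module SolveP = RingSolver polynomials

  open SetoidReasoning PS.setoid

  -- The scalars are a semiring with a chosen `-1#`: every difference is written `x + (-1# * y)`,
  -- and the remaining identities can be left to a solver for semirings.
  x+-1x≡0 : ∀ x → x + (-1# * x) ≡ 0#
  x+-1x≡0 x = trans (cong (_+ (-1# * x)) (sym (S.*-identityˡ x)))
    (trans (sym (S.distribʳ x 1# -1#)) (trans (cong (_* x) 1+-1≡0) (S.zeroˡ x)))

  x+-1y≡0⇒x≡y : ∀ {x y} → x + (-1# * y) ≡ 0# → x ≡ y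
  x+-1y≡0⇒x≡y {x} {y} e =
    trans (sym (S.+-identityʳ x)) (trans (cong (x +_) (sym (trans (S.+-comm _ y) (x+-1x≡0 y))))
      (trans (sym (S.+-assoc x _ y)) (trans (cong (_+ y) e) (S.+-identityˡ y))))

  -- Exact degree `t`. The zero polynomial has no such `t`, so its degree needs no convention.
  record Top (P : Poly) (t : ℕ) : Set where
    constructor _,_
    field
      leading : coef P t ≢ 0#
      bounded : Bounded (suc t) P
  open Top public

  top? : ∀ P → P ≈ [] ⊎ ∃ (Top P)
  top? []      = inj₁ ≈-refl
  top? (c ∷ P) with top? P
  ... | inj₂ (t , c≢0 , b) = inj₂ (suc t , c≢0 , λ { (suc i) (s≤s t<i) → b i t<i })
  ... | inj₁ P≈0 with c ≟ 0#
  ...   | yes c≡0 = inj₁ (≈-trans (∷-cong c≡0 P≈0) shift-zero)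
  ...   | no  c≢0 = inj₂ (0 , c≢0 , λ { (suc i) _ → at P≈0 i })

  top-cong : ∀ {P Q t} → P ≈ Q → Top P t → Top Q t
  top-cong e (c≢0 , b) = (λ c≡0 → c≢0 (trans (at e _) c≡0)) , bounded-cong e b

  top-⊗ : ∀ {P Q s t} → Top P s → Top Q t → Top (P ⊗ Q) (s ℕ.+ t)
  top-⊗ {P} {Q} {s} {t} (c≢0 , b) (d≢0 , b′) =
    let e , b″ = coef-⊗-top s t P Q b b′
    in (λ z → *-nonzero c≢0 d≢0 (trans (sym e) z)) , b″

  top-unique : ∀ {P s t} → Top P s → Top P t → s ≡ t
  top-unique (c≢0 , b) (d≢0 , b′) =
    ℕₚ.≤-antisym (ℕₚ.≮⇒≥ λ t<s → c≢0 (b′ _ t<s)) (ℕₚ.≮⇒≥ λ s<t → d≢0 (b _ s<t))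

  top⇒≉0 : ∀ {P t} → Top P t → ¬ (P ≈ [])
  top⇒≉0 (c≢0 , _) e = c≢0 (at e _)

  linear : A → Poly
  linear x = (-1# * x) ∷ 1# ∷ []

  top-1 : Top (const 1#) 0
  top-1 = 1≢0 , λ { (suc i) _ → refl }

  top-linear : ∀ x → Top (linear x) 1
  top-linear x = 1≢0 , λ { (suc (suc i)) _ → refl ; (suc zero) (s≤s ()) }

  top-^ : ∀ {P t} → Top P t → ∀ k → Top (P ^ k) (k ℕ.* t)
  top-^ p zero    = top-1
  top-^ p (suc k) = top-⊗ p (top-^ p k)

  eval-linear : ∀ x y → eval y (linear x) ≡ y + (-1# * x)
  eval-linear x y = trans (cong (λ s → (-1# * x) + (y * (1# + s))) (S.zeroʳ y))
    (trans (cong (λ s → (-1# * x) + (y * s)) (S.+-identityʳ 1#))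
      (trans (cong ((-1# * x) +_) (S.*-identityʳ y)) (S.+-comm _ y)))

  eval-linear-self : ∀ x → eval x (linear x) ≡ 0#
  eval-linear-self x = trans (eval-linear x x) (x+-1x≡0 x)

  ∂-linear : ∀ x → ∂ (linear x) ≈ const 1#
  ∂-linear x .at zero          = S.+-identityʳ 1#
  ∂-linear x .at (suc zero)    = refl
  ∂-linear x .at (suc (suc i)) = refl

  -- Horner's scheme: the values at `x` of the successive proper tails of the list are the
  -- coefficients of the quotient by `linear x`, and the value of the entire list is the remainder.
  quotient : A → Poly → Poly
  quotient x []      = []
  quotient x (c ∷ P) = eval x P ∷ quotient x P

  division : ∀ x P → P ≈ linear x ⊗ quotient x P ⊕ const (eval x P)
  division x []      = ≈-sym (≈-trans (⊕-cong (⊗-zeroʳ (linear x)) shift-zero) ≈-refl)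
  division x (c ∷ P) = ≈-sym (≈-trans
    (⊕-cong (⊗-shiftʳ (linear x) (eval x P) (quotient x P)) (≈-refl {const (c + (x * eval x P))}))
    (∷-cong head (begin
      (eval x P * 1# ∷ []) ⊕ linear x ⊗ quotient x P ⊕ []
        ≈⟨ PS.+-identityʳ _ ⟩
      const (eval x P * 1#) ⊕ linear x ⊗ quotient x P
        ≈⟨ ⊕-cong (∷-cong (S.*-identityʳ _) ≈-refl) (≈-refl {linear x ⊗ quotient x P}) ⟩
      const (eval x P) ⊕ linear x ⊗ quotient x P
        ≈⟨ ⊕-comm (const (eval x P)) _ ⟩
      linear x ⊗ quotient x P ⊕ const (eval x P)
        ≈⟨ division x P ⟨
      P ∎)))
    where
    v = eval x P
    head : ((v * (-1# * x)) + 0#) + (c + (x * v)) ≡ c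
    head = trans (SolveS.solve 4 (λ v m x c → v :* (m :* x) :+ con 0 :+ (c :+ x :* v)
                                      := c :+ (x :* v :+ m :* (x :* v))) refl v -1# x c)
      (trans (cong (c +_) (x+-1x≡0 (x * v))) (S.+-identityʳ c))
      where open SolveS using (_:*_; _:+_; _:=_; con)

  root⇒factor : ∀ x P → eval x P ≡ 0# → P ≈ linear x ⊗ quotient x P
  root⇒factor x P e = ≈-trans (division x P) (≈-trans
    (⊕-cong (≈-refl {linear x ⊗ quotient x P}) (≈-trans (∷-cong e ≈-refl) shift-zero)) (⊕-identityʳ _))

  ⊕-cancel : ∀ P Q → P ⊕ -1# · Q ≈ [] → P ≈ Q
  ⊕-cancel P Q e .at i = x+-1y≡0⇒x≡y (trans (cong (coef P i +_) (sym (coef-· -1# Q i)))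
    (trans (sym (coef-⊕ P (-1# · Q) i)) (at e i)))

  ⊕-inverse : ∀ {P Q} → P ≈ Q → P ⊕ -1# · Q ≈ []
  ⊕-inverse {P} {Q} e .at i = trans (coef-⊕ P (-1# · Q) i)
    (trans (cong₂ _+_ (at e i) (coef-· -1# Q i)) (x+-1x≡0 (coef Q i)))

  -- If `P - Q` had a leading term, so would its product with `D`, which is zero.
  ⊗-cancelˡ : ∀ {D t} → Top D t → ∀ P Q → D ⊗ P ≈ D ⊗ Q → P ≈ Q
  ⊗-cancelˡ {D} d P Q e with top? (P ⊕ -1# · Q)
  ... | inj₁ z       = ⊕-cancel P Q z
  ... | inj₂ (s , r) = ⊥-elim (top⇒≉0 (top-⊗ d r) (begin
    D ⊗ (P ⊕ -1# · Q)          ≈⟨ PS.distribˡ D P (-1# · Q) ⟩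
    D ⊗ P ⊕ D ⊗ (-1# · Q)      ≈⟨ PS.+-congˡ {D ⊗ P} (PS.*-congˡ {D} (const-⊗ -1# Q)) ⟨
    D ⊗ P ⊕ D ⊗ (const -1# ⊗ Q) ≈⟨ PS.+-congˡ {D ⊗ P} (SolveP.solve 3 (λ d m q → d :* (m :* q) := m :* (d :* q)) ≈-refl D (const -1#) Q) ⟩
    D ⊗ P ⊕ const -1# ⊗ (D ⊗ Q) ≈⟨ PS.+-congˡ {D ⊗ P} (const-⊗ -1# (D ⊗ Q)) ⟩
    D ⊗ P ⊕ -1# · (D ⊗ Q)      ≈⟨ ⊕-inverse e ⟩
    []                         ∎))
    where open SolveP using (_:*_; _:=_)

  infix 4 _∣_
  record _∣_ (P Q : Poly) : Set where
    constructor divides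
    field
      cofactor : Poly
      equality : Q ≈ P ⊗ cofactor

  ∣-resp : ∀ {P Q R} → Q ≈ R → P ∣ Q → P ∣ R
  ∣-resp e (divides G g) = divides G (≈-trans (≈-sym e) g)

  -- At `y` the factor `linear x` has the nonzero value `y - x`, so `H` vanishes there; one factor
  -- `linear y` is cancelled on both sides and `k` decreases.
  coprime-linear : ∀ {x y} → x ≢ y → ∀ k H → linear y ^ k ∣ linear x ⊗ H → linear y ^ k ∣ H
  coprime-linear x≢y zero H _ = divides H (≈-sym (⊗-identityˡ H))
  coprime-linear {x} {y} x≢y (suc k) H (divides Q e) with eval y H ≟ 0#
  ... | no  Hy≢0 = ⊥-elim (*-nonzero
      (λ z → x≢y (sym (x+-1y≡0⇒x≡y (trans (sym (eval-linear x y)) z)))) Hy≢0 vanish)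
    where
    vanish : eval y (linear x) * eval y H ≡ 0#
    vanish = trans (sym (eval-⊗ y (linear x) H)) (trans (eval-cong y e)
      (trans (eval-⊗ y (linear y ^ suc k) Q) (trans (cong (_* eval y Q)
        (trans (eval-⊗ y (linear y) (linear y ^ k)) (trans (cong (_* eval y (linear y ^ k))
          (eval-linear-self y)) (S.zeroˡ _)))) (S.zeroˡ _))))
  ... | yes Hy≡0 =
    let H₁ = quotient y H
        H≈ = root⇒factor y H Hy≡0
        divides R r = coprime-linear x≢y k H₁ (divides Q (⊗-cancelˡ (top-linear y) (linear x ⊗ H₁) (linear y ^ k ⊗ Q) (begin
          linear y ⊗ (linear x ⊗ H₁)    ≈⟨ SolveP.solve 3 (λ a b c → a :* (b :* c) := b :* (a :* c)) ≈-refl (linear y) (linear x) H₁ ⟩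
          linear x ⊗ (linear y ⊗ H₁)    ≈⟨ PS.*-congˡ {linear x} H≈ ⟨
          linear x ⊗ H                  ≈⟨ e ⟩
          linear y ^ suc k ⊗ Q          ≈⟨ ⊗-assoc (linear y) (linear y ^ k) Q ⟩
          linear y ⊗ (linear y ^ k ⊗ Q) ∎)))
    in divides R (begin
      H                              ≈⟨ H≈ ⟩
      linear y ⊗ H₁                  ≈⟨ PS.*-congˡ {linear y} r ⟩
      linear y ⊗ (linear y ^ k ⊗ R)  ≈⟨ ⊗-assoc (linear y) (linear y ^ k) R ⟨
      linear y ^ suc k ⊗ R           ∎)
    where open SolveP using (_:*_; _:=_)

  coprime-linear^ : ∀ {x y} → x ≢ y → ∀ j k H → linear y ^ k ∣ linear x ^ j ⊗ H → linear y ^ k ∣ H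
  coprime-linear^ x≢y zero    k H d = ∣-resp (⊗-identityˡ H) d
  coprime-linear^ {x} x≢y (suc j) k H d = coprime-linear^ x≢y j k H
    (coprime-linear x≢y k (linear x ^ j ⊗ H) (∣-resp (⊗-assoc (linear x) (linear x ^ j) H) d))

  -- The power at the first root is split off. By coprimality the powers at the other roots divide
  -- the cofactor, whose degree is smaller by `m zero`.
  sum-multiplicities≤degree : ∀ n (x : Fin n → A) → (∀ {i j} → x i ≡ x j → i ≡ j) →
    (m : Fin n → ℕ) → ∀ P {t} → Top P t → (∀ i → linear (x i) ^ m i ∣ P) → sum m ≤ t
  sum-multiplicities≤degree zero    x inj m P     top div = z≤n
  sum-multiplicities≤degree (suc n) x inj m P {t} top div with div zero
  ... | divides G P≈ with top? G
  ...   | inj₁ G≈0 = ⊥-elim (top⇒≉0 top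
    (≈-trans P≈ (≈-trans (PS.*-congˡ {linear (x zero) ^ m zero} G≈0) (⊗-zeroʳ (linear (x zero) ^ m zero)))))
  ...   | inj₂ (s , topG) = subst (sum m ≤_) (sym t≡) (ℕₚ.+-monoʳ-≤ (m zero)
      (sum-multiplicities≤degree n (λ i → x (suc i)) (λ e → suc-injective (inj e)) (λ i → m (suc i)) G topG
        λ i → coprime-linear^ (λ e → 0≢1+n (inj e)) (m zero) (m (suc i)) G (∣-resp P≈ (div (suc i)))))
    where
    t≡ : t ≡ m zero ℕ.+ s
    t≡ = trans (top-unique (top-cong P≈ top) (top-⊗ (top-^ (top-linear (x zero)) (m zero)) topG))
      (cong (ℕ._+ s) (ℕₚ.*-identityʳ (m zero)))

  root⇒linear∣ : ∀ x P → eval x P ≡ 0# → linear x ^ 1 ∣ P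
  root⇒linear∣ x P e = divides (quotient x P) (≈-trans (root⇒factor x P e)
    (⊗-cong (≈-sym (PS.*-identityʳ (linear x))) (≈-refl {quotient x P})))

  top-X : Top X 1
  top-X = 1≢0 , λ { (suc (suc i)) _ → refl ; (suc zero) (s≤s ()) }

  top-⊕ : ∀ {P Q t} → Top P t → Bounded t Q → Top (P ⊕ Q) t
  top-⊕ {P} {Q} {t} (c≢0 , b) b′ =
    (λ z → c≢0 (trans (sym (trans (cong (coef P t +_) (b′ t ℕₚ.≤-refl)) (S.+-identityʳ _)))
      (trans (sym (coef-⊕ P Q t)) z))) ,
    bounded-⊕ P Q b (bounded-≤ Q (ℕₚ.n≤1+n t) b′)

  nat-+ : ∀ m n → nat (m ℕ.+ n) ≡ nat m + nat n
  nat-+ zero    n = sym (S.+-identityˡ _)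
  nat-+ (suc m) n = trans (cong (1# +_) (nat-+ m n)) (sym (S.+-assoc 1# _ _))

  -- The extra factor `P` admits every exponent, zero included, where `∂-^` has a successor.
  ⊗-∂-^ : ∀ P n → P ⊗ ∂ (P ^ n) ≈ const (nat n) ⊗ (P ^ n ⊗ ∂ P)
  ⊗-∂-^ P zero = begin
    P ⊗ ∂ (const 1#)               ≈⟨ PS.*-congˡ {P} (∂-const 1#) ⟩
    P ⊗ []                         ≈⟨ ⊗-zeroʳ P ⟩
    []                             ≈⟨ ·-zero (P ^ 0 ⊗ ∂ P) ⟨
    0# · (P ^ 0 ⊗ ∂ P)             ≈⟨ const-⊗ 0# (P ^ 0 ⊗ ∂ P) ⟨
    const 0# ⊗ (P ^ 0 ⊗ ∂ P)       ∎
  ⊗-∂-^ P (suc n) = begin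
    P ⊗ ∂ (P ^ suc n)                             ≈⟨ PS.*-congˡ {P} (∂-^ P n) ⟩
    P ⊗ (const (nat (suc n)) ⊗ (P ^ n ⊗ ∂ P))
      ≈⟨ SolveP.solve 4 (λ p c q d → p :* (c :* (q :* d)) := c :* ((p :* q) :* d)) ≈-refl
           P (const (nat (suc n))) (P ^ n) (∂ P) ⟩
    const (nat (suc n)) ⊗ (P ^ suc n ⊗ ∂ P)       ∎
    where open SolveP using (_:*_; _:=_)

  -- The sum of the `Y^i u_i`, nested as in Horner's scheme. `Y` is `X ^ p` in the auxiliary
  -- polynomial and `X` once values at rational points are taken.
  linearCombination : Poly → List Poly → Poly
  linearCombination Y []       = []
  linearCombination Y (u ∷ us) = u ⊕ Y ⊗ linearCombination Y us

  eval-linearCombination : ∀ x {Y Z} → eval x Y ≡ eval x Z → ∀ us →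
    eval x (linearCombination Y us) ≡ eval x (linearCombination Z us)
  eval-linearCombination x         e []       = refl
  eval-linearCombination x {Y} {Z} e (u ∷ us) =
    trans (eval-⊕ x u (Y ⊗ linearCombination Y us)) (trans (cong (eval x u +_)
      (trans (eval-⊗ x Y (linearCombination Y us)) (trans (cong₂ _*_ e (eval-linearCombination x e us))
        (sym (eval-⊗ x Z (linearCombination Z us))))))
      (sym (eval-⊕ x u (Z ⊗ linearCombination Z us))))

  -- A cofactor that vanishes at `x` yields one more factor. The hypothesis has the shape in which
  -- the lemmas on the order of vanishing deliver it.
  linear^∣ : ∀ x P n → (∀ k G → k < n → P ≈ linear x ^ k ⊗ G → eval x G ≡ 0#) → linear x ^ n ∣ P
  linear^∣ x P zero    vanish = divides P (≈-sym (⊗-identityˡ P))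
  linear^∣ x P (suc n) vanish with linear^∣ x P n (λ k G k<n → vanish k G (ℕₚ.m≤n⇒m≤1+n k<n))
  ... | divides G e = divides (quotient x G) (begin
    P                                          ≈⟨ e ⟩
    linear x ^ n ⊗ G                           ≈⟨ PS.*-congˡ {linear x ^ n} (root⇒factor x G (vanish n G ℕₚ.≤-refl e)) ⟩
    linear x ^ n ⊗ (linear x ⊗ quotient x G)
      ≈⟨ SolveP.solve 3 (λ a b c → a :* (b :* c) := (b :* a) :* c) ≈-refl (linear x ^ n) (linear x) (quotient x G) ⟩
    linear x ^ suc n ⊗ quotient x G            ∎)
    where open SolveP using (_:*_; _:=_)

  -- The derivation 2y d/dx and orders of vanishing.

  module Derivation (f : Poly) (h : ℕ)
    (characteristic : nat (suc (h ℕ.+ h)) ≡ 0#)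
    (nat≢0 : ∀ {n} → 0 < n → n < suc (h ℕ.+ h) → nat n ≢ 0#) where

    -- The derivation 2y d/dx of the ring of polynomials in x and y with y² = f:
    -- it maps P to y · D true P and y · P to D false P.
    D : Bool → Poly → Poly
    D true  P = ∂ P ⊕ ∂ P
    D false P = f ⊗ (∂ P ⊕ ∂ P) ⊕ ∂ f ⊗ P

    -- The Boolean is the kind of the argument: `true` for `P`, `false` for `y P`. Each application
    -- exchanges the kinds, and `y` itself is never written.
    D^ : ℕ → Bool → Poly → Poly
    D^ zero    e P = P
    D^ (suc j) e P = D^ j (not e) (D e P)

    parity : ℕ → Bool → Bool
    parity zero    e = e
    parity (suc j) e = parity j (not e)

    D-cong : ∀ e {P Q} → P ≈ Q → D e P ≈ D e Q
    D-cong true  z = ⊕-cong (∂-cong z) (∂-cong z)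
    D-cong false z = ⊕-cong (PS.*-congˡ {f} (⊕-cong (∂-cong z) (∂-cong z))) (PS.*-congˡ {∂ f} z)

    D-⊕ : ∀ e P Q → D e (P ⊕ Q) ≈ D e P ⊕ D e Q
    D-⊕ true P Q = begin
      ∂ (P ⊕ Q) ⊕ ∂ (P ⊕ Q)         ≈⟨ ⊕-cong (∂-⊕ P Q) (∂-⊕ P Q) ⟩
      (∂ P ⊕ ∂ Q) ⊕ (∂ P ⊕ ∂ Q)
        ≈⟨ SolveP.solve 2 (λ a b → (a :+ b) :+ (a :+ b) := (a :+ a) :+ (b :+ b)) ≈-refl (∂ P) (∂ Q) ⟩
      D true P ⊕ D true Q           ∎
      where open SolveP using (_:+_; _:=_)
    D-⊕ false P Q = begin
      f ⊗ D true (P ⊕ Q) ⊕ ∂ f ⊗ (P ⊕ Q)           ≈⟨ PS.+-congʳ (PS.*-congˡ {f} (D-⊕ true P Q)) ⟩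
      f ⊗ (D true P ⊕ D true Q) ⊕ ∂ f ⊗ (P ⊕ Q)
        ≈⟨ SolveP.solve 6 (λ f a b d p q → f :* (a :+ b) :+ d :* (p :+ q)
             := (f :* a :+ d :* p) :+ (f :* b :+ d :* q)) ≈-refl f (D true P) (D true Q) (∂ f) P Q ⟩
      D false P ⊕ D false Q                        ∎
      where open SolveP using (_:+_; _:*_; _:=_)

    -- Elements with zero derivative, namely constants and `X ^ p`, act as scalars.
    D-constant : ∀ e {C} → ∂ C ≈ [] → ∀ P → D e (C ⊗ P) ≈ C ⊗ D e P
    D-constant true {C} z P = begin
      ∂ (C ⊗ P) ⊕ ∂ (C ⊗ P)   ≈⟨ ⊕-cong constant constant ⟩
      C ⊗ ∂ P ⊕ C ⊗ ∂ P       ≈⟨ PS.distribˡ C (∂ P) (∂ P) ⟨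
      C ⊗ D true P            ∎
      where
      constant : ∂ (C ⊗ P) ≈ C ⊗ ∂ P
      constant = ≈-trans (∂-⊗ C P) (PS.+-congʳ (PS.*-congʳ {P} z))
    D-constant false {C} z P = begin
      f ⊗ D true (C ⊗ P) ⊕ ∂ f ⊗ (C ⊗ P)    ≈⟨ PS.+-congʳ {∂ f ⊗ (C ⊗ P)} (PS.*-congˡ {f} (D-constant true {C} z P)) ⟩
      f ⊗ (C ⊗ D true P) ⊕ ∂ f ⊗ (C ⊗ P)
        ≈⟨ SolveP.solve 5 (λ f c a d p → f :* (c :* a) :+ d :* (c :* p) := c :* (f :* a :+ d :* p))
             ≈-refl f C (D true P) (∂ f) P ⟩
      C ⊗ D false P                         ∎
      where open SolveP using (_:+_; _:*_; _:=_)

    D^-cong : ∀ j e {P Q} → P ≈ Q → D^ j e P ≈ D^ j e Q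
    D^-cong zero    e z = z
    D^-cong (suc j) e z = D^-cong j (not e) (D-cong e z)

    D^-⊕ : ∀ j e P Q → D^ j e (P ⊕ Q) ≈ D^ j e P ⊕ D^ j e Q
    D^-⊕ zero    e P Q = ≈-refl
    D^-⊕ (suc j) e P Q = ≈-trans (D^-cong j (not e) (D-⊕ e P Q)) (D^-⊕ j (not e) (D e P) (D e Q))

    D^-constant : ∀ j e {C} → ∂ C ≈ [] → ∀ P → D^ j e (C ⊗ P) ≈ C ⊗ D^ j e P
    D^-constant zero    e z P = ≈-refl
    D^-constant (suc j) e {C} z P =
      ≈-trans (D^-cong j (not e) (D-constant e {C} z P)) (D^-constant j (not e) {C} z (D e P))

    D^-[] : ∀ j e → D^ j e [] ≈ []
    D^-[] zero    e     = ≈-refl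
    D^-[] (suc j) true  = D^-[] j false
    D^-[] (suc j) false = ≈-trans (D^-cong j true
      (⊕-cong (⊗-zeroʳ f) (⊗-zeroʳ (∂ f)))) (D^-[] j true)

    D^-linearCombination : ∀ j e {Y} → ∂ Y ≈ [] → ∀ us →
      D^ j e (linearCombination Y us) ≈ linearCombination Y (map (D^ j e) us)
    D^-linearCombination j e     z []       = D^-[] j e
    D^-linearCombination j e {Y} z (u ∷ us) = begin
      D^ j e (u ⊕ Y ⊗ linearCombination Y us)
        ≈⟨ D^-⊕ j e u (Y ⊗ linearCombination Y us) ⟩
      D^ j e u ⊕ D^ j e (Y ⊗ linearCombination Y us)
        ≈⟨ PS.+-congˡ {D^ j e u} (≈-trans (D^-constant j e {Y} z (linearCombination Y us))
             (PS.*-congˡ {Y} (D^-linearCombination j e z us))) ⟩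
      D^ j e u ⊕ Y ⊗ linearCombination Y (map (D^ j e) us) ∎

    -- f^h times y to an odd (true) or even (false) power: as y^p = y f^h is killed by
    -- the derivation, D passes through these factors.
    twist : Bool → Poly
    twist true  = f ^ suc h
    twist false = f ^ h

    2·nat[1+h]≡1 : nat (suc h) + nat (suc h) ≡ 1#
    2·nat[1+h]≡1 = trans (sym (nat-+ (suc h) (suc h))) (trans
      (cong (λ n → nat (suc n)) (ℕₚ.+-suc h h)) (trans (cong (1# +_) characteristic) (S.+-identityʳ 1#)))

    -- With `y^p = y f^h`, the two cases are the derivatives of `y^p · y V` and of `y^p V`. The
    -- terms in which the power of `f` is differentiated come out right because `2 (h + 1) = 1` and
    -- `2 h + 1 = 0` in characteristic `p`.
    D-twist : ∀ e V → D e (twist e ⊗ V) ≈ twist (not e) ⊗ D (not e) V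
    D-twist true V = begin
      ∂ (f ^ suc h ⊗ V) ⊕ ∂ (f ^ suc h ⊗ V)
        ≈⟨ ⊕-cong once once ⟩
      (c ⊗ (g ⊗ f′) ⊗ V ⊕ f ⊗ g ⊗ V′) ⊕ (c ⊗ (g ⊗ f′) ⊗ V ⊕ f ⊗ g ⊗ V′)
        ≈⟨ SolveP.solve 6 (λ c g f′ v f v′ →
             (c :* (g :* f′) :* v :+ f :* g :* v′) :+ (c :* (g :* f′) :* v :+ f :* g :* v′)
             := g :* (f :* (v′ :+ v′) :+ (c :+ c) :* (f′ :* v))) ≈-refl c g f′ V f V′ ⟩
      g ⊗ (f ⊗ (V′ ⊕ V′) ⊕ (c ⊕ c) ⊗ (f′ ⊗ V))
        ≈⟨ PS.*-congˡ {g} (PS.+-congˡ {f ⊗ (V′ ⊕ V′)} (PS.*-congʳ {f′ ⊗ V} (∷-cong 2·nat[1+h]≡1 (≈-refl {[]})))) ⟩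
      g ⊗ (f ⊗ (V′ ⊕ V′) ⊕ const 1# ⊗ (f′ ⊗ V))
        ≈⟨ PS.*-congˡ {g} (PS.+-congˡ {f ⊗ (V′ ⊕ V′)} (⊗-identityˡ (f′ ⊗ V))) ⟩
      g ⊗ D false V ∎
      where
      open SolveP using (_:+_; _:*_; _:=_)
      c = const (nat (suc h))
      g = f ^ h
      f′ = ∂ f
      V′ = ∂ V
      once : ∂ (f ^ suc h ⊗ V) ≈ c ⊗ (g ⊗ f′) ⊗ V ⊕ f ⊗ g ⊗ V′
      once = ≈-trans (∂-⊗ (f ^ suc h) V) (PS.+-congʳ (PS.*-congʳ {V} (∂-^ f h)))
    D-twist false V = begin
      f ⊗ (∂ (g ⊗ V) ⊕ ∂ (g ⊗ V)) ⊕ f′ ⊗ (g ⊗ V)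
        ≈⟨ PS.+-congʳ (PS.*-congˡ {f} (⊕-cong (∂-⊗ g V) (∂-⊗ g V))) ⟩
      f ⊗ ((g′ ⊗ V ⊕ g ⊗ V′) ⊕ (g′ ⊗ V ⊕ g ⊗ V′)) ⊕ f′ ⊗ (g ⊗ V)
        ≈⟨ SolveP.solve 6 (λ f g′ v g v′ f′ →
             f :* ((g′ :* v :+ g :* v′) :+ (g′ :* v :+ g :* v′)) :+ f′ :* (g :* v)
             := (f :* g) :* (v′ :+ v′) :+ ((f :* g′) :* v :+ (f :* g′) :* v :+ (g :* f′) :* v))
             ≈-refl f g′ V g V′ f′ ⟩
      (f ⊗ g) ⊗ D true V ⊕ ((f ⊗ g′) ⊗ V ⊕ (f ⊗ g′) ⊗ V ⊕ (g ⊗ f′) ⊗ V)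
        ≈⟨ PS.+-congˡ {(f ⊗ g) ⊗ D true V} (PS.+-congʳ (⊕-cong expand expand)) ⟩
      (f ⊗ g) ⊗ D true V ⊕ (c ⊗ (g ⊗ f′) ⊗ V ⊕ c ⊗ (g ⊗ f′) ⊗ V ⊕ (g ⊗ f′) ⊗ V)
        ≈⟨ PS.+-congˡ {(f ⊗ g) ⊗ D true V} (SolveP.solve 3 (λ c w v →
             c :* w :* v :+ c :* w :* v :+ w :* v := (con 1 :+ (c :+ c)) :* (w :* v)) ≈-refl c (g ⊗ f′) V) ⟩
      (f ⊗ g) ⊗ D true V ⊕ (const 1# ⊕ (c ⊕ c)) ⊗ ((g ⊗ f′) ⊗ V)
        ≈⟨ PS.+-congˡ {(f ⊗ g) ⊗ D true V} (PS.*-congʳ {(g ⊗ f′) ⊗ V} (≈-trans (∷-cong vanish (≈-refl {[]})) shift-zero)) ⟩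
      (f ⊗ g) ⊗ D true V ⊕ []
        ≈⟨ ⊕-identityʳ _ ⟩
      (f ⊗ g) ⊗ D true V ∎
      where
      open SolveP using (_:+_; _:*_; _:=_; con)
      c = const (nat h)
      g = f ^ h
      g′ = ∂ g
      f′ = ∂ f
      V′ = ∂ V
      vanish : 1# + (nat h + nat h) ≡ 0#
      vanish = trans (cong (1# +_) (sym (nat-+ h h))) characteristic
      expand : (f ⊗ g′) ⊗ V ≈ c ⊗ (g ⊗ f′) ⊗ V
      expand = PS.*-congʳ {V} (⊗-∂-^ f h)

    D^-twist : ∀ j e V → D^ j e (twist e ⊗ V) ≈ twist (parity j e) ⊗ D^ j (not e) V
    D^-twist zero    e V = ≈-refl
    D^-twist (suc j) e V =
      ≈-trans (D^-cong j (not e) (D-twist e V)) (D^-twist j (not e) (D (not e) V))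

    private
      ∂-linear^ : ∀ x i G → ∂ (linear x ^ suc i ⊗ G) ≈
        linear x ^ i ⊗ (const (nat (suc i)) ⊗ G ⊕ linear x ⊗ ∂ G)
      ∂-linear^ x i G = begin
        ∂ (L ^ suc i ⊗ G)                        ≈⟨ ∂-⊗ (L ^ suc i) G ⟩
        ∂ (L ^ suc i) ⊗ G ⊕ L ^ suc i ⊗ ∂ G      ≈⟨ PS.+-congʳ (PS.*-congʳ {G} (≈-trans (∂-^ L i)
                                                       (PS.*-congˡ {c} (PS.*-congˡ {L ^ i} (∂-linear x))))) ⟩
        c ⊗ (L ^ i ⊗ const 1#) ⊗ G ⊕ L ⊗ L ^ i ⊗ ∂ G
          ≈⟨ SolveP.solve 5 (λ c l g l₁ d → c :* (l :* con 1) :* g :+ l₁ :* l :* d := l :* (c :* g :+ l₁ :* d))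
               ≈-refl c (L ^ i) G L (∂ G) ⟩
        L ^ i ⊗ (c ⊗ G ⊕ L ⊗ ∂ G)                ∎
        where
        open SolveP using (_:+_; _:*_; _:=_; con)
        L = linear x
        c = const (nat (suc i))

      reduced : ∀ x i G → Poly
      reduced x i G = const (nat (suc i)) ⊗ G ⊕ linear x ⊗ ∂ G

      eval-linear⊗ : ∀ x P → eval x (linear x ⊗ P) ≡ 0#
      eval-linear⊗ x P = trans (eval-⊗ x (linear x) P)
        (trans (cong (_* eval x P) (eval-linear-self x)) (S.zeroˡ _))

      eval-reduced : ∀ x i G → eval x (reduced x i G) ≡ nat (suc i) * eval x G
      eval-reduced x i G = trans (eval-⊕ x (const (nat (suc i)) ⊗ G) (linear x ⊗ ∂ G)) (trans
        (cong₂ _+_ (trans (eval-⊗ x (const (nat (suc i))) G) (cong (_* eval x G) (eval-const x (nat (suc i)))))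
          (eval-linear⊗ x (∂ G))) (S.+-identityʳ _))

      D-true-linear^ : ∀ x i G → D true (linear x ^ suc i ⊗ G) ≈ linear x ^ i ⊗ (reduced x i G ⊕ reduced x i G)
      D-true-linear^ x i G = ≈-trans (⊕-cong (∂-linear^ x i G) (∂-linear^ x i G))
        (≈-sym (PS.distribˡ (linear x ^ i) (reduced x i G) (reduced x i G)))

      D-false-linear^ : ∀ x i G → D false (linear x ^ suc i ⊗ G) ≈
        linear x ^ i ⊗ (f ⊗ (reduced x i G ⊕ reduced x i G) ⊕ linear x ⊗ (∂ f ⊗ G))
      D-false-linear^ x i G = begin
        f ⊗ D true (L ^ suc i ⊗ G) ⊕ ∂ f ⊗ (L ^ suc i ⊗ G)
          ≈⟨ PS.+-congʳ (PS.*-congˡ {f} (D-true-linear^ x i G)) ⟩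
        f ⊗ (L ^ i ⊗ (E ⊕ E)) ⊕ ∂ f ⊗ (L ⊗ L ^ i ⊗ G)
          ≈⟨ SolveP.solve 6 (λ f l e d l₁ g → f :* (l :* e) :+ d :* (l₁ :* l :* g)
               := l :* (f :* e :+ l₁ :* (d :* g))) ≈-refl f (L ^ i) (E ⊕ E) (∂ f) L G ⟩
        L ^ i ⊗ (f ⊗ (E ⊕ E) ⊕ L ⊗ (∂ f ⊗ G)) ∎
        where
        open SolveP using (_:+_; _:*_; _:=_)
        L = linear x
        E = reduced x i G

      cancel-≢0 : ∀ {c y} → c ≢ 0# → c * y ≡ 0# → y ≡ 0#
      cancel-≢0 {c} {y} c≢0 z with y ≟ 0#
      ... | yes e  = e
      ... | no y≢0 = ⊥-elim (*-nonzero c≢0 y≢0 z)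

      double : ∀ y → y + y ≡ nat 2 * y
      double y = sym (trans (cong (λ s → (1# + s) * y) (S.+-identityʳ 1#))
        (trans (S.distribʳ y 1# 1#) (cong₂ _+_ (S.*-identityˡ y) (S.*-identityˡ y))))

      twice≡0 : ∀ {y} → 2 < suc (h ℕ.+ h) → y + y ≡ 0# → y ≡ 0#
      twice≡0 {y} 2<p z = cancel-≢0 (nat≢0 (s≤s z≤n) 2<p) (trans (sym (double y)) z)

      eval-twice-reduced : ∀ x i G → 2 < suc (h ℕ.+ h) → suc i < suc (h ℕ.+ h) →
        eval x (reduced x i G ⊕ reduced x i G) ≡ 0# → eval x G ≡ 0#
      eval-twice-reduced x i G 2<p i<p z = cancel-≢0 (nat≢0 (s≤s z≤n) i<p)
        (trans (sym (eval-reduced x i G)) (twice≡0 2<p (trans (sym (eval-⊕ x (reduced x i G) (reduced x i G))) z)))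

    -- Where `f(x)` is nonzero, the derivation lowers the exponent of `linear x` by one and
    -- multiplies the value of the cofactor by twice that exponent, and for kind `false` also by
    -- `f(x)`. These factors are units below `p`, so the value after `i` steps is a nonzero multiple
    -- of `G(x)`.
    vanishing-order : 2 < suc (h ℕ.+ h) → ∀ x → eval x f ≢ 0# → ∀ i e G → i < suc (h ℕ.+ h) →
      eval x (D^ i e (linear x ^ i ⊗ G)) ≡ 0# → eval x G ≡ 0#
    vanishing-order 2<p x fx≢0 zero e G i<p z = trans (eval-cong x (≈-sym (⊗-identityˡ G))) z
    vanishing-order 2<p x fx≢0 (suc i) true G i<p z = eval-twice-reduced x i G 2<p i<p
      (vanishing-order 2<p x fx≢0 i false (reduced x i G ⊕ reduced x i G) (ℕₚ.<-trans ℕₚ.≤-refl i<p)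
        (trans (eval-cong x (D^-cong i false (≈-sym (D-true-linear^ x i G)))) z))
    vanishing-order 2<p x fx≢0 (suc i) false G i<p z = eval-twice-reduced x i G 2<p i<p
      (cancel-≢0 fx≢0 (trans (sym (trans (eval-⊕ x (f ⊗ EE) (linear x ⊗ (∂ f ⊗ G)))
        (trans (cong₂ _+_ (eval-⊗ x f EE) (eval-linear⊗ x (∂ f ⊗ G))) (S.+-identityʳ _))))
        (vanishing-order 2<p x fx≢0 i true (f ⊗ EE ⊕ linear x ⊗ (∂ f ⊗ G)) (ℕₚ.<-trans ℕₚ.≤-refl i<p)
          (trans (eval-cong x (D^-cong i true (≈-sym (D-false-linear^ x i G)))) z))))
      where EE = reduced x i G ⊕ reduced x i G

    -- At a simple zero of f the local parameter is y, and x - x₀ vanishes to order two.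
    vanishing-order-root : 2 < suc (h ℕ.+ h) → ∀ x → eval x f ≡ 0# → eval x (∂ f) ≢ 0# → ∀ i G →
      i ℕ.+ i < suc (h ℕ.+ h) →
      eval x (D^ (i ℕ.+ i) true (linear x ^ i ⊗ G)) ≡ 0# → eval x G ≡ 0#
    vanishing-order-root 2<p x fx≡0 f′x≢0 zero G i<p z = trans (eval-cong x (≈-sym (⊗-identityˡ G))) z
    vanishing-order-root 2<p x fx≡0 f′x≢0 (suc i) G i<p z =
      eval-twice-reduced x i G 2<p (ℕₚ.≤-<-trans (ℕₚ.m≤m+n (suc i) (suc i)) i<p)
        (cancel-≢0 f′x≢0 (cancel-≢0 (nat≢0 {suc (i ℕ.+ i)} (s≤s z≤n) (ℕₚ.<-trans ℕₚ.≤-refl 2i<p)) (trans (sym factored)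
          (vanishing-order-root 2<p x fx≡0 f′x≢0 i T (ℕₚ.<-trans ℕₚ.≤-refl (ℕₚ.<-trans ℕₚ.≤-refl 2i<p))
            (trans (eval-cong x (D^-cong (i ℕ.+ i) true (≈-sym step)))
              (subst (λ j → eval x (D^ j true (linear x ^ suc i ⊗ G)) ≡ 0#) (cong suc (ℕₚ.+-suc i i)) z))))))
      where
      open SolveP using (_:+_; _:*_; _:=_; con)
      2i<p : suc (suc (i ℕ.+ i)) < suc (h ℕ.+ h)
      2i<p = subst (_< suc (h ℕ.+ h)) (cong suc (ℕₚ.+-suc i i)) i<p
      L = linear x
      f₁ = quotient x f
      f≈ : f ≈ L ⊗ f₁
      f≈ = root⇒factor x f fx≡0
      E = reduced x i G ⊕ reduced x i G
      c = const (nat i)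
      T = (c ⊗ f₁ ⊗ E ⊕ c ⊗ f₁ ⊗ E ⊕ L ⊗ (f₁ ⊗ (∂ E ⊕ ∂ E))) ⊕ ∂ f ⊗ E
      L∂ : L ⊗ ∂ (L ^ i) ≈ c ⊗ L ^ i
      L∂ = ≈-trans (⊗-∂-^ L i) (PS.*-congˡ {c} (≈-trans (PS.*-congˡ {L ^ i} (∂-linear x)) (PS.*-identityʳ (L ^ i))))
      step : D false (D true (L ^ suc i ⊗ G)) ≈ L ^ i ⊗ T
      step = begin
        D false (D true (L ^ suc i ⊗ G))   ≈⟨ D-cong false (D-true-linear^ x i G) ⟩
        f ⊗ (∂ (L ^ i ⊗ E) ⊕ ∂ (L ^ i ⊗ E)) ⊕ ∂ f ⊗ (L ^ i ⊗ E)
          ≈⟨ PS.+-congʳ (⊗-cong f≈ (⊕-cong (∂-⊗ (L ^ i) E) (∂-⊗ (L ^ i) E))) ⟩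
        (L ⊗ f₁) ⊗ ((∂ (L ^ i) ⊗ E ⊕ L ^ i ⊗ ∂ E) ⊕ (∂ (L ^ i) ⊗ E ⊕ L ^ i ⊗ ∂ E)) ⊕ ∂ f ⊗ (L ^ i ⊗ E)
          ≈⟨ SolveP.solve 7 (λ l f₁ d e l^ e′ f′ →
               (l :* f₁) :* ((d :* e :+ l^ :* e′) :+ (d :* e :+ l^ :* e′)) :+ f′ :* (l^ :* e)
               := ((l :* d) :* (f₁ :* e) :+ (l :* d) :* (f₁ :* e) :+ l^ :* (l :* (f₁ :* (e′ :+ e′)))) :+ l^ :* (f′ :* e))
               ≈-refl L f₁ (∂ (L ^ i)) E (L ^ i) (∂ E) (∂ f) ⟩
        ((L ⊗ ∂ (L ^ i)) ⊗ (f₁ ⊗ E) ⊕ (L ⊗ ∂ (L ^ i)) ⊗ (f₁ ⊗ E) ⊕ L ^ i ⊗ (L ⊗ (f₁ ⊗ (∂ E ⊕ ∂ E)))) ⊕ L ^ i ⊗ (∂ f ⊗ E)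
          ≈⟨ PS.+-congʳ (PS.+-congʳ (⊕-cong (PS.*-congʳ {f₁ ⊗ E} L∂) (PS.*-congʳ {f₁ ⊗ E} L∂))) ⟩
        ((c ⊗ L ^ i) ⊗ (f₁ ⊗ E) ⊕ (c ⊗ L ^ i) ⊗ (f₁ ⊗ E) ⊕ L ^ i ⊗ (L ⊗ (f₁ ⊗ (∂ E ⊕ ∂ E)))) ⊕ L ^ i ⊗ (∂ f ⊗ E)
          ≈⟨ SolveP.solve 7 (λ c l^ f₁ e l d f′ →
               ((c :* l^) :* (f₁ :* e) :+ (c :* l^) :* (f₁ :* e) :+ l^ :* (l :* (f₁ :* d))) :+ l^ :* (f′ :* e)
               := l^ :* ((c :* f₁ :* e :+ c :* f₁ :* e :+ l :* (f₁ :* d)) :+ f′ :* e))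
               ≈-refl c (L ^ i) f₁ E L (∂ E ⊕ ∂ E) (∂ f) ⟩
        L ^ i ⊗ T ∎
      f′x : eval x (∂ f) ≡ eval x f₁
      f′x = trans (eval-cong x (≈-trans (∂-cong f≈) (∂-⊗ L f₁)))
        (trans (eval-⊕ x (∂ L ⊗ f₁) (L ⊗ ∂ f₁)) (trans (cong₂ _+_
          (eval-cong x (≈-trans (PS.*-congʳ {f₁} (∂-linear x)) (⊗-identityˡ f₁))) (eval-linear⊗ x (∂ f₁))) (S.+-identityʳ _)))
      evalcE : eval x (c ⊗ f₁ ⊗ E) ≡ (nat i * eval x (∂ f)) * eval x E
      evalcE = trans (eval-⊗ x (c ⊗ f₁) E) (cong (_* eval x E)
        (trans (eval-⊗ x c f₁) (cong₂ _*_ (eval-const x (nat i)) (sym f′x))))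
      -- As `f₁` and `∂ f` agree at `x`, the two terms with `c` and the term `∂ f ⊗ E` add up to the
      -- factor `2 i + 1`, which is nonzero because it is below `p`.
      factored : eval x T ≡ nat (suc (i ℕ.+ i)) * (eval x (∂ f) * eval x E)
      factored = trans (eval-⊕ x (c ⊗ f₁ ⊗ E ⊕ c ⊗ f₁ ⊗ E ⊕ L ⊗ (f₁ ⊗ (∂ E ⊕ ∂ E))) (∂ f ⊗ E)) (trans
        (cong₂ _+_ (trans (eval-⊕ x (c ⊗ f₁ ⊗ E ⊕ c ⊗ f₁ ⊗ E) (L ⊗ (f₁ ⊗ (∂ E ⊕ ∂ E))))
          (cong₂ _+_ (trans (eval-⊕ x (c ⊗ f₁ ⊗ E) (c ⊗ f₁ ⊗ E)) (cong₂ _+_ evalcE evalcE))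
            (eval-linear⊗ x (f₁ ⊗ (∂ E ⊕ ∂ E))))) (eval-⊗ x (∂ f) E))
        (trans (SolveS.solve 3 (λ n d e → ((n S:* d) S:* e S:+ (n S:* d) S:* e) S:+ Scon 0 S:+ d S:* e
            S:= (Scon 1 S:+ (n S:+ n)) S:* (d S:* e)) refl (nat i) (eval x (∂ f)) (eval x E))
          (cong (λ s → (1# + s) * (eval x (∂ f) * eval x E)) (sym (nat-+ i i)))))
        where open SolveS using () renaming (_:+_ to _S:+_; _:*_ to _S:*_; _:=_ to _S:=_; con to Scon)

  -- deg P + c < m, without truncated subtraction.
  Below : ℕ → ℕ → Poly → Set
  Below m c P = ∀ i → m ≤ i ℕ.+ c → coef P i ≡ 0#

  below-cong : ∀ {m c P Q} → P ≈ Q → Below m c P → Below m c Q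
  below-cong e b i le = trans (sym (at e i)) (b i le)

  below-⊕ : ∀ {m c} P Q → Below m c P → Below m c Q → Below m c (P ⊕ Q)
  below-⊕ P Q p q i le = trans (coef-⊕ P Q i) (trans (cong₂ _+_ (p i le) (q i le)) (S.+-identityˡ 0#))

  below-· : ∀ {m c} d P → Below m c P → Below m c (d · P)
  below-· d P b i le = trans (coef-· d P i) (trans (cong (d *_) (b i le)) (S.zeroʳ d))

  below-∂ : ∀ {m c} P → Below m c P → Below m (suc c) (∂ P)
  below-∂ {m} {c} P b i le =
    trans (coef-∂ P i) (trans (cong (nat (suc i) *_) (b (suc i) (subst (m ≤_) (ℕₚ.+-suc i c) le))) (S.zeroʳ _))

  below-reduce : ∀ k {m c} P → Below (k ℕ.+ m) (k ℕ.+ c) P → Below m c P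
  below-reduce k {m} {c} P b i le = b i (subst (k ℕ.+ m ≤_) (x∙yz≈y∙xz k i c) (ℕₚ.+-monoʳ-≤ k le))
    where open CommutativeSemigroup ℕₚ.+-commutativeSemigroup using (x∙yz≈y∙xz)

  -- The degree of `Q` is at most `length Q - 1`; the one is moved to the other side, into `suc c`.
  below-⊗ : ∀ {m c} Q P → Below m c P → Below (length Q ℕ.+ m) (suc c) (Q ⊗ P)
  below-⊗         []      P b i       le = refl
  below-⊗ {m} {c} (d ∷ Q) P b i       le = trans (coef-⊕ (d · P) (0# ∷ Q ⊗ P) i)
    (trans (cong₂ _+_ (below-· d P b i (ℕₚ.≤-trans (ℕₚ.m≤n+m m (length Q)) (le′ i le))) (shifted i le)) (S.+-identityˡ 0#))
    where
    le′ : ∀ i → suc (length Q ℕ.+ m) ≤ i ℕ.+ suc c → length Q ℕ.+ m ≤ i ℕ.+ c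
    le′ i le = ℕₚ.≤-pred (subst (suc (length Q ℕ.+ m) ≤_) (ℕₚ.+-suc i c) le)
    shifted : ∀ i → suc (length Q ℕ.+ m) ≤ i ℕ.+ suc c → coef (0# ∷ Q ⊗ P) i ≡ 0#
    shifted zero    le = refl
    shifted (suc i) le = below-⊗ Q P b i (ℕₚ.≤-pred le)

  below-X⊗ : ∀ {m c} P → Below m (suc c) P → Below m c (X ⊗ P)
  below-X⊗ P b = below-reduce 2 (X ⊗ P) (below-⊗ X P b)

  -- The bounded quantity is `deg u_i + i`, the degree of a summand once `Y` is replaced by `X`. The
  -- offset `c` starts at 0 for the `u_a` and at 3 for the `v_b`, since `y^p · y` becomes `y² = f`.
  BelowAll : ℕ → ℕ → List Poly → Set
  BelowAll m c []       = ⊤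
  BelowAll m c (u ∷ us) = Below m c u × BelowAll m (suc c) us

  below-linearCombination : ∀ {m c} us → BelowAll m c us → Below m c (linearCombination X us)
  below-linearCombination []       _        i le = refl
  below-linearCombination (u ∷ us) (b , bs) =
    below-⊕ u (X ⊗ linearCombination X us) b
      (below-X⊗ (linearCombination X us) (below-linearCombination us bs))

  linearCombination-zero : ∀ Y {us} → All (_≈ []) us → linearCombination Y us ≈ []
  linearCombination-zero Y []       = ≈-refl
  linearCombination-zero Y {u ∷ us} (z ∷ zs) =
    ⊕-cong z (≈-trans (PS.*-congˡ {Y} (linearCombination-zero Y zs)) (⊗-zeroʳ Y))

  -- `Y` has degree `n` and every `u_i` has degree below `n`, so the summands occupy disjoint ranges
  -- of degrees and the last nonzero `u_i` gives the leading term.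
  top-linearCombination : ∀ {Y n m} → Top Y n → m ≤ n → ∀ c us → BelowAll m c us →
    All (_≈ []) us ⊎ ∃ λ i → ∃ λ d →
      Top (linearCombination Y us) (i ℕ.* n ℕ.+ d) × i < length us × d ℕ.+ i ℕ.+ c < m
  top-linearCombination y m≤n c [] _ = inj₁ []
  top-linearCombination {Y} {n} {m} y m≤n c (u ∷ us) (b , bs)
    with top-linearCombination y m≤n (suc c) us bs
  ... | inj₂ (i , d , t , i< , d<) = inj₂ (suc i , d ,
      top-cong (⊕-comm (Y ⊗ linearCombination Y us) u)
        (subst (Top _) (sym (ℕₚ.+-assoc n (i ℕ.* n) d)) (top-⊕ (top-⊗ y t) λ j le →
          b j (ℕₚ.≤-trans m≤n (ℕₚ.≤-trans (ℕₚ.m≤m+n n _) (ℕₚ.≤-trans le (ℕₚ.m≤m+n j c)))))) ,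
      s≤s i< , subst (_< m) (trans (ℕₚ.+-suc (d ℕ.+ i) c) (cong (ℕ._+ c) (sym (ℕₚ.+-suc d i)))) d<)
  ... | inj₁ zs with top? u
  ...   | inj₁ z       = inj₁ (z ∷ zs)
  ...   | inj₂ (d , t) = inj₂ (0 , d ,
      top-cong (≈-sym (≈-trans (⊕-cong (≈-refl {u}) (≈-trans (PS.*-congˡ {Y} (linearCombination-zero Y zs))
        (⊗-zeroʳ Y))) (⊕-identityʳ u))) t , s≤s z≤n ,
      ℕₚ.≰⇒> λ le → leading t (b d (subst (λ s → m ≤ s ℕ.+ c) (ℕₚ.+-identityʳ d) le)))

  parity-half : ∀ j → Bool → ℕ
  parity-half j true  = ⌈ j /2⌉
  parity-half j false = ⌊ j /2⌋

  -- Stepanov's auxiliary polynomial and its conditions.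

  module Stepanov (a b : A) (h : ℕ)
    (characteristic : nat (suc (h ℕ.+ h)) ≡ 0#)
    (nat≢0 : ∀ {n} → 0 < n → n < suc (h ℕ.+ h) → nat n ≢ 0#) where

    f : Poly
    f = b ∷ a ∷ 0# ∷ 1# ∷ []

    open Derivation f h characteristic nat≢0 public

    p : ℕ
    p = suc (h ℕ.+ h)

    top-f : Top f 3
    top-f = 1≢0 , λ
      { (suc (suc (suc (suc i)))) _ → refl
      ; (suc (suc (suc zero))) (s≤s (s≤s (s≤s ())))
      ; (suc (suc zero)) (s≤s (s≤s ()))
      ; (suc zero) (s≤s ()) }

    ∂f≈ : ∂ f ≈ a ∷ 0# ∷ nat 3 ∷ []
    ∂f≈ .at 0 = S.+-identityʳ a
    ∂f≈ .at 1 = trans (coef-∂ f 1) (S.zeroʳ _)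
    ∂f≈ .at 2 = trans (coef-∂ f 2) (S.*-identityʳ _)
    ∂f≈ .at 3 = refl
    ∂f≈ .at (suc (suc (suc (suc i)))) = coef-∂ f (4 ℕ.+ i) ■
      where
      _■ : ∀ {x} → x ≡ nat (5 ℕ.+ i) * 0# → x ≡ 0#
      e ■ = trans e (S.zeroʳ _)

    below-D : ∀ e {m c} P → Below m c P →
      Below (2 ℕ.* parity-half 1 (not e) ℕ.+ m) (parity-half 1 e ℕ.+ c) (D e P)
    below-D true  P b = below-⊕ (∂ P) (∂ P) (below-∂ P b) (below-∂ P b)
    below-D false {m} {c} P b = below-⊕ (f ⊗ D true P) (∂ f ⊗ P)
      (below-reduce 2 (f ⊗ D true P) (below-⊗ f (D true P) (below-D true P b)))
      (below-reduce 1 (∂ f ⊗ P) (below-cong (PS.*-congʳ {P} (≈-sym ∂f≈)) (below-⊗ (a ∷ 0# ∷ nat 3 ∷ []) P b)))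

    below-D^ : ∀ j e {m c} P → Below m c P →
      Below (2 ℕ.* parity-half j (not e) ℕ.+ m) (parity-half j e ℕ.+ c) (D^ j e P)
    below-D^ zero    true  P b = b
    below-D^ zero    false P b = b
    below-D^ (suc j) true  {m} {c} P b = subst (λ s → Below (2 ℕ.* ⌈ j /2⌉ ℕ.+ m) s (D^ (suc j) true P))
      (ℕₚ.+-suc ⌊ j /2⌋ c) (below-D^ j false (D true P) (below-D true P b))
    below-D^ (suc j) false {m} {c} P b = subst (λ s → Below s (⌈ j /2⌉ ℕ.+ c) (D^ (suc j) false P))
      (arith ⌊ j /2⌋ m) (below-D^ j true (D false P) (below-D false P b))
      where
      arith : ∀ i m → 2 ℕ.* i ℕ.+ (2 ℕ.+ m) ≡ 2 ℕ.* suc i ℕ.+ m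
      arith = solve-∀

    belowAll-D^ : ∀ j e {m c} us → BelowAll m c us →
      BelowAll (2 ℕ.* parity-half j (not e) ℕ.+ m) (parity-half j e ℕ.+ c) (map (D^ j e) us)
    belowAll-D^ j e         []       _        = tt
    belowAll-D^ j e {m} {c} (u ∷ us) (b , bs) = below-D^ j e u b ,
      subst (λ s → BelowAll (2 ℕ.* parity-half j (not e) ℕ.+ m) s (map (D^ j e) us)) (ℕₚ.+-suc (parity-half j e) c) (belowAll-D^ j e us bs)

    -- The values of `ε f^(h+1)` and `ε f^h` at points where `f^h = ε` and `ε² = 1`.
    untwisted : Bool → Poly
    untwisted true  = f
    untwisted false = const 1#

    -- The j-th derivative of Σ X^(pa) u_a + y^p · y Σ X^(pb) v_b with X^p and y^p replaced by X and y,
    -- which does not change its values at 𝔽ₚ-rational points.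
    condition : ℕ → List Poly → List Poly → Poly
    condition j us vs = linearCombination X (map (D^ j true) us)
      ⊕ untwisted (parity j true) ⊗ linearCombination X (map (D^ j false) vs)

    parity-⌈/2⌉ : ∀ j → parity j true ≡ true → ⌈ j /2⌉ ≡ ⌊ j /2⌋
    parity-⌈/2⌉ zero          _ = refl
    parity-⌈/2⌉ (suc (suc j)) e = cong suc (parity-⌈/2⌉ j e)

    parity-⌈/2⌉′ : ∀ j → parity j true ≡ false → ⌈ j /2⌉ ≡ suc ⌊ j /2⌋
    parity-⌈/2⌉′ (suc zero)    _ = refl
    parity-⌈/2⌉′ (suc (suc j)) e = cong suc (parity-⌈/2⌉′ j e)

    -- The `v_b` exceed the `u_a` by 3, their offset: for even `j` through the factor `f`; for odd
    -- `j` because they have undergone one more step of kind `false` and one fewer of kind `true`, a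
    -- difference of 2 + 1.
    below-condition : ∀ j {m} us vs → BelowAll m 0 us → BelowAll m 3 vs →
      Below (2 ℕ.* ⌊ j /2⌋ ℕ.+ m) ⌈ j /2⌉ (condition j us vs)
    below-condition j {m} us vs bu bv = below-⊕ U _ (subst (λ s → Below (2 ℕ.* ⌊ j /2⌋ ℕ.+ m) s U) (ℕₚ.+-identityʳ ⌈ j /2⌉) belowU)
      (second (parity j true) refl)
      where
      U = linearCombination X (map (D^ j true) us)
      V = linearCombination X (map (D^ j false) vs)
      belowU = below-linearCombination (map (D^ j true) us) (belowAll-D^ j true us bu)
      belowV : Below (2 ℕ.* ⌈ j /2⌉ ℕ.+ m) (⌊ j /2⌋ ℕ.+ 3) V
      belowV = below-linearCombination (map (D^ j false) vs) (belowAll-D^ j false vs bv)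
      second : ∀ e → parity j true ≡ e → Below (2 ℕ.* ⌊ j /2⌋ ℕ.+ m) ⌈ j /2⌉ (untwisted e ⊗ V)
      second true  e = below-reduce 4 (f ⊗ V) (subst₂ (λ s t → Below (4 ℕ.+ (2 ℕ.* s ℕ.+ m)) t (f ⊗ V))
        (parity-⌈/2⌉ j e) (trans (cong suc (ℕₚ.+-comm ⌊ j /2⌋ 3)) (cong (4 ℕ.+_) (sym (parity-⌈/2⌉ j e))))
        (below-⊗ f V belowV))
      second false e = below-cong (≈-sym (⊗-identityˡ V)) (below-reduce 2 V (subst₂ (λ s t → Below s t V)
        (trans (cong (λ s → 2 ℕ.* s ℕ.+ m) (parity-⌈/2⌉′ j e)) (arith ⌊ j /2⌋ m))
        (trans (ℕₚ.+-comm ⌊ j /2⌋ 3) (cong (2 ℕ.+_) (sym (parity-⌈/2⌉′ j e))))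
        belowV))
        where
        arith : ∀ i m → 2 ℕ.* suc i ℕ.+ m ≡ 2 ℕ.+ (2 ℕ.* i ℕ.+ m)
        arith = solve-∀

    -- Σ X^(pa) u_a + ε y^(p+1) Σ X^(pb) v_b; only even powers of y occur, so this is a polynomial in X.
    auxiliary : A → List Poly → List Poly → Poly
    auxiliary ε us vs = linearCombination (X ^ p) us ⊕ const ε ⊗ (twist true ⊗ linearCombination (X ^ p) vs)

    ∂X^p≈0 : ∂ (X ^ p) ≈ []
    ∂X^p≈0 = begin
      ∂ (X ^ p)                                        ≈⟨ ∂-^ X (h ℕ.+ h) ⟩
      const (nat p) ⊗ (X ^ (h ℕ.+ h) ⊗ ∂ X)            ≈⟨ PS.*-congʳ (≈-trans (∷-cong characteristic ≈-refl) shift-zero) ⟩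
      []                                               ∎

    D^-auxiliary : ∀ j ε us vs → D^ j true (auxiliary ε us vs) ≈ linearCombination (X ^ p) (map (D^ j true) us)
      ⊕ const ε ⊗ (twist (parity j true) ⊗ linearCombination (X ^ p) (map (D^ j false) vs))
    D^-auxiliary j ε us vs = begin
      D^ j true (U ⊕ const ε ⊗ (twist true ⊗ V))
        ≈⟨ D^-⊕ j true U (const ε ⊗ (twist true ⊗ V)) ⟩
      D^ j true U ⊕ D^ j true (const ε ⊗ (twist true ⊗ V))
        ≈⟨ ⊕-cong (D^-linearCombination j true {X ^ p} ∂X^p≈0 us) (D^-constant j true {const ε} (∂-const ε) (twist true ⊗ V)) ⟩
      U′ ⊕ const ε ⊗ D^ j true (twist true ⊗ V)
        ≈⟨ PS.+-congˡ {U′} (PS.*-congˡ {const ε} (≈-trans (D^-twist j true V)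
             (PS.*-congˡ {twist (parity j true)} (D^-linearCombination j false {X ^ p} ∂X^p≈0 vs)))) ⟩
      U′ ⊕ const ε ⊗ (twist (parity j true) ⊗ linearCombination (X ^ p) (map (D^ j false) vs)) ∎
      where
      U = linearCombination (X ^ p) us
      V = linearCombination (X ^ p) vs
      U′ = linearCombination (X ^ p) (map (D^ j true) us)

    -- Rationality enters here: `x^p = x` turns `X ^ p` into `X`, and the last hypothesis does the
    -- same for `y^p` and `y`.
    eval-condition : ∀ x → x ^ˢ p ≡ x → ∀ j ε us vs →
      ε * eval x (twist (parity j true)) ≡ eval x (untwisted (parity j true)) →
      eval x (D^ j true (auxiliary ε us vs)) ≡ eval x (condition j us vs)
    eval-condition x x^p j ε us vs e = trans (eval-cong x (D^-auxiliary j ε us vs))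
      (trans (eval-⊕ x U′ (const ε ⊗ (T ⊗ V′))) (trans (cong₂ _+_ (same (map (D^ j true) us)) (chain
        (trans (eval-⊗ x (const ε) (T ⊗ V′)) (cong₂ _*_ (eval-const x ε) (eval-⊗ x T V′)))
        (trans (sym (S.*-assoc ε (eval x T) (eval x V′))) (cong₂ _*_ e (same (map (D^ j false) vs))))
        (sym (eval-⊗ x R (linearCombination X (map (D^ j false) vs))))))
      (sym (eval-⊕ x (linearCombination X (map (D^ j true) us)) (R ⊗ linearCombination X (map (D^ j false) vs))))))
      where
      chain : ∀ {w x y z : A} → w ≡ x → x ≡ y → y ≡ z → w ≡ z
      chain e f g = trans e (trans f g)
      T = twist (parity j true)
      R = untwisted (parity j true)
      U′ = linearCombination (X ^ p) (map (D^ j true) us)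
      V′ = linearCombination (X ^ p) (map (D^ j false) vs)
      same : ∀ us → eval x (linearCombination (X ^ p) us) ≡ eval x (linearCombination X us)
      same = eval-linearCombination x (trans (eval-^ x X p) (trans (cong (_^ˢ p) (eval-X x)) (trans x^p (sym (eval-X x)))))

    parity-even : ∀ i → parity (i ℕ.+ i) true ≡ true
    parity-even zero    = refl
    parity-even (suc i) rewrite ℕₚ.+-suc i i = parity-even i

    -- The derivatives of order below `n` take at `x` the values of the conditions, which vanish
    -- identically; `n < p` keeps the factors in `vanishing-order` invertible.
    linear^∣auxiliary : ∀ n us vs → (∀ j → j < n → condition j us vs ≈ []) → n < p → 2 < p →
      ∀ ε → ε * ε ≡ 1# → ∀ x → x ^ˢ p ≡ x → eval x f ≢ 0# → eval x f ^ˢ h ≡ ε →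
      linear x ^ n ∣ auxiliary ε us vs
    linear^∣auxiliary n us vs conds n<p 2<p ε ε²≡1 x x^p fx≢0 χ = linear^∣ x (auxiliary ε us vs) n
      λ k G k<n e → vanishing-order 2<p x fx≢0 k true G (ℕₚ.<-trans k<n n<p)
        (trans (eval-cong x (D^-cong k true (≈-sym e))) (trans (eval-condition x x^p k ε us vs (agree (parity k true)))
          (eval-zero x (conds k k<n))))
      where
      agree : ∀ e → ε * eval x (twist e) ≡ eval x (untwisted e)
      agree false = trans (cong (ε *_) (trans (eval-^ x f h) χ)) (trans ε²≡1 (sym (eval-const x 1#)))
      agree true  = trans (cong (ε *_) (trans (eval-⊗ x f (f ^ h)) (S.*-comm (eval x f) (eval x (f ^ h)))))
        (trans (sym (S.*-assoc ε _ _)) (trans (cong (_* eval x f) (trans (agree false) (eval-const x 1#)))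
          (S.*-identityˡ _)))

    -- Two derivatives account for one factor `linear x`, so only conditions of even index `2 k < n`
    -- enter. As `f(x) = 0`, both `f^(h+1)` and its replacement `f` vanish at `x`, whatever `ε` is.
    linear^∣auxiliary-root : ∀ n us vs → (∀ j → j < n → condition j us vs ≈ []) → n < p → 2 < p →
      ∀ ε x → x ^ˢ p ≡ x → eval x f ≡ 0# → eval x (∂ f) ≢ 0# →
      linear x ^ ⌈ n /2⌉ ∣ auxiliary ε us vs
    linear^∣auxiliary-root n us vs conds n<p 2<p ε x x^p fx≡0 f′x≢0 = linear^∣ x (auxiliary ε us vs) ⌈ n /2⌉
      λ k G k< e → let 2k<n = double< n k< in
        vanishing-order-root 2<p x fx≡0 f′x≢0 k G (ℕₚ.<-trans 2k<n n<p)
          (trans (eval-cong x (D^-cong (k ℕ.+ k) true (≈-sym e)))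
            (trans (eval-condition x x^p (k ℕ.+ k) ε us vs (subst (λ e → ε * eval x (twist e) ≡ eval x (untwisted e))
              (sym (parity-even k)) agree)) (eval-zero x (conds (k ℕ.+ k) 2k<n))))
      where
      double< : ∀ n {k} → k < ⌈ n /2⌉ → k ℕ.+ k < n
      double< (suc n)       {zero}  _ = s≤s z≤n
      double< (suc (suc n)) {suc k} (s≤s k<) = s≤s (subst (_< suc n) (sym (ℕₚ.+-suc k k)) (s≤s (double< n k<)))
      double< (suc zero) {suc k} (s≤s ())
      agree : ε * eval x (f ^ suc h) ≡ eval x f
      agree = trans (cong (ε *_) (trans (eval-⊗ x f (f ^ h)) (trans (cong (_* eval x (f ^ h)) fx≡0) (S.zeroˡ _))))
        (trans (S.zeroʳ ε) (sym fx≡0))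

-- Arithmetic of the prime field.

module PrimeField (q : ℕ) (prime : Prime (suc q)) where

  p : ℕ
  p = suc q

  F : Set
  F = Fin p

  opaque
    ι : ℕ → F
    ι n = n mod p

    toℕ-ι : ∀ n → toℕ (ι n) ≡ n % p
    toℕ-ι n = toℕ-fromℕ< _

  ι-cong : ∀ {m n} → m % p ≡ n % p → ι m ≡ ι n
  ι-cong {m} {n} e = toℕ-injective (trans (toℕ-ι m) (trans e (sym (toℕ-ι n))))

  ι-injective : ∀ {m n} → ι m ≡ ι n → m % p ≡ n % p
  ι-injective {m} {n} e = trans (sym (toℕ-ι m)) (trans (cong toℕ e) (toℕ-ι n))

  ι-toℕ : ∀ x → ι (toℕ x) ≡ x
  ι-toℕ x = toℕ-injective (trans (toℕ-ι (toℕ x)) (m<n⇒m%n≡m (toℕ<n x)))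

  infixl 6 _+_
  infixl 7 _*_

  opaque
    _+_ _*_ : F → F → F
    x + y = ι (toℕ x ℕ.+ toℕ y)
    x * y = ι (toℕ x ℕ.* toℕ y)

    ι-+ : ∀ m n → ι m + ι n ≡ ι (m ℕ.+ n)
    ι-+ m n = trans (cong₂ (λ s t → ι (s ℕ.+ t)) (toℕ-ι m) (toℕ-ι n))
      (ι-cong (sym (%-distribˡ-+ m n p)))

    ι-* : ∀ m n → ι m * ι n ≡ ι (m ℕ.* n)
    ι-* m n = trans (cong₂ (λ s t → ι (s ℕ.* t)) (toℕ-ι m) (toℕ-ι n))
      (ι-cong (sym (%-distribˡ-* m n p)))

  0# 1# -1# : F
  0# = zero
  1# = ι 1
  -1# = ι q

  ι-0 : ι 0 ≡ 0#
  ι-0 = toℕ-injective (toℕ-ι 0)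

  ι-surjective : ∀ x → ∃ λ n → ι n ≡ x
  ι-surjective x = toℕ x , ι-toℕ x

  private
    -- `ι` is a surjective homomorphism, so identities of natural numbers descend to the field.
    lift₂ : {f g : F → F → F} {f′ g′ : ℕ → ℕ → ℕ} →
      (∀ m n → f (ι m) (ι n) ≡ ι (f′ m n)) → (∀ m n → g (ι m) (ι n) ≡ ι (g′ m n)) →
      (∀ m n → f′ m n ≡ g′ m n) → ∀ x y → f x y ≡ g x y
    lift₂ {f} {g} ef eg e x y with ι-surjective x | ι-surjective y
    ... | m , refl | n , refl = trans (ef m n) (trans (cong ι (e m n)) (sym (eg m n)))

    lift₃ : {f g : F → F → F → F} {f′ g′ : ℕ → ℕ → ℕ → ℕ} →
      (∀ m n o → f (ι m) (ι n) (ι o) ≡ ι (f′ m n o)) → (∀ m n o → g (ι m) (ι n) (ι o) ≡ ι (g′ m n o)) →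
      (∀ m n o → f′ m n o ≡ g′ m n o) → ∀ x y z → f x y z ≡ g x y z
    lift₃ {f} {g} ef eg e x y z with ι-surjective x | ι-surjective y | ι-surjective z
    ... | m , refl | n , refl | o , refl =
      trans (ef m n o) (trans (cong ι (e m n o)) (sym (eg m n o)))

  +-assoc : ∀ x y z → (x + y) + z ≡ x + (y + z)
  +-assoc = lift₃ (λ m n o → trans (cong (_+ ι o) (ι-+ m n)) (ι-+ _ o))
    (λ m n o → trans (cong (ι m +_) (ι-+ n o)) (ι-+ m _)) ℕₚ.+-assoc

  *-assoc : ∀ x y z → (x * y) * z ≡ x * (y * z)
  *-assoc = lift₃ (λ m n o → trans (cong (_* ι o) (ι-* m n)) (ι-* _ o))
    (λ m n o → trans (cong (ι m *_) (ι-* n o)) (ι-* m _)) ℕₚ.*-assoc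

  *-distribˡ : ∀ x y z → x * (y + z) ≡ x * y + x * z
  *-distribˡ = lift₃ (λ m n o → trans (cong (ι m *_) (ι-+ n o)) (ι-* m _))
    (λ m n o → trans (cong₂ _+_ (ι-* m n) (ι-* m o)) (ι-+ _ _)) ℕₚ.*-distribˡ-+

  +-comm : ∀ x y → x + y ≡ y + x
  +-comm = lift₂ ι-+ (λ m n → ι-+ n m) ℕₚ.+-comm

  *-comm : ∀ x y → x * y ≡ y * x
  *-comm = lift₂ ι-* (λ m n → ι-* n m) ℕₚ.*-comm

  +-identityˡ : ∀ x → 0# + x ≡ x
  +-identityˡ x with ι-surjective x
  ... | n , refl = trans (cong (_+ ι n) (sym ι-0)) (ι-+ 0 n)

  *-identityˡ : ∀ x → 1# * x ≡ x
  *-identityˡ x with ι-surjective x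
  ... | n , refl = trans (ι-* 1 n) (cong ι (ℕₚ.*-identityˡ n))

  *-zeroˡ : ∀ x → 0# * x ≡ 0#
  *-zeroˡ x with ι-surjective x
  ... | n , refl = trans (cong (_* ι n) (sym ι-0)) (trans (ι-* 0 n) ι-0)

  isCommutativeSemiring : IsCommutativeSemiring _≡_ _+_ _*_ 0# 1#
  isCommutativeSemiring = record
    { isSemiring = record
      { isSemiringWithoutAnnihilatingZero = record
        { +-isCommutativeMonoid = record
          { isMonoid = record
            { isSemigroup = record
              { isMagma = record { isEquivalence = isEquivalence ; ∙-cong = cong₂ _+_ }
              ; assoc = +-assoc }
            ; identity = +-identityˡ , λ x → trans (+-comm x 0#) (+-identityˡ x) }
          ; comm = +-comm }
        ; *-cong = cong₂ _*_
        ; *-assoc = *-assoc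
        ; *-identity = *-identityˡ , λ x → trans (*-comm x 1#) (*-identityˡ x)
        ; distrib = *-distribˡ , λ x y z → trans (*-comm (y + z) x)
            (trans (*-distribˡ x y z) (cong₂ _+_ (*-comm x y) (*-comm x z))) }
      ; zero = *-zeroˡ , λ x → trans (*-comm x 0#) (*-zeroˡ x) }
    ; *-comm = *-comm }

  scalars : CommutativeSemiring 0ℓ 0ℓ
  scalars = record { isCommutativeSemiring = isCommutativeSemiring }

  module S = CommutativeSemiring scalars

  ι≡0⇒∣ : ∀ n → ι n ≡ 0# → p ℕᵈ.∣ n
  ι≡0⇒∣ n e = ℕᵈ.m%n≡0⇒n∣m n p (trans (sym (toℕ-ι n)) (cong toℕ e))

  ∣⇒ι≡0 : ∀ n → p ℕᵈ.∣ n → ι n ≡ 0#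
  ∣⇒ι≡0 n d = toℕ-injective (trans (toℕ-ι n) (ℕᵈ.n∣m⇒m%n≡0 n p d))

  ι-p : ι p ≡ 0#
  ι-p = ∣⇒ι≡0 p (ℕᵈ.divides 1 (sym (ℕₚ.*-identityˡ p)))

  ι-nonzero : ∀ {n} → 0 < n → n < p → ι n ≢ 0#
  ι-nonzero {suc n} _ n<p e = ℕₚ.<⇒≱ n<p (ℕᵈ.∣⇒≤ (ι≡0⇒∣ (suc n) e))

  1<p : 1 < p
  1<p = ℕ.nonTrivial⇒n>1 p {{prime⇒nonTrivial prime}}

  1≢0 : 1# ≢ 0#
  1≢0 = ι-nonzero (s≤s z≤n) 1<p

  1+-1≡0 : 1# + -1# ≡ 0#
  1+-1≡0 = trans (ι-+ 1 q) ι-p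

  x*y≡0⇒x≡0⊎y≡0 : ∀ x y → x * y ≡ 0# → x ≡ 0# ⊎ y ≡ 0#
  x*y≡0⇒x≡0⊎y≡0 x y e with ι-surjective x | ι-surjective y
  ... | m , refl | n , refl with euclidsLemma m n prime (ι≡0⇒∣ _ (trans (sym (ι-* m n)) e))
  ...   | inj₁ d = inj₁ (∣⇒ι≡0 m d)
  ...   | inj₂ d = inj₂ (∣⇒ι≡0 n d)

  *-nonzero : ∀ {x y} → x ≢ 0# → y ≢ 0# → x * y ≢ 0#
  *-nonzero {x} {y} x≢0 y≢0 e with x*y≡0⇒x≡0⊎y≡0 x y e
  ... | inj₁ x≡0 = x≢0 x≡0
  ... | inj₂ y≡0 = y≢0 y≡0

  infix 4 _≟_
  opaque
    _≟_ : DecidableEquality F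
    _≟_ = Finₚ._≟_

  open DomainPolynomials isCommutativeSemiring _≟_ 1≢0 -1# 1+-1≡0 *-nonzero public

  -1*-1≡1 : -1# * -1# ≡ 1#
  -1*-1≡1 = x+-1y≡0⇒x≡y (trans (sym (*-distribˡ -1# -1# 1#))
    (trans (cong (-1# *_) (trans (+-comm -1# 1#) 1+-1≡0)) (S.zeroʳ -1#)))

  opaque
    inverse : ∀ x → x ≢ 0# → ∃ λ y → x * y ≡ 1#
    inverse zero    x≢0 = ⊥-elim (x≢0 refl)
    inverse (suc i) x≢0
      with coprime-Bézout (prime⇒coprime prime (s≤s (toℕ<n i)))
    ... | Bézout.-+ a b e = ι b , (begin
      suc i * ι b                 ≡⟨ cong (_* ι b) (ι-toℕ (suc i)) ⟨
      ι (suc (toℕ i)) * ι b       ≡⟨ ι-* _ b ⟩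
      ι (suc (toℕ i) ℕ.* b)       ≡⟨ cong ι (trans (ℕₚ.*-comm _ b) (sym e)) ⟩
      ι (1 ℕ.+ a ℕ.* p)           ≡⟨ ι-cong ([m+kn]%n≡m%n 1 a p) ⟩
      1#                          ∎)
      where open ≡-Reasoning
    -- Here `1 + b n = a p`, so the inverse is the negative of `b`.
    ... | Bézout.+- a b e = -1# * ι b , x+-1y≡0⇒x≡y (begin
      suc i * (-1# * ι b) + -1# * 1#   ≡⟨ cong (λ s → s * (-1# * ι b) + -1# * 1#) (ι-toℕ (suc i)) ⟨
      ι n * (-1# * ι b) + -1# * 1#     ≡⟨ cong (_+ -1# * 1#) (x∙yz≈y∙xz (ι n) -1# (ι b)) ⟩
      -1# * (ι n * ι b) + -1# * 1#     ≡⟨ *-distribˡ -1# _ _ ⟨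
      -1# * (ι n * ι b + 1#)           ≡⟨ cong (λ s → -1# * (s + 1#)) (ι-* n b) ⟩
      -1# * (ι (n ℕ.* b) + 1#)         ≡⟨ cong (-1# *_) (ι-+ (n ℕ.* b) 1) ⟩
      -1# * ι (n ℕ.* b ℕ.+ 1)          ≡⟨ cong (λ s → -1# * ι s) (trans (ℕₚ.+-comm _ 1) (trans (cong suc (ℕₚ.*-comm n b)) e)) ⟩
      -1# * ι (a ℕ.* p)                ≡⟨ cong (-1# *_) (∣⇒ι≡0 _ (ℕᵈ.divides a refl)) ⟩
      -1# * 0#                         ≡⟨ S.zeroʳ -1# ⟩
      0#                               ∎)
      where
      open ≡-Reasoning
      open CommutativeSemigroup S.*-commutativeSemigroup using (x∙yz≈y∙xz)
      n : ℕ
      n = suc (toℕ i)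

  *-cancelˡ : ∀ {x y z} → x ≢ 0# → x * y ≡ x * z → y ≡ z
  *-cancelˡ {x} {y} {z} x≢0 e = trans (sym (undo y)) (trans (cong (x⁻¹ *_) e) (undo z))
    where
    x⁻¹ = proj₁ (inverse x x≢0)
    undo : ∀ w → x⁻¹ * (x * w) ≡ w
    undo w = trans (sym (*-assoc x⁻¹ x w)) (trans (cong (_* w)
      (trans (*-comm x⁻¹ x) (proj₂ (inverse x x≢0)))) (*-identityˡ w))

  nat≡ι : ∀ n → nat n ≡ ι n
  nat≡ι zero    = sym ι-0
  nat≡ι (suc n) = trans (cong (1# +_) (nat≡ι n)) (ι-+ 1 n)

-- Finite sums of natural numbers.

indicator : ∀ {P : Set} → Dec P → ℕ
indicator (yes _) = 1
indicator (no  _) = 0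

sum-mono-≤ : ∀ {n} {f g : Fin n → ℕ} → (∀ i → f i ≤ g i) → sum f ≤ sum g
sum-mono-≤ {zero}  f≤g = z≤n
sum-mono-≤ {suc n} f≤g = ℕₚ.+-mono-≤ (f≤g zero) (sum-mono-≤ (λ i → f≤g (suc i)))

sum-≤-tight : ∀ {n} {f g : Fin n → ℕ} → (∀ i → f i ≤ g i) → sum g ≤ sum f → ∀ i → f i ≡ g i
sum-≤-tight {suc n} {f} {g} f≤g Σg≤Σf zero = ℕₚ.≤-antisym (f≤g zero)
  (ℕₚ.+-cancelʳ-≤ (sum (f ∘ suc)) (g zero) (f zero) (ℕₚ.≤-trans
    (ℕₚ.+-monoʳ-≤ (g zero) (sum-mono-≤ (f≤g ∘ suc))) Σg≤Σf))
sum-≤-tight {suc n} {f} {g} f≤g Σg≤Σf (suc i) = sum-≤-tight (f≤g ∘ suc)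
  (ℕₚ.+-cancelˡ-≤ (f zero) _ _ (ℕₚ.≤-trans (ℕₚ.+-monoˡ-≤ _ (f≤g zero)) Σg≤Σf)) i

sum-const : ∀ n c → sum {n} (λ _ → c) ≡ n ℕ.* c
sum-const zero    c = refl
sum-const (suc n) c = cong (c ℕ.+_) (sum-const n c)

sum-zero : ∀ {n} {f : Fin n → ℕ} → (∀ i → f i ≡ 0) → sum f ≡ 0
sum-zero {n} e = trans (sum-cong-≗ e) (trans (sum-const n 0) (ℕₚ.*-zeroʳ n))

indicator-yes : ∀ {P : Set} (d : Dec P) → P → indicator d ≡ 1
indicator-yes (yes _) _ = refl
indicator-yes (no ¬P) x = ⊥-elim (¬P x)

indicator-no : ∀ {P : Set} (d : Dec P) → ¬ P → indicator d ≡ 0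
indicator-no (yes x) ¬P = ⊥-elim (¬P x)
indicator-no (no _)  _  = refl

sum-indicator-≡ : ∀ {n} {a : Fin n} (d : ∀ x → Dec (a ≡ x)) → sum (λ x → indicator (d x)) ≡ 1
sum-indicator-≡ {suc n} {zero} d =
  cong₂ ℕ._+_ (indicator-yes (d zero) refl) (sum-zero {n} λ i → indicator-no (d (suc i)) λ ())
sum-indicator-≡ {suc n} {suc a} d = cong₂ ℕ._+_ (indicator-no (d zero) λ ())
  (trans (sum-cong-≗ {n} λ x → step (d (suc x)))
    (sum-indicator-≡ λ x → Dec.map′ Finₚ.suc-injective (cong suc) (d (suc x))))
  where
  step : ∀ {x} (d : Dec (suc a ≡ suc x)) → indicator d ≡ indicator (Dec.map′ Finₚ.suc-injective (cong suc) d)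
  step (yes _) = refl
  step (no _)  = refl

-- Fermat's theorem, power sums and Euler's criterion.

module OddPrimeField (h : ℕ) (prime : Prime (suc (h ℕ.+ h))) where

  q : ℕ
  q = h ℕ.+ h

  open PrimeField q prime public
  open MonoidSum S.*-commutativeMonoid using ()
    renaming (sum to ∏; sum-permute to ∏-permute; ∑-distrib-+ to ∏-distrib-*; sum-cong-≗ to ∏-cong
             ; sum-replicate to ∏-replicate)
  open SemiringSum S.semiring public using ()
    renaming (sum to Σ; sum-permute to Σ-permute; ∑-distrib-+ to Σ-distrib-+
             ; sum-cong-≗ to Σ-cong; *-distribˡ-sum to *-distribˡ-Σ)

  0<h : 0 < h
  0<h = positive h 1<p
    where
    positive : ∀ n → 1 < suc (n ℕ.+ n) → 0 < n
    positive (suc n) _ = s≤s z≤n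
    positive zero (s≤s ())

  0<q : 0 < q
  0<q = ℕₚ.≤-trans 0<h (ℕₚ.m≤m+n h h)

  scaling : ∀ c → c ≢ 0# → Permutation′ p
  scaling c c≢0 = permutation (c *_) (c⁻¹ *_)
    (λ x → trans (sym (*-assoc c c⁻¹ x)) (trans (cong (_* x) cc⁻¹) (*-identityˡ x)))
    (λ x → trans (sym (*-assoc c⁻¹ c x)) (trans (cong (_* x) (trans (*-comm c⁻¹ c) cc⁻¹)) (*-identityˡ x)))
    where
    c⁻¹ = proj₁ (inverse c c≢0)
    cc⁻¹ = proj₂ (inverse c c≢0)

  -- Multiplying the nonzero residues by c permutes them; comparing products gives c^(p-1) = 1.
  fermat : ∀ {c} → c ≢ 0# → c ^ˢ q ≡ 1#
  fermat {c} c≢0 = trans (sym ∏ψ) (*-cancelˡ (∏≢0 φ φ≢0) (begin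
    ∏ φ * ∏ ψ             ≡⟨ *-comm (∏ φ) (∏ ψ) ⟩
    ∏ ψ * ∏ φ             ≡⟨ ∏-distrib-* ψ φ ⟨
    ∏ (λ x → ψ x * φ x)   ≡⟨ ∏-cong φ-scale ⟨
    ∏ (λ x → φ (c * x))   ≡⟨ ∏-permute φ (scaling c c≢0) ⟨
    ∏ φ                   ≡⟨ S.*-identityʳ (∏ φ) ⟨
    ∏ φ * 1#              ∎))
    where
    open ≡-Reasoning
    -- `φ` puts 1 in place of the residue 0, which makes the product over the entire field nonzero;
    -- `ψ` is the factor that multiplication by `c` brings to `φ`.
    φ ψ : F → F
    φ zero    = 1#
    φ (suc i) = suc i
    ψ zero    = 1#
    ψ (suc i) = c
    φ≢0 : ∀ x → φ x ≢ 0#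
    φ≢0 zero    = 1≢0
    φ≢0 (suc i) = λ ()
    φ-nonzero : ∀ {x} → x ≢ 0# → φ x ≡ x
    φ-nonzero {zero}  x≢0 = ⊥-elim (x≢0 refl)
    φ-nonzero {suc i} x≢0 = refl
    φ-scale : ∀ x → φ (c * x) ≡ ψ x * φ x
    φ-scale zero    = trans (cong φ (S.zeroʳ c)) (sym (*-identityˡ 1#))
    φ-scale (suc i) = φ-nonzero (*-nonzero c≢0 λ ())
    ∏≢0 : ∀ {n} (f : Fin n → F) → (∀ i → f i ≢ 0#) → ∏ f ≢ 0#
    ∏≢0 {zero}  f f≢0 = 1≢0
    ∏≢0 {suc n} f f≢0 = *-nonzero (f≢0 zero) (∏≢0 (f ∘ suc) (f≢0 ∘ suc))
    ∏ψ : ∏ ψ ≡ c ^ˢ q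
    ∏ψ = trans (*-identityˡ _) (∏-replicate q)

  0^ : ∀ {n} → 0 < n → 0# ^ˢ n ≡ 0#
  0^ {suc n} _ = *-zeroˡ _

  frobenius : ∀ x → x ^ˢ p ≡ x
  frobenius x with x ≟ 0#
  ... | yes refl = *-zeroˡ _
  ... | no  x≢0  = trans (cong (x *_) (fermat x≢0)) (S.*-identityʳ x)

  -- `X^k - c` has degree `k`. The function `m` marks some of its roots, so the subset to be counted
  -- can be given by any test.
  nth-root-count : ∀ k → 0 < k → ∀ c (m : F → ℕ) → (∀ x → m x ≡ 0 ⊎ m x ≡ 1 × x ^ˢ k ≡ c) → sum m ≤ k
  nth-root-count k 0<k c m roots = sum-multiplicities≤degree p (λ x → x) (λ e → e) m P
    (top-⊕ (subst (Top (X ^ k)) (ℕₚ.*-identityʳ k) (top-^ top-X k)) bound) div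
    where
    P = X ^ k ⊕ const (-1# * c)
    bound : Bounded k (const (-1# * c))
    bound zero    k≤0 = ⊥-elim (ℕₚ.<⇒≱ 0<k k≤0)
    bound (suc i) _   = refl
    div : ∀ x → linear x ^ m x ∣ P
    div x with m x | roots x
    ... | _ | inj₁ refl       = divides P (≈-sym (⊗-identityˡ P))
    ... | _ | inj₂ (refl , e) = root⇒linear∣ x P (trans (eval-⊕ x (X ^ k) (const (-1# * c)))
      (trans (cong₂ _+_ (trans (eval-^ x X k) (trans (cong (_^ˢ k) (eval-X x)) e)) (eval-const x (-1# * c)))
        (x+-1x≡0 c)))

  powerSum : ℕ → F
  powerSum k = Σ (λ (x : F) → x ^ˢ k)

  *-^ : ∀ x y k → (x * y) ^ˢ k ≡ x ^ˢ k * y ^ˢ k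
  *-^ x y zero    = sym (*-identityˡ 1#)
  *-^ x y (suc k) = trans (cong (x * y *_) (*-^ x y k)) (interchange x y _ _)
    where open CommutativeSemigroup S.*-commutativeSemigroup using (interchange)

  ^-+ : ∀ x m n → x ^ˢ (m ℕ.+ n) ≡ x ^ˢ m * x ^ˢ n
  ^-+ x zero    n = sym (*-identityˡ _)
  ^-+ x (suc m) n = trans (cong (x *_) (^-+ x m n)) (sym (*-assoc x _ _))

  Σ-const : ∀ n → Σ {n} (λ _ → 1#) ≡ ι n
  Σ-const zero    = sym ι-0
  Σ-const (suc n) = trans (cong (1# +_) (Σ-const n)) (ι-+ 1 n)

  powerSum-0 : powerSum 0 ≡ 0#
  powerSum-0 = trans (Σ-const p) ι-p

  powerSum-q : powerSum q ≡ -1#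
  powerSum-q = trans (cong₂ _+_ (0^ 0<q) (Σ-cong {q} (λ i → fermat {suc i} (λ ()))))
    (trans (+-identityˡ _) (Σ-const q))

  -- Otherwise all `q > k` nonzero residues would be roots of `X^k - 1`. This takes the place of a
  -- primitive root.
  nonroot : ∀ {k} → 0 < k → k < q → ∃ λ c → c ≢ 0# × c ^ˢ k ≢ 1#
  nonroot {k} 0<k k<q with ¬∀⟶∃¬ q (λ i → suc i ^ˢ k ≡ 1#) (λ i → suc i ^ˢ k ≟ 1#) not-all
    where
    not-all : ¬ (∀ i → suc i ^ˢ k ≡ 1#)
    not-all all = ℕₚ.<⇒≱ k<q (subst (_≤ k) (trans (sum-const q 1) (ℕₚ.*-identityʳ q))
      (nth-root-count k 0<k 1# (λ { zero → 0 ; (suc i) → 1 }) λ { zero → inj₁ refl ; (suc i) → inj₂ (refl , all i) }))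
  ... | i , ≢1 = suc i , (λ ()) , ≢1

  -- Substituting `c x` for `x` multiplies the sum by `c^k`; when `c^k` differs from 1, the sum must
  -- be zero.
  powerSum-small : ∀ {k} → 0 < k → k < q → powerSum k ≡ 0#
  powerSum-small {k} 0<k k<q = [ (λ z → ⊥-elim (c^k≢1 (x+-1y≡0⇒x≡y z))) , (λ z → z) ]′
    (x*y≡0⇒x≡0⊎y≡0 (c ^ˢ k + -1# * 1#) (powerSum k) annihilated)
    where
    open ≡-Reasoning
    c = proj₁ (nonroot 0<k k<q)
    c≢0 = proj₁ (proj₂ (nonroot 0<k k<q))
    c^k≢1 = proj₂ (proj₂ (nonroot 0<k k<q))
    scaled : c ^ˢ k * powerSum k ≡ powerSum k
    scaled = begin
      c ^ˢ k * powerSum k          ≡⟨ *-distribˡ-Σ (c ^ˢ k) (λ (x : F) → x ^ˢ k) ⟩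
      Σ (λ x → c ^ˢ k * x ^ˢ k)    ≡⟨ Σ-cong (λ x → *-^ c x k) ⟨
      Σ (λ x → (c * x) ^ˢ k)       ≡⟨ Σ-permute (λ x → x ^ˢ k) (scaling c c≢0) ⟨
      powerSum k                   ∎
    annihilated : (c ^ˢ k + -1# * 1#) * powerSum k ≡ 0#
    annihilated = begin
      (c ^ˢ k + -1# * 1#) * powerSum k               ≡⟨ S.distribʳ (powerSum k) _ _ ⟩
      c ^ˢ k * powerSum k + (-1# * 1#) * powerSum k  ≡⟨ cong₂ _+_ scaled (cong (_* powerSum k) (S.*-identityʳ -1#)) ⟩
      powerSum k + -1# * powerSum k                  ≡⟨ x+-1x≡0 (powerSum k) ⟩
      0#                                             ∎

  -- Both exponents are positive, which matters at `x = 0`, where the exponent 0 would give 1.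
  powerSum-period : ∀ k → powerSum (q ℕ.+ suc k) ≡ powerSum (suc k)
  powerSum-period k = Σ-cong step
    where
    step : ∀ x → x ^ˢ (q ℕ.+ suc k) ≡ x ^ˢ suc k
    step x = begin
      x ^ˢ (q ℕ.+ suc k)      ≡⟨ cong (x ^ˢ_) (ℕₚ.+-suc q k) ⟩
      x ^ˢ (p ℕ.+ k)          ≡⟨ ^-+ x p k ⟩
      x ^ˢ p * x ^ˢ k         ≡⟨ cong (_* x ^ˢ k) (frobenius x) ⟩
      x ^ˢ suc k              ∎
      where open ≡-Reasoning

  shift-X^ : ∀ j → X ^ suc j ≈ 0# ∷ X ^ j
  shift-X^ j = ≈-trans (shift-⊗ (const 1#) (X ^ j)) (∷-cong refl (⊗-identityˡ (X ^ j)))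

  coef-X^-≡ : ∀ j → coef (X ^ j) j ≡ 1#
  coef-X^-≡ zero    = refl
  coef-X^-≡ (suc j) = trans (at (shift-X^ j) (suc j)) (coef-X^-≡ j)

  coef-X^-≢ : ∀ j i → j ≢ i → coef (X ^ j) i ≡ 0#
  coef-X^-≢ zero    zero    ne = ⊥-elim (ne refl)
  coef-X^-≢ zero    (suc i) ne = refl
  coef-X^-≢ (suc j) zero    ne = at (shift-X^ j) 0
  coef-X^-≢ (suc j) (suc i) ne = trans (at (shift-X^ j) (suc i)) (coef-X^-≢ j i (ne ∘ cong suc))

  -- Below `2 q` the only positive multiple of `q` is `q` itself, and the exponent 0 contributes
  -- `p = 0`.
  powerSum-coef : ∀ j → j < q ℕ.+ q → powerSum j ≡ -1# * coef (X ^ j) q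
  powerSum-coef j j<2q with ℕₚ.<-cmp j q
  powerSum-coef zero j<2q | tri< j<q j≢q _ =
    trans powerSum-0 (sym (trans (cong (-1# *_) (coef-X^-≢ 0 q j≢q)) (S.zeroʳ -1#)))
  powerSum-coef (suc j) j<2q | tri< j<q j≢q _ =
    trans (powerSum-small (s≤s z≤n) j<q) (sym (trans (cong (-1# *_) (coef-X^-≢ (suc j) q j≢q)) (S.zeroʳ -1#)))
  powerSum-coef j j<2q | tri≈ _ j≡q _ = trans (cong powerSum j≡q)
    (trans powerSum-q (sym (trans (cong (λ j → -1# * coef (X ^ j) q) j≡q)
      (trans (cong (-1# *_) (coef-X^-≡ q)) (S.*-identityʳ -1#)))))
  powerSum-coef j j<2q | tri> _ j≢q q<j with ℕₚ.m≤n⇒∃[o]m+o≡n q<j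
  ... | o , refl = trans (trans (cong powerSum (sym (ℕₚ.+-suc q o))) (trans (powerSum-period o)
      (powerSum-small (s≤s z≤n) (ℕₚ.+-cancelˡ-< q _ _ (subst (_< q ℕ.+ q) (sym (ℕₚ.+-suc q o)) j<2q)))))
    (sym (trans (cong (-1# *_) (coef-X^-≢ j q j≢q)) (S.zeroʳ -1#)))

  Σ-eval : Poly → F
  Σ-eval P = Σ (λ (x : F) → eval x P)

  Σ-eval-cong : ∀ {P Q} → P ≈ Q → Σ-eval P ≡ Σ-eval Q
  Σ-eval-cong e = Σ-cong (λ x → eval-cong x e)

  private
    HasSum : Poly → Set
    HasSum P = Σ-eval P ≡ -1# * coef P q

    sum-⊕ : ∀ P Q → HasSum P → HasSum Q → HasSum (P ⊕ Q)
    sum-⊕ P Q p q′ = trans (Σ-cong (λ x → eval-⊕ x P Q)) (trans (Σ-distrib-+ (λ (x : F) → eval x P) (λ x → eval x Q))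
      (trans (cong₂ _+_ p q′) (trans (sym (*-distribˡ -1# _ _)) (cong (-1# *_) (sym (coef-⊕ P Q q))))))

    sum-resp : ∀ {P Q} → P ≈ Q → HasSum P → HasSum Q
    sum-resp e s = trans (sym (Σ-eval-cong e)) (trans s (cong (-1# *_) (at e q)))

    sum-X^ : ∀ c j → j < q ℕ.+ q → HasSum (c · X ^ j)
    sum-X^ c j j<2q = trans (Σ-cong (λ x → trans (eval-· x c (X ^ j)) (cong (c *_)
        (trans (eval-^ x X j) (cong (_^ˢ j) (eval-X x))))))
      (trans (sym (*-distribˡ-Σ c (λ (x : F) → x ^ˢ j))) (trans (cong (c *_) (powerSum-coef j j<2q))
        (trans (x∙yz≈y∙xz c -1# _) (cong (-1# *_) (sym (coef-· c (X ^ j) q))))))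
      where open CommutativeSemigroup S.*-commutativeSemigroup using (x∙yz≈y∙xz)

    sum-[] : HasSum []
    sum-[] = trans (Σ-zero p) (sym (S.zeroʳ -1#))
      where
      Σ-zero : ∀ n → Σ {n} (λ _ → 0#) ≡ 0#
      Σ-zero zero    = refl
      Σ-zero (suc n) = trans (+-identityˡ _) (Σ-zero n)

    sum-X^⊗ : ∀ j P n → j ℕ.+ n ≤ q ℕ.+ q → Bounded n P → HasSum (X ^ j ⊗ P)
    sum-X^⊗ j []      n       _  b = sum-resp (≈-sym (⊗-zeroʳ (X ^ j))) sum-[]
    sum-X^⊗ j (c ∷ P) zero    le b =
      sum-resp (≈-sym (≈-trans (⊗-congˡ (X ^ j) (bounded-zero {c ∷ P} b)) (⊗-zeroʳ (X ^ j)))) sum-[]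
    sum-X^⊗ j (c ∷ P) (suc n) le b = sum-resp (≈-sym split)
      (sum-⊕ (c · X ^ j) (X ^ suc j ⊗ P) (sum-X^ c j (ℕₚ.≤-trans (ℕₚ.m≤m+n (suc j) n) le′))
        (sum-X^⊗ (suc j) P n le′ λ i n≤i → b (suc i) (s≤s n≤i)))
      where
      le′ : suc (j ℕ.+ n) ≤ q ℕ.+ q
      le′ = subst (_≤ q ℕ.+ q) (ℕₚ.+-suc j n) le
      split : X ^ j ⊗ (c ∷ P) ≈ c · X ^ j ⊕ X ^ suc j ⊗ P
      split = ≈-trans (⊗-shiftʳ (X ^ j) c P) (⊕-cong (≈-refl {c · X ^ j})
        (≈-sym (≈-trans (⊗-cong (shift-X^ j) (≈-refl {P})) (shift-⊗ (X ^ j) P))))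

  Σ-eval-coef : ∀ P → Bounded (q ℕ.+ q) P → Σ-eval P ≡ -1# * coef P q
  Σ-eval-coef P b = sum-resp (⊗-identityˡ P) (sum-X^⊗ 0 P (q ℕ.+ q) ℕₚ.≤-refl b)

  1≢-1 : 1# ≢ -1#
  1≢-1 e = ι-nonzero {2} (s≤s z≤n) (s≤s (ℕₚ.+-mono-≤ 0<h 0<h))
    (trans (sym (ι-+ 1 1)) (trans (cong (1# +_) e) 1+-1≡0))

  -- `c^h` is a square root of `c^(p-1) = 1`.
  ^h-≢0 : ∀ {c} → c ≢ 0# → c ^ˢ h ≡ 1# ⊎ c ^ˢ h ≡ -1#
  ^h-≢0 {c} c≢0 =
    [ (λ e → inj₁ (x+-1y≡0⇒x≡y e)) , (λ e → inj₂ (x+-1y≡0⇒x≡y (trans (cong (s +_) -1*-1≡1) e))) ]′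
      (x*y≡0⇒x≡0⊎y≡0 (s + -1# * 1#) (s + 1#) factored)
    where
    open ≡-Reasoning
    s = c ^ˢ h
    factored : (s + -1# * 1#) * (s + 1#) ≡ 0#
    factored = begin
      (s + -1# * 1#) * (s + 1#)    ≡⟨ cong (λ m → (s + m) * (s + 1#)) (S.*-identityʳ -1#) ⟩
      (s + -1#) * (s + 1#)         ≡⟨ S.distribʳ (s + 1#) s -1# ⟩
      s * (s + 1#) + -1# * (s + 1#)  ≡⟨ cong (_+ -1# * (s + 1#)) (trans (*-distribˡ s s 1#)
                                         (cong₂ _+_ (trans (sym (^-+ c h h)) (fermat c≢0)) (S.*-identityʳ s))) ⟩
      (1# + s) + -1# * (s + 1#)    ≡⟨ cong (_+ -1# * (s + 1#)) (+-comm 1# s) ⟩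
      (s + 1#) + -1# * (s + 1#)    ≡⟨ x+-1x≡0 (s + 1#) ⟩
      0#                           ∎

  select : ∀ {P Q : Set} → Dec P → Dec Q → ℕ
  select (yes _) _       = 1
  select (no _)  (yes _) = 2
  select (no _)  (no _)  = 0

  -- For ε = 1 this counts the square roots of c, for ε = -1 those of d c with d a fixed non-square.
  weight : F → F → ℕ
  weight ε c = select (c ≟ 0#) (c ^ˢ h ≟ ε)

  weight-complement : ∀ c → weight 1# c ℕ.+ weight -1# c ≡ 2
  weight-complement c = cases (c ≟ 0#) (c ^ˢ h ≟ 1#) (c ^ˢ h ≟ -1#)
    where
    cases : ∀ d e e′ → select {c ≡ 0#} {c ^ˢ h ≡ 1#} d e ℕ.+ select {c ≡ 0#} {c ^ˢ h ≡ -1#} d e′ ≡ 2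
    cases (yes _)  _        _        = refl
    cases (no _)   (yes e)  (yes e′) = ⊥-elim (1≢-1 (trans (sym e) e′))
    cases (no _)   (yes _)  (no _)   = refl
    cases (no _)   (no _)   (yes _)  = refl
    cases (no c≢0) (no ≢1)  (no ≢-1) = ⊥-elim ([ ≢1 , ≢-1 ]′ (^h-≢0 c≢0))

  ι-weight : ∀ c → ι (weight 1# c) ≡ 1# + c ^ˢ h
  ι-weight c = cases (c ≟ 0#) (c ^ˢ h ≟ 1#)
    where
    cases : ∀ d e → ι (select {c ≡ 0#} {c ^ˢ h ≡ 1#} d e) ≡ 1# + c ^ˢ h
    cases (yes c≡0) _ =
      sym (trans (cong (1# +_) (trans (cong (_^ˢ h) c≡0) (0^ 0<h))) (S.+-identityʳ 1#))
    cases (no c≢0) (yes e) = trans (sym (ι-+ 1 1)) (cong (1# +_) (sym e))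
    cases (no c≢0) (no ≢1) = [ (λ e → ⊥-elim (≢1 e)) ,
      (λ e → trans ι-0 (trans (sym 1+-1≡0) (cong (1# +_) (sym e)))) ]′ (^h-≢0 c≢0)

  squareRoots : F → ℕ
  squareRoots c = sum (λ y → indicator (y * y ≟ c))

  private
    indicator-cases : ∀ {P : Set} (d : Dec P) → indicator d ≡ 0 ⊎ indicator d ≡ 1 × P
    indicator-cases (yes x) = inj₂ (refl , x)
    indicator-cases (no _)  = inj₁ refl

    -- If `y² = c` is nonzero, then `c^h = y^(p-1) = 1`, and a quadratic polynomial has at most two
    -- roots; if `c = 0`, the only root is 0.
    squareRoots≤weight : ∀ c → squareRoots c ≤ weight 1# c
    squareRoots≤weight c = cases (c ≟ 0#) (c ^ˢ h ≟ 1#)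
      where
      square-zero : ∀ y → y * y ≡ 0# → y ≡ 0#
      square-zero y e = [ (λ z → z) , (λ z → z) ]′ (x*y≡0⇒x≡0⊎y≡0 y y e)
      count : ∀ k c′ → 0 < k → (∀ y → y * y ≡ c → y ^ˢ k ≡ c′) → squareRoots c ≤ k
      count k c′ 0<k roots = nth-root-count k 0<k c′ (λ y → indicator (y * y ≟ c)) λ y →
        [ inj₁ , (λ { (e , s) → inj₂ (e , roots y s) }) ]′ (indicator-cases (y * y ≟ c))
      none : c ≢ 0# → c ^ˢ h ≢ 1# → ∀ y (d : Dec (y * y ≡ c)) → indicator d ≡ 0
      none c≢0 ≢1 y (no _)  = refl
      none c≢0 ≢1 y (yes e) = ⊥-elim (≢1 (trans (cong (_^ˢ h) (sym e)) (trans (*-^ y y h)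
        (trans (sym (^-+ y h h)) (fermat λ y≡0 → c≢0 (trans (sym e) (trans (cong (_* y) y≡0) (*-zeroˡ y))))))))
      cases : ∀ d e → squareRoots c ≤ select {c ≡ 0#} {c ^ˢ h ≡ 1#} d e
      cases (yes c≡0) _       = count 1 0# (s≤s z≤n) λ y e →
        trans (S.*-identityʳ y) (square-zero y (trans e c≡0))
      cases (no c≢0)  (yes _) = count 2 c (s≤s z≤n) λ y e → trans (cong (y *_) (S.*-identityʳ y)) e
      cases (no c≢0)  (no ≢1) = ℕₚ.≤-reflexive (sum-zero (λ y → none c≢0 ≢1 y (y * y ≟ c)))

    Σ-squareRoots : sum squareRoots ≡ p
    Σ-squareRoots = trans (∑-comm (λ c y → indicator (y * y ≟ c)))
      (trans (sum-cong-≗ {p} (λ y → sum-indicator-≡ (y * y ≟_))) (trans (sum-const p 1) (ℕₚ.*-identityʳ p)))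

  -- One for the residue 0 and two for each of the at most `h` roots of `X^h - ε`, together
  -- `1 + 2 h`.
  sum-weight≤p : ∀ ε → sum (weight ε) ≤ p
  sum-weight≤p ε = ℕₚ.≤-trans (sum-mono-≤ {p} split) (subst₂ _≤_
    (sym (∑-distrib-+ (λ x → indicator (0# ≟ x)) (λ x → 2 ℕ.* unit x)))
    refl
    (ℕₚ.+-mono-≤ (ℕₚ.≤-reflexive (sum-indicator-≡ (0# ≟_)))
      (subst₂ _≤_ (*-distribˡ-sum 2 unit) (cong (h ℕ.+_) (ℕₚ.+-identityʳ h))
        (ℕₚ.*-monoʳ-≤ 2 (nth-root-count h 0<h ε unit λ x → indicator-cases (x ^ˢ h ≟ ε))))))
    where
    unit : F → ℕ
    unit x = indicator (x ^ˢ h ≟ ε)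
    split : ∀ x → weight ε x ≤ indicator (0# ≟ x) ℕ.+ 2 ℕ.* unit x
    split x = cases (x ≟ 0#) (0# ≟ x) (x ^ˢ h ≟ ε)
      where
      cases : ∀ d d′ e → select {x ≡ 0#} {x ^ˢ h ≡ ε} d e ≤ indicator {0# ≡ x} d′ ℕ.+ 2 ℕ.* indicator e
      cases (yes _) (yes _)  _       = s≤s z≤n
      cases (yes e) (no ≢)   _       = ⊥-elim (≢ (sym e))
      cases (no _)  d′       (yes _) = ℕₚ.m≤n+m 2 (indicator d′)
      cases (no _)  _        (no _)  = z≤n

  -- Euler's criterion: both sides sum to p over all c, so the inequality is an equality.
  squareRoots≡weight : ∀ c → squareRoots c ≡ weight 1# c
  squareRoots≡weight = sum-≤-tight squareRoots≤weight
    (subst (sum (weight 1#) ≤_) (sym Σ-squareRoots) (sum-weight≤p 1#))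

-- Numbers of unknowns and equations, and degrees of the auxiliary polynomial.

double-cancel-≤ : ∀ {m n} → m ℕ.+ m ≤ n ℕ.+ n → m ≤ n
double-cancel-≤ le = ℕₚ.≮⇒≥ λ n<m → ℕₚ.<⇒≱ (ℕₚ.+-mono-< n<m n<m) le

triangular : ℕ → ℕ
triangular zero    = 0
triangular (suc n) = suc n ℕ.+ triangular n

double-triangular : ∀ n → triangular n ℕ.+ triangular n ≡ n ℕ.* suc n
double-triangular zero    = refl
double-triangular (suc n) = trans (lemma n (triangular n))
  (trans (cong (2 ℕ.* suc n ℕ.+_) (double-triangular n)) (lemma′ n))
  where
  lemma : ∀ n t → suc n ℕ.+ t ℕ.+ (suc n ℕ.+ t) ≡ 2 ℕ.* suc n ℕ.+ (t ℕ.+ t)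
  lemma = solve-∀
  lemma′ : ∀ n → 2 ℕ.* suc n ℕ.+ n ℕ.* suc n ≡ suc n ℕ.* suc (suc n)
  lemma′ = solve-∀

-- Number of coefficients of l polynomials u_c, u_(c+1), … with deg u_i < m - i.
unknowns : ℕ → ℕ → ℕ → ℕ
unknowns m c zero    = 0
unknowns m c (suc l) = (m ∸ c) ℕ.+ unknowns m (suc c) l

unknowns-suc : ∀ m c l → unknowns m c (suc l) ≡ unknowns m c l ℕ.+ (m ∸ (c ℕ.+ l))
unknowns-suc m c zero    = trans (ℕₚ.+-identityʳ _) (cong (m ∸_) (sym (ℕₚ.+-identityʳ c)))
unknowns-suc m c (suc l) = trans (cong ((m ∸ c) ℕ.+_) (unknowns-suc m (suc c) l))
  (trans (sym (ℕₚ.+-assoc (m ∸ c) _ _)) (cong (λ s → unknowns m c (suc l) ℕ.+ (m ∸ s)) (sym (ℕₚ.+-suc c l))))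

-- A bound for the number of coefficients of the j-th condition on the unknowns.
equationsAt : ℕ → ℕ → ℕ
equationsAt m j = 2 ℕ.* ⌊ j /2⌋ ℕ.+ m ∸ ⌈ j /2⌉

equations : ℕ → ℕ → ℕ
equations m zero    = 0
equations m (suc n) = equations m n ℕ.+ equationsAt m n

equationsAt-+ : ∀ k j → equationsAt (suc k) j ℕ.+ ⌈ j /2⌉ ≡ 2 ℕ.* ⌊ j /2⌋ ℕ.+ suc k
equationsAt-+ k j = ℕₚ.m∸n+n≡m (bound j)
  where
  bound : ∀ j → ⌈ j /2⌉ ≤ 2 ℕ.* ⌊ j /2⌋ ℕ.+ suc k
  bound zero          = z≤n
  bound (suc zero)    = s≤s z≤n
  bound (suc (suc j)) = subst (suc ⌈ j /2⌉ ≤_) (arith ⌊ j /2⌋ k) (s≤s (ℕₚ.m≤n⇒m≤1+n (bound j)))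
    where
    arith : ∀ i k → suc (suc (2 ℕ.* i ℕ.+ suc k)) ≡ 2 ℕ.* suc i ℕ.+ suc k
    arith = solve-∀

-- There is one polynomial more than there are conditions, a surplus of `m = suc k`. Passing from
-- `n` to `n + 2` adds two conditions and one polynomial to each family, at most `2 n + 3` more
-- equations than unknowns; these increments add up to `triangular n`.
equations≤unknowns : ∀ k n → suc k ℕ.+ equations (suc k) n ≤
  unknowns (suc k) 0 (suc ⌈ n /2⌉) ℕ.+ unknowns (suc k) 3 ⌊ n /2⌋ ℕ.+ triangular n
equations≤unknowns k zero       = ℕₚ.≤-reflexive (base k)
  where
  base : ∀ k → suc k ℕ.+ 0 ≡ suc k ℕ.+ 0 ℕ.+ 0 ℕ.+ 0
  base = solve-∀
equations≤unknowns k (suc zero) = ℕₚ.≤-reflexive (base k)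
  where
  base : ∀ k → suc k ℕ.+ suc k ≡ suc k ℕ.+ (k ℕ.+ 0) ℕ.+ 0 ℕ.+ 1
  base = solve-∀
-- All subtrahends are added on both sides. For the equations the difference is exact by
-- `equationsAt-+`; for the unknowns `m ≤ a + (m ∸ a)` is enough, which survives truncation.
equations≤unknowns k (suc (suc n)) = ℕₚ.+-cancelʳ-≤ (1 ℕ.+ (A ℕ.+ B) ℕ.+ (A ℕ.+ B ℕ.+ 4)) _ _ (begin
  suc k ℕ.+ (E ℕ.+ e₀ ℕ.+ e₁) ℕ.+ (1 ℕ.+ (A ℕ.+ B) ℕ.+ (A ℕ.+ B ℕ.+ 4))
    ≡⟨ arith₁ k E e₀ e₁ A B ⟩
  (suc k ℕ.+ E) ℕ.+ ((e₀ ℕ.+ A) ℕ.+ (e₁ ℕ.+ suc B)) ℕ.+ (A ℕ.+ B ℕ.+ 4)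
    ≡⟨ cong (λ s → (suc k ℕ.+ E) ℕ.+ s ℕ.+ (A ℕ.+ B ℕ.+ 4)) (cong₂ ℕ._+_ (equationsAt-+ k n) (equationsAt-+ k (suc n))) ⟩
  (suc k ℕ.+ E) ℕ.+ ((2 ℕ.* B ℕ.+ suc k) ℕ.+ (2 ℕ.* A ℕ.+ suc k)) ℕ.+ (A ℕ.+ B ℕ.+ 4)
    ≤⟨ ℕₚ.+-monoˡ-≤ (A ℕ.+ B ℕ.+ 4) (ℕₚ.+-mono-≤ (equations≤unknowns k n)
         (ℕₚ.+-mono-≤ (ℕₚ.+-monoʳ-≤ (2 ℕ.* B) (ℕₚ.m≤n+m∸n (suc k) (suc A))) (ℕₚ.+-monoʳ-≤ (2 ℕ.* A) (ℕₚ.m≤n+m∸n (suc k) (3 ℕ.+ B))))) ⟩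
  (U ℕ.+ V ℕ.+ triangular n) ℕ.+ ((2 ℕ.* B ℕ.+ (suc A ℕ.+ u)) ℕ.+ (2 ℕ.* A ℕ.+ (3 ℕ.+ B ℕ.+ v))) ℕ.+ (A ℕ.+ B ℕ.+ 4)
    ≡⟨ arith₂ U V (triangular n) A B u v ⟩
  (U ℕ.+ u) ℕ.+ (V ℕ.+ v) ℕ.+ (suc (suc (B ℕ.+ A)) ℕ.+ (suc (B ℕ.+ A) ℕ.+ triangular n)) ℕ.+ (1 ℕ.+ (A ℕ.+ B) ℕ.+ (A ℕ.+ B ℕ.+ 4))
    ≡⟨ cong (ℕ._+ (1 ℕ.+ (A ℕ.+ B) ℕ.+ (A ℕ.+ B ℕ.+ 4))) (cong₂ (λ s t → s ℕ.+ (suc (suc t) ℕ.+ (suc t ℕ.+ triangular n)))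
         (cong₂ ℕ._+_ (sym (unknowns-suc (suc k) 0 (suc A))) (sym (unknowns-suc (suc k) 3 B))) (ℕₚ.⌊n/2⌋+⌈n/2⌉≡n n)) ⟩
  unknowns (suc k) 0 (suc (suc A)) ℕ.+ unknowns (suc k) 3 (suc B) ℕ.+ triangular (suc (suc n)) ℕ.+ (1 ℕ.+ (A ℕ.+ B) ℕ.+ (A ℕ.+ B ℕ.+ 4)) ∎)
  where
  open ℕₚ.≤-Reasoning
  A = ⌈ n /2⌉
  B = ⌊ n /2⌋
  E = equations (suc k) n
  e₀ = equationsAt (suc k) n
  e₁ = equationsAt (suc k) (suc n)
  U = unknowns (suc k) 0 (suc A)
  V = unknowns (suc k) 3 B
  u = suc k ∸ suc A
  v = suc k ∸ (3 ℕ.+ B)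
  arith₁ : ∀ k E e₀ e₁ A B → suc k ℕ.+ (E ℕ.+ e₀ ℕ.+ e₁) ℕ.+ (1 ℕ.+ (A ℕ.+ B) ℕ.+ (A ℕ.+ B ℕ.+ 4))
    ≡ (suc k ℕ.+ E) ℕ.+ ((e₀ ℕ.+ A) ℕ.+ (e₁ ℕ.+ suc B)) ℕ.+ (A ℕ.+ B ℕ.+ 4)
  arith₁ = solve-∀
  arith₂ : ∀ U V T A B u v →
    (U ℕ.+ V ℕ.+ T) ℕ.+ ((2 ℕ.* B ℕ.+ (suc A ℕ.+ u)) ℕ.+ (2 ℕ.* A ℕ.+ (3 ℕ.+ B ℕ.+ v))) ℕ.+ (A ℕ.+ B ℕ.+ 4)
    ≡ (U ℕ.+ u) ℕ.+ (V ℕ.+ v) ℕ.+ (suc (suc (B ℕ.+ A)) ℕ.+ (suc (B ℕ.+ A) ℕ.+ T)) ℕ.+ (1 ℕ.+ (A ℕ.+ B) ℕ.+ (A ℕ.+ B ℕ.+ 4))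
  arith₂ = solve-∀

-- The surplus `m` has to exceed the deficit `triangular n`; this fixes the value of `m`.
equations<unknowns : ∀ n → let m = suc (triangular n) in
  equations m n < unknowns m 0 (suc ⌈ n /2⌉) ℕ.+ unknowns m 3 ⌊ n /2⌋
equations<unknowns n = ℕₚ.+-cancelˡ-≤ (triangular n) _ _ (subst₂ _≤_ (sym (ℕₚ.+-suc _ _)) (ℕₚ.+-comm _ (triangular n))
  (equations≤unknowns (triangular n) n))

private
  double-⌊/2⌋ : ∀ n → ⌊ n /2⌋ ℕ.+ ⌊ n /2⌋ ≤ n
  double-⌊/2⌋ n = ℕₚ.≤-trans (ℕₚ.+-monoʳ-≤ ⌊ n /2⌋ (ℕₚ.⌊n/2⌋≤⌈n/2⌉ n)) (ℕₚ.≤-reflexive (ℕₚ.⌊n/2⌋+⌈n/2⌉≡n n))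

  -- Twice the degree is `2 α (p - 1) + 2 (d + α)`, where `2 α ≤ n + 1` and `d + α` is at most
  -- `n (n + 1) / 2`.
  degree-even : ∀ h n α d → α < suc ⌈ n /2⌉ → d ℕ.+ α ℕ.+ 0 < suc (triangular n) →
    let t = α ℕ.* suc (h ℕ.+ h) ℕ.+ d in t ℕ.+ t ≤ suc n ℕ.* (h ℕ.+ h ℕ.+ n)
  degree-even h n α d (s≤s α≤) (s≤s d≤) = begin
    α ℕ.* suc (h ℕ.+ h) ℕ.+ d ℕ.+ (α ℕ.* suc (h ℕ.+ h) ℕ.+ d)
      ≡⟨ arith₁ α h d ⟩
    (α ℕ.+ α) ℕ.* (h ℕ.+ h) ℕ.+ ((d ℕ.+ α ℕ.+ 0) ℕ.+ (d ℕ.+ α ℕ.+ 0))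
      ≤⟨ ℕₚ.+-mono-≤ (ℕₚ.*-monoˡ-≤ (h ℕ.+ h) (ℕₚ.≤-trans (ℕₚ.+-mono-≤ α≤ α≤) (double-⌊/2⌋ (suc n)))) (ℕₚ.+-mono-≤ d≤ d≤) ⟩
    suc n ℕ.* (h ℕ.+ h) ℕ.+ (triangular n ℕ.+ triangular n)
      ≡⟨ cong (suc n ℕ.* (h ℕ.+ h) ℕ.+_) (double-triangular n) ⟩
    suc n ℕ.* (h ℕ.+ h) ℕ.+ n ℕ.* suc n
      ≡⟨ arith₂ n h ⟩
    suc n ℕ.* (h ℕ.+ h ℕ.+ n) ∎
    where
    open ℕₚ.≤-Reasoning
    arith₁ : ∀ α h d → α ℕ.* suc (h ℕ.+ h) ℕ.+ d ℕ.+ (α ℕ.* suc (h ℕ.+ h) ℕ.+ d)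
      ≡ (α ℕ.+ α) ℕ.* (h ℕ.+ h) ℕ.+ ((d ℕ.+ α ℕ.+ 0) ℕ.+ (d ℕ.+ α ℕ.+ 0))
    arith₁ = solve-∀
    arith₂ : ∀ n h → suc n ℕ.* (h ℕ.+ h) ℕ.+ n ℕ.* suc n ≡ suc n ℕ.* (h ℕ.+ h ℕ.+ n)
    arith₂ = solve-∀

  -- Here `3 (h + 1)` is the degree of `f^(h+1)`. Twice the total degree is
  -- `(2 β + 3) (p - 1) + 2 (d + β + 3)`, and `2 β + 3 ≤ n + 1`.
  degree-odd : ∀ h n β d → β < ⌊ n /2⌋ → d ℕ.+ β ℕ.+ 3 < suc (triangular n) →
    let t = suc h ℕ.* 3 ℕ.+ (β ℕ.* suc (h ℕ.+ h) ℕ.+ d) in t ℕ.+ t ≤ suc n ℕ.* (h ℕ.+ h ℕ.+ n)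
  degree-odd h n β d β< (s≤s d≤) = begin
    suc h ℕ.* 3 ℕ.+ (β ℕ.* suc (h ℕ.+ h) ℕ.+ d) ℕ.+ (suc h ℕ.* 3 ℕ.+ (β ℕ.* suc (h ℕ.+ h) ℕ.+ d))
      ≡⟨ arith₁ β h d ⟩
    suc (suc β ℕ.+ suc β) ℕ.* (h ℕ.+ h) ℕ.+ ((d ℕ.+ β ℕ.+ 3) ℕ.+ (d ℕ.+ β ℕ.+ 3))
      ≤⟨ ℕₚ.+-mono-≤ (ℕₚ.*-monoˡ-≤ (h ℕ.+ h) (s≤s (ℕₚ.≤-trans (ℕₚ.+-mono-≤ β< β<) (double-⌊/2⌋ n)))) (ℕₚ.+-mono-≤ d≤ d≤) ⟩
    suc n ℕ.* (h ℕ.+ h) ℕ.+ (triangular n ℕ.+ triangular n)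
      ≡⟨ cong (suc n ℕ.* (h ℕ.+ h) ℕ.+_) (double-triangular n) ⟩
    suc n ℕ.* (h ℕ.+ h) ℕ.+ n ℕ.* suc n
      ≡⟨ arith₂ n h ⟩
    suc n ℕ.* (h ℕ.+ h ℕ.+ n) ∎
    where
    open ℕₚ.≤-Reasoning
    arith₁ : ∀ β h d → suc h ℕ.* 3 ℕ.+ (β ℕ.* suc (h ℕ.+ h) ℕ.+ d) ℕ.+ (suc h ℕ.* 3 ℕ.+ (β ℕ.* suc (h ℕ.+ h) ℕ.+ d))
      ≡ suc (suc β ℕ.+ suc β) ℕ.* (h ℕ.+ h) ℕ.+ ((d ℕ.+ β ℕ.+ 3) ℕ.+ (d ℕ.+ β ℕ.+ 3))
    arith₁ = solve-∀
    arith₂ : ∀ n h → suc n ℕ.* (h ℕ.+ h) ℕ.+ n ℕ.* suc n ≡ suc n ℕ.* (h ℕ.+ h ℕ.+ n)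
    arith₂ = solve-∀

  -- Modulo `p = 2 h + 1` the left side is `d ≤ h + 1`, while the right side is `h + 2 + e` with
  -- `e ≤ h - 2` and so lies between `h + 2` and `2 h`.
  degree-distinct : ∀ h α d β e → d ℕ.+ α ≤ suc h → e ℕ.+ β ℕ.+ 3 ≤ suc h →
    α ℕ.* suc (h ℕ.+ h) ℕ.+ d ≢ suc h ℕ.* 3 ℕ.+ (β ℕ.* suc (h ℕ.+ h) ℕ.+ e)
  degree-distinct h α d β e d≤ e≤ eq with ℕₚ.<-cmp α (suc β)
  ... | tri< (s≤s α≤β) _ _ = ℕₚ.<⇒≢ (begin-strict
    α ℕ.* suc (h ℕ.+ h) ℕ.+ d          ≤⟨ ℕₚ.+-mono-≤ (ℕₚ.*-monoˡ-≤ (suc (h ℕ.+ h)) α≤β) (ℕₚ.≤-trans (ℕₚ.m≤m+n d α) d≤) ⟩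
    β ℕ.* suc (h ℕ.+ h) ℕ.+ suc h      <⟨ ℕₚ.m<n+m _ {suc (e ℕ.+ (h ℕ.+ h ℕ.+ 1))} (s≤s z≤n) ⟩
    suc (e ℕ.+ (h ℕ.+ h ℕ.+ 1)) ℕ.+ (β ℕ.* suc (h ℕ.+ h) ℕ.+ suc h) ≡⟨ arith e h (β ℕ.* suc (h ℕ.+ h)) ⟩
    suc h ℕ.* 3 ℕ.+ (β ℕ.* suc (h ℕ.+ h) ℕ.+ e) ∎) eq
    where
    open ℕₚ.≤-Reasoning
    arith : ∀ e h s → suc (e ℕ.+ (h ℕ.+ h ℕ.+ 1)) ℕ.+ (s ℕ.+ suc h) ≡ suc h ℕ.* 3 ℕ.+ (s ℕ.+ e)
    arith = solve-∀
  ... | tri≈ _ refl _ = ℕₚ.<⇒≢ (begin-strict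
    suc β ℕ.* suc (h ℕ.+ h) ℕ.+ d      ≤⟨ ℕₚ.+-monoʳ-≤ (suc β ℕ.* suc (h ℕ.+ h))
                                            (ℕₚ.≤-trans (ℕₚ.m≤m+n d β) (ℕₚ.≤-pred (subst (_≤ suc h) (ℕₚ.+-suc d β) d≤))) ⟩
    suc β ℕ.* suc (h ℕ.+ h) ℕ.+ h      <⟨ ℕₚ.m<n+m _ {suc (suc e)} (s≤s z≤n) ⟩
    suc (suc e) ℕ.+ (suc β ℕ.* suc (h ℕ.+ h) ℕ.+ h) ≡⟨ arith e h β ⟩
    suc h ℕ.* 3 ℕ.+ (β ℕ.* suc (h ℕ.+ h) ℕ.+ e) ∎) eq
    where
    open ℕₚ.≤-Reasoning
    arith : ∀ e h β → suc (suc e) ℕ.+ (suc β ℕ.* suc (h ℕ.+ h) ℕ.+ h) ≡ suc h ℕ.* 3 ℕ.+ (β ℕ.* suc (h ℕ.+ h) ℕ.+ e)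
    arith = solve-∀
  ... | tri> _ _ β+2≤α = ℕₚ.>⇒≢ (begin-strict
    suc h ℕ.* 3 ℕ.+ (β ℕ.* suc (h ℕ.+ h) ℕ.+ e)  ≤⟨ ℕₚ.m≤m+n _ β ⟩
    suc h ℕ.* 3 ℕ.+ (β ℕ.* suc (h ℕ.+ h) ℕ.+ e) ℕ.+ β  ≡⟨ arith₁ e h β ⟩
    3 ℕ.* h ℕ.+ β ℕ.* suc (h ℕ.+ h) ℕ.+ (e ℕ.+ β ℕ.+ 3) ≤⟨ ℕₚ.+-monoʳ-≤ (3 ℕ.* h ℕ.+ β ℕ.* suc (h ℕ.+ h)) e≤ ⟩
    3 ℕ.* h ℕ.+ β ℕ.* suc (h ℕ.+ h) ℕ.+ suc h <⟨ ℕₚ.n<1+n _ ⟩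
    suc (3 ℕ.* h ℕ.+ β ℕ.* suc (h ℕ.+ h) ℕ.+ suc h) ≡⟨ arith₂ h β ⟩
    suc (suc β) ℕ.* suc (h ℕ.+ h)      ≤⟨ ℕₚ.*-monoˡ-≤ (suc (h ℕ.+ h)) β+2≤α ⟩
    α ℕ.* suc (h ℕ.+ h)                ≤⟨ ℕₚ.m≤m+n _ d ⟩
    α ℕ.* suc (h ℕ.+ h) ℕ.+ d          ∎) eq
    where
    open ℕₚ.≤-Reasoning
    arith₁ : ∀ e h β → suc h ℕ.* 3 ℕ.+ (β ℕ.* suc (h ℕ.+ h) ℕ.+ e) ℕ.+ β ≡ 3 ℕ.* h ℕ.+ β ℕ.* suc (h ℕ.+ h) ℕ.+ (e ℕ.+ β ℕ.+ 3)
    arith₁ = solve-∀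
    arith₂ : ∀ h β → suc (3 ℕ.* h ℕ.+ β ℕ.* suc (h ℕ.+ h) ℕ.+ suc h) ≡ suc (suc β) ℕ.* suc (h ℕ.+ h)
    arith₂ = solve-∀

funToFin-cong : ∀ {m n} {f g : Fin m → Fin n} → f ≗ g → funToFin f ≡ funToFin g
funToFin-cong {zero}  e = refl
funToFin-cong {suc m} e = cong₂ combine (e zero) (funToFin-cong (λ i → e (suc i)))

-- There are `k^n` arguments and only `k^m` values. For an additive `φ` this gives a nonzero element
-- of the kernel, without elimination.
collision : ∀ {k m n} → 1 < k → m < n → (φ : (Fin n → Fin k) → Fin m → Fin k) →
  ∃₂ λ v w → (∃ λ i → v i ≢ w i) × φ v ≗ φ w
collision {k} {m} {n} 1<k m<n φ
  with pigeonhole (ℕₚ.^-monoʳ-< k 1<k m<n) (λ i → funToFin (φ (finToFun i)))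
... | i , j , i<j , e = finToFun i , finToFun j ,
  ¬∀⟶∃¬ n _ (λ l → finToFun {k} {n} i l Finₚ.≟ finToFun j l) (λ all → Finₚ.<⇒≢ i<j
    (trans (sym (funToFin-finToFin {n} {k} i)) (trans (funToFin-cong all) (funToFin-finToFin {n} {k} j)))) ,
  λ l → trans (sym (finToFun-funToFin (φ (finToFun i)) l))
    (trans (cong (λ s → finToFun {k} {m} s l) e) (finToFun-funToFin (φ (finToFun j)) l))

-- Existence of an auxiliary polynomial and Stepanov's estimate.

module StepanovBound (h : ℕ) (prime : Prime (suc (h ℕ.+ h)))
  (a b : Fin (suc (h ℕ.+ h))) where

  open OddPrimeField h prime
  open Stepanov a b h (trans (nat≡ι (suc (h ℕ.+ h))) ι-p)
    (λ {n} 0<n n<p e → ι-nonzero 0<n n<p (trans (sym (nat≡ι n)) e)) public hiding (p)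

  -- The summands have distinct degrees: 2 deg u_a ≤ p + 1 - 2a and 2 deg v_b + 3 ≤ p - 2 - 2b are too small for
  -- the leading terms of two of them to meet.
  top-auxiliary : ∀ n → n ℕ.* suc n ≤ suc p → ∀ {ε} → ε ≢ 0# → ∀ us vs →
    BelowAll (suc (triangular n)) 0 us → BelowAll (suc (triangular n)) 3 vs →
    length us ≡ suc ⌈ n /2⌉ → length vs ≡ ⌊ n /2⌋ →
    ¬ (All (_≈ []) us × All (_≈ []) vs) →
    ∃ λ t → Top (auxiliary ε us vs) t × t ℕ.+ t ≤ suc n ℕ.* (h ℕ.+ h ℕ.+ n)
  top-auxiliary n n²≤ {ε} ε≢0 us vs bu bv lu lv nonzero =
    cases (top-linearCombination topY m≤p 0 us bu) (top-linearCombination topY m≤p 3 vs bv)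
    where
    κ≤ : triangular n ≤ suc h
    κ≤ = double-cancel-≤ (subst₂ _≤_ (sym (double-triangular n)) (cong suc (sym (ℕₚ.+-suc h h))) n²≤)
    m≤p : suc (triangular n) ≤ p
    m≤p = ℕₚ.≤-trans (s≤s κ≤) (s≤s (ℕₚ.+-monoˡ-≤ h 0<h))
    topY : Top (X ^ p) p
    topY = subst (Top (X ^ p)) (ℕₚ.*-identityʳ p) (top-^ top-X p)
    top-ε : Top (const ε) 0
    top-ε = ε≢0 , λ { (suc i) _ → refl }
    U = linearCombination (X ^ p) us
    V = linearCombination (X ^ p) vs
    W = const ε ⊗ (twist true ⊗ V)
    topW : ∀ {t} → Top V t → Top W (suc h ℕ.* 3 ℕ.+ t)
    topW t = top-⊗ top-ε (top-⊗ (top-^ top-f (suc h)) t)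
    Result = ∃ λ t → Top (auxiliary ε us vs) t × t ℕ.+ t ≤ suc n ℕ.* (h ℕ.+ h ℕ.+ n)
    W≈0 : All (_≈ []) vs → W ≈ []
    W≈0 zs = ≈-trans (⊗-congˡ (const ε) (≈-trans (⊗-congˡ (twist true) (linearCombination-zero (X ^ p) zs))
      (⊗-zeroʳ (twist true)))) (⊗-zeroʳ (const ε))
    Tops : ℕ → List Poly → Set
    Tops c xs = ∃ λ i → ∃ λ d → Top (linearCombination (X ^ p) xs) (i ℕ.* p ℕ.+ d) × i < length xs × d ℕ.+ i ℕ.+ c < suc (triangular n)
    below-leading : ∀ {P s t} → Top P s → s < t → Bounded t P
    below-leading {P} top s<t = bounded-≤ P s<t (bounded top)
    cases : All (_≈ []) us ⊎ Tops 0 us → All (_≈ []) vs ⊎ Tops 3 vs → Result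
    cases (inj₁ zu) (inj₁ zv) = ⊥-elim (nonzero (zu , zv))
    cases (inj₂ (i , d , t , i< , d<)) (inj₁ zv) = _ ,
      top-cong (≈-sym (≈-trans (⊕-cong (≈-refl {U}) (W≈0 zv)) (⊕-identityʳ U))) t ,
      degree-even h n i d (subst (i <_) lu i<) d<
    cases (inj₁ zu) (inj₂ (i , d , t , i< , d<)) = _ ,
      top-cong (≈-sym (⊕-cong (linearCombination-zero (X ^ p) zu) (≈-refl {W}))) (topW t) ,
      degree-odd h n i d (subst (i <_) lv i<) d<
    cases (inj₂ (i , d , t , i< , d<)) (inj₂ (j , e , t′ , j< , e<)) =
      compare (ℕₚ.<-cmp (i ℕ.* p ℕ.+ d) (suc h ℕ.* 3 ℕ.+ (j ℕ.* p ℕ.+ e)))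
      where
      compare : Tri (i ℕ.* p ℕ.+ d < suc h ℕ.* 3 ℕ.+ (j ℕ.* p ℕ.+ e)) (i ℕ.* p ℕ.+ d ≡ suc h ℕ.* 3 ℕ.+ (j ℕ.* p ℕ.+ e))
        (suc h ℕ.* 3 ℕ.+ (j ℕ.* p ℕ.+ e) < i ℕ.* p ℕ.+ d) → Result
      compare (tri< lt _ _) = _ , top-cong (⊕-comm W U) (top-⊕ (topW t′) (below-leading t lt)) ,
        degree-odd h n j e (subst (j <_) lv j<) e<
      compare (tri> _ _ gt) = _ , top-⊕ t (below-leading (topW t′) gt) ,
        degree-even h n i d (subst (i <_) lu i<) d<
      compare (tri≈ _ eq _) = ⊥-elim (degree-distinct h i d j e
        (ℕₚ.≤-trans (ℕₚ.≤-pred (subst (_< suc (triangular n)) (ℕₚ.+-identityʳ _) d<)) κ≤)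
        (ℕₚ.≤-trans (ℕₚ.≤-pred e<) κ≤) eq)

  family : ∀ m c l → (Fin (unknowns m c l) → F) → List Poly
  family m c zero    v = []
  family m c (suc l) v =
    tabulate (λ i → v (i ↑ˡ unknowns m (suc c) l)) ∷ family m (suc c) l (λ i → v ((m ∸ c) ↑ʳ i))

  length-family : ∀ m c l v → length (family m c l v) ≡ l
  length-family m c zero    v = refl
  length-family m c (suc l) v = cong suc (length-family m (suc c) l _)

  coef-tabulate : ∀ {n} (v : Fin n → F) i → coef (tabulate v) (toℕ i) ≡ v i
  coef-tabulate v zero    = refl
  coef-tabulate v (suc i) = coef-tabulate (v ∘ suc) i

  bounded-tabulate : ∀ {n} (v : Fin n → F) → Bounded n (tabulate v)
  bounded-tabulate {zero}  v i       _         = refl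
  bounded-tabulate {suc n} v (suc i) (s≤s n≤i) = bounded-tabulate (v ∘ suc) i n≤i

  below-family : ∀ m c l v → BelowAll m c (family m c l v)
  below-family m c zero    v = tt
  below-family m c (suc l) v =
    (λ i le → bounded-tabulate _ i (ℕₚ.m≤n+o⇒m∸n≤o m c (subst (m ≤_) (ℕₚ.+-comm i c) le))) , below-family m (suc c) l _

  infixl 6 _⊖_
  _⊖_ : Poly → Poly → Poly
  P ⊖ Q = P ⊕ -1# · Q

  difference : List Poly → List Poly → List Poly
  difference = zipWith _⊖_

  length-difference : ∀ {l} us ws → length us ≡ l → length ws ≡ l → length (difference us ws) ≡ l
  length-difference us ws refl e =
    trans (length-zipWith _⊖_ us ws) (trans (cong (length us ℕ.⊓_) e) (ℕₚ.⊓-idem (length us)))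

  below-difference : ∀ {m} c us ws → BelowAll m c us → BelowAll m c ws → BelowAll m c (difference us ws)
  below-difference c []       ws       _        _          = tt
  below-difference c (u ∷ us) []       _        _          = tt
  below-difference c (u ∷ us) (w ∷ ws) (b , bs) (b′ , bs′) =
    below-⊕ u (-1# · w) b (below-· -1# w b′) , below-difference (suc c) us ws bs bs′

  family-injective : ∀ m c l v w → All (_≈ []) (difference (family m c l v) (family m c l w)) → v ≗ w
  family-injective m c (suc l) v w (z ∷ zs) k with splitAt (m ∸ c) k | Finₚ.join-splitAt (m ∸ c) (unknowns m (suc c) l) k
  ... | inj₁ i | refl = trans (sym (coef-tabulate (first v) i))
    (trans (at (⊕-cancel (tabulate (first v)) (tabulate (first w)) z) (toℕ i)) (coef-tabulate (first w) i))
    where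
    first : (Fin (unknowns m c (suc l)) → F) → Fin (m ∸ c) → F
    first v i = v (i ↑ˡ unknowns m (suc c) l)
  ... | inj₂ i | refl = family-injective m (suc c) l (λ i → v ((m ∸ c) ↑ʳ i)) (λ i → w ((m ∸ c) ↑ʳ i)) zs i

  ⊖-⊕ : ∀ P P′ Q Q′ → (P ⊕ P′) ⊖ (Q ⊕ Q′) ≈ (P ⊖ Q) ⊕ (P′ ⊖ Q′)
  ⊖-⊕ P P′ Q Q′ = ≈-trans (⊕-cong (≈-refl {P ⊕ P′}) (·-distribˡ -1# Q Q′))
    (interchange P P′ (-1# · Q) (-1# · Q′))
    where
    open CommutativeSemigroup (CommutativeMonoid.commutativeSemigroup ⊕-commutativeMonoid) using (interchange)

  ·-⊗ʳ : ∀ c P Q → P ⊗ (c · Q) ≈ c · (P ⊗ Q)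
  ·-⊗ʳ c P Q = ≈-trans (⊗-comm P (c · Q)) (≈-trans (·-⊗ c Q P) (·-cong refl (⊗-comm Q P)))

  ⊗-⊖ : ∀ R P Q → R ⊗ (P ⊖ Q) ≈ (R ⊗ P) ⊖ (R ⊗ Q)
  ⊗-⊖ R P Q = ≈-trans (CommutativeSemiring.distribˡ polynomials R P (-1# · Q))
    (⊕-cong (≈-refl {R ⊗ P}) (·-⊗ʳ -1# R Q))

  D^-⊖ : ∀ j e P Q → D^ j e (P ⊖ Q) ≈ D^ j e P ⊖ D^ j e Q
  D^-⊖ j e P Q = ≈-trans (D^-⊕ j e P (-1# · Q)) (⊕-cong (≈-refl {D^ j e P})
    (≈-trans (D^-cong j e (≈-sym (const-⊗ -1# Q))) (≈-trans (D^-constant j e {const -1#} (∂-const -1#) Q)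
      (const-⊗ -1# (D^ j e Q)))))

  D^-difference : ∀ j e us ws → length us ≡ length ws →
    linearCombination X (map (D^ j e) (difference us ws))
      ≈ linearCombination X (map (D^ j e) us) ⊖ linearCombination X (map (D^ j e) ws)
  D^-difference j e []       []       _  = ≈-refl
  D^-difference j e (u ∷ us) (w ∷ ws) eq = ≈-trans
    (⊕-cong (D^-⊖ j e u w) (≈-trans (⊗-congˡ X (D^-difference j e us ws (ℕₚ.suc-injective eq)))
      (⊗-⊖ X (linearCombination X (map (D^ j e) us)) (linearCombination X (map (D^ j e) ws)))))
    (≈-sym (⊖-⊕ (D^ j e u) (X ⊗ linearCombination X (map (D^ j e) us))
      (D^ j e w) (X ⊗ linearCombination X (map (D^ j e) ws))))

  condition-difference : ∀ j us vs us′ vs′ → length us ≡ length us′ → length vs ≡ length vs′ →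
    condition j (difference us us′) (difference vs vs′) ≈ condition j us vs ⊖ condition j us′ vs′
  condition-difference j us vs us′ vs′ e e′ = ≈-trans
    (⊕-cong (D^-difference j true us us′ e) (≈-trans (⊗-congˡ R (D^-difference j false vs vs′ e′)) (⊗-⊖ R V V′)))
    (≈-sym (⊖-⊕ U (R ⊗ V) U′ (R ⊗ V′)))
    where
    R = untwisted (parity j true)
    U = linearCombination X (map (D^ j true) us)
    V = linearCombination X (map (D^ j false) vs)
    U′ = linearCombination X (map (D^ j true) us′)
    V′ = linearCombination X (map (D^ j false) vs′)

  -- `ε` does not occur, so one solution serves both the curve and its twist.
  record Solution (n : ℕ) : Set where
    field
      us vs : List Poly
      below-us : BelowAll (suc (triangular n)) 0 us
      below-vs : BelowAll (suc (triangular n)) 3 vs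
      length-us : length us ≡ suc ⌈ n /2⌉
      length-vs : length vs ≡ ⌊ n /2⌋
      nontrivial : ¬ (All (_≈ []) us × All (_≈ []) vs)
      conditions : ∀ j → j < n → condition j us vs ≈ []

  module Unknowns (m lu lv : ℕ) where

    Assignment : Set
    Assignment = Fin (unknowns m 0 lu ℕ.+ unknowns m 3 lv) → F

    left : Assignment → Fin (unknowns m 0 lu) → F
    left v i = v (i ↑ˡ unknowns m 3 lv)

    right : Assignment → Fin (unknowns m 3 lv) → F
    right v i = v (unknowns m 0 lu ↑ʳ i)

    u u′ : Assignment → List Poly
    u  v = family m 0 lu (left v)
    u′ v = family m 3 lv (right v)

    halves : ∀ {v w} → left v ≗ left w → right v ≗ right w → v ≗ w
    halves el er k with splitAt (unknowns m 0 lu) k | Finₚ.join-splitAt (unknowns m 0 lu) (unknowns m 3 lv) k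
    ... | inj₁ i | refl = el i
    ... | inj₂ i | refl = er i

    coefficients : ∀ k → Assignment → Fin (equations m k) → F
    coefficients zero    v ()
    coefficients (suc k) v = coefficients k v ++ λ i → coef (condition k (u v) (u′ v)) (toℕ i)

    coefficients-≗ : ∀ v w k → coefficients k v ≗ coefficients k w → ∀ j → j < k → ∀ i → i < equationsAt m j →
      coef (condition j (u v) (u′ v)) i ≡ coef (condition j (u w) (u′ w)) i
    coefficients-≗ v w (suc k) e j j<k i i< = [ earlier , last ]′ (ℕₚ.m≤n⇒m<n∨m≡n (ℕₚ.≤-pred j<k))
      where
      row : Assignment → Fin (equationsAt m k) → F
      row v l = coef (condition k (u v) (u′ v)) (toℕ l)
      earlier : j < k → coef (condition j (u v) (u′ v)) i ≡ coef (condition j (u w) (u′ w)) i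
      earlier j<k′ = coefficients-≗ v w k (λ l → trans (sym (lookup-++ˡ (coefficients k v) (row v) l))
        (trans (e (l ↑ˡ equationsAt m k)) (lookup-++ˡ (coefficients k w) (row w) l))) j j<k′ i i<
      last : j ≡ k → coef (condition j (u v) (u′ v)) i ≡ coef (condition j (u w) (u′ w)) i
      last refl = subst (λ i → coef (condition k (u v) (u′ v)) i ≡ coef (condition k (u w) (u′ w)) i) (toℕ-fromℕ< i<)
        (trans (sym (lookup-++ʳ (coefficients k v) (row v) (fromℕ< i<)))
          (trans (e (equations m k ↑ʳ fromℕ< i<)) (lookup-++ʳ (coefficients k w) (row w) (fromℕ< i<))))

    conditions-≈ : ∀ v w n → coefficients n v ≗ coefficients n w → ∀ j → j < n →
      condition j (u v) (u′ v) ≈ condition j (u w) (u′ w)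
    conditions-≈ v w n e j j<n .at i with i ℕₚ.<? equationsAt m j
    ... | yes i< = coefficients-≗ v w n e j j<n i i<
    -- Coefficients not listed among the equations vanish for both assignments by the degree bound.
    ... | no  i≮ = trans (below v i high) (sym (below w i high))
      where
      below : ∀ v → Below (2 ℕ.* ⌊ j /2⌋ ℕ.+ m) ⌈ j /2⌉ (condition j (u v) (u′ v))
      below v = below-condition j (u v) (u′ v) (below-family m 0 lu (left v)) (below-family m 3 lv (right v))
      high : 2 ℕ.* ⌊ j /2⌋ ℕ.+ m ≤ i ℕ.+ ⌈ j /2⌉
      high = ℕₚ.≤-trans (ℕₚ.m≤n+m∸n _ ⌈ j /2⌉) (subst (⌈ j /2⌉ ℕ.+ equationsAt m j ≤_) (ℕₚ.+-comm ⌈ j /2⌉ i)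
        (ℕₚ.+-monoʳ-≤ ⌈ j /2⌉ (ℕₚ.≮⇒≥ i≮)))

  -- The conditions are additive: the difference of two colliding assignments satisfies all of them,
  -- and it is nonzero because the assignments differ.
  solution : ∀ n → Solution n
  solution n = fromCollision (collision 1<p (equations<unknowns n) (coefficients n))
    where
    m = suc (triangular n)
    lu = suc ⌈ n /2⌉
    lv = ⌊ n /2⌋
    open Unknowns m lu lv
    fromCollision : (∃₂ λ v w → (∃ λ i → v i ≢ w i) × coefficients n v ≗ coefficients n w) → Solution n
    fromCollision (v , w , (i , v≢w) , e) = record
      { us = difference (u v) (u w)
      ; vs = difference (u′ v) (u′ w)
      ; below-us = below-difference 0 (u v) (u w) (below-family m 0 lu (left v)) (below-family m 0 lu (left w))
      ; below-vs = below-difference 3 (u′ v) (u′ w) (below-family m 3 lv (right v)) (below-family m 3 lv (right w))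
      ; length-us = length-difference (u v) (u w) (length-family m 0 lu (left v)) (length-family m 0 lu (left w))
      ; length-vs = length-difference (u′ v) (u′ w) (length-family m 3 lv (right v)) (length-family m 3 lv (right w))
      ; nontrivial = λ (zu , zv) → v≢w (halves {v} {w}
          (family-injective m 0 lu (left v) (left w) zu) (family-injective m 3 lv (right v) (right w) zv) i)
      ; conditions = λ j j<n → ≈-trans
          (condition-difference j (u v) (u′ v) (u w) (u′ w)
            (trans (length-family m 0 lu (left v)) (sym (length-family m 0 lu (left w))))
            (trans (length-family m 3 lv (right v)) (sym (length-family m 3 lv (right w)))))
          (⊕-inverse (conditions-≈ v w n e j j<n)) }

  -- At an `x` of weight 2 the auxiliary polynomial vanishes to order `n`, at a zero of `f`, of
  -- weight 1, to order `⌈ n /2⌉`. So `n` times the weight is at most twice the order, and the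
  -- orders add up to at most the degree.
  stepanov : ∀ n → n ℕ.* suc n ≤ suc p → n < p → (∀ x → eval x f ≡ 0# → eval x (∂ f) ≢ 0#) →
    ∀ ε → ε * ε ≡ 1# → n ℕ.* sum (λ x → weight ε (eval x f)) ≤ suc n ℕ.* (h ℕ.+ h ℕ.+ n)
  stepanov n n²≤ n<p simple ε ε²≡1 = begin
    n ℕ.* sum w                ≡⟨ *-distribˡ-sum n w ⟩
    sum (λ x → n ℕ.* w x)      ≤⟨ sum-mono-≤ {p} weigh ⟩
    sum (λ x → 2 ℕ.* mult x)   ≡⟨ *-distribˡ-sum 2 mult ⟨
    2 ℕ.* sum mult             ≤⟨ ℕₚ.*-monoʳ-≤ 2 (sum-multiplicities≤degree p (λ x → x) (λ e → e) mult
                                    (auxiliary ε us vs) top divisible) ⟩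
    2 ℕ.* t                    ≡⟨ cong (t ℕ.+_) (ℕₚ.+-identityʳ t) ⟩
    t ℕ.+ t                    ≤⟨ t≤ ⟩
    suc n ℕ.* (h ℕ.+ h ℕ.+ n)  ∎
    where
    open ℕₚ.≤-Reasoning
    open Solution (solution n)
    w : F → ℕ
    w x = weight ε (eval x f)
    ε≢0 : ε ≢ 0#
    ε≢0 e = 1≢0 (trans (sym ε²≡1) (trans (cong (_* ε) e) (*-zeroˡ ε)))
    found = top-auxiliary n n²≤ ε≢0 us vs below-us below-vs length-us length-vs nontrivial
    t = proj₁ found
    top = proj₁ (proj₂ found)
    t≤ = proj₂ (proj₂ found)
    multiplicity : ∀ {P Q : Set} → Dec P → Dec Q → ℕ
    multiplicity (yes _) _       = ⌈ n /2⌉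
    multiplicity (no _)  (yes _) = n
    multiplicity (no _)  (no _)  = 0
    mult : F → ℕ
    mult x = multiplicity (eval x f ≟ 0#) (eval x f ^ˢ h ≟ ε)
    half : ∀ n → n ≤ 2 ℕ.* ⌈ n /2⌉
    half zero          = z≤n
    half (suc zero)    = s≤s z≤n
    half (suc (suc n)) = subst (suc (suc n) ≤_) (sym (arith ⌈ n /2⌉)) (s≤s (s≤s (half n)))
      where
      arith : ∀ i → 2 ℕ.* suc i ≡ suc (suc (2 ℕ.* i))
      arith = solve-∀
    weigh : ∀ x → n ℕ.* w x ≤ 2 ℕ.* mult x
    weigh x = cases (eval x f ≟ 0#) (eval x f ^ˢ h ≟ ε)
      where
      cases : ∀ {P Q : Set} (d : Dec P) (e : Dec Q) → n ℕ.* select d e ≤ 2 ℕ.* multiplicity d e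
      cases (yes _) _       = ℕₚ.≤-trans (ℕₚ.≤-reflexive (ℕₚ.*-identityʳ n)) (half n)
      cases (no _)  (yes _) = ℕₚ.≤-reflexive (ℕₚ.*-comm n 2)
      cases (no _)  (no _)  = ℕₚ.≤-reflexive (ℕₚ.*-zeroʳ n)
    2<p : 2 < p
    2<p = s≤s (ℕₚ.+-mono-≤ 0<h 0<h)
    divisible : ∀ x → linear x ^ mult x ∣ auxiliary ε us vs
    divisible x = cases (eval x f ≟ 0#) (eval x f ^ˢ h ≟ ε)
      where
      cases : ∀ (d : Dec (eval x f ≡ 0#)) (e : Dec (eval x f ^ˢ h ≡ ε)) → linear x ^ multiplicity d e ∣ auxiliary ε us vs
      cases (yes fx≡0) _ =
        linear^∣auxiliary-root n us vs conditions n<p 2<p ε x (frobenius x) fx≡0 (simple x fx≡0)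
      cases (no fx≢0) (yes χ) = linear^∣auxiliary n us vs conditions n<p 2<p ε ε²≡1 x (frobenius x) fx≢0 χ
      cases (no _)    (no _)  = divides (auxiliary ε us vs) (≈-sym (⊗-identityˡ (auxiliary ε us vs)))

-- From Stepanov's estimate to the Hasse bound.

pronic-floor : ∀ s → ∃ λ n → n ℕ.* suc n ≤ s × s < suc n ℕ.* suc (suc n)
pronic-floor zero    = 0 , z≤n , s≤s z≤n
pronic-floor (suc s) with pronic-floor s
... | n , low , high with ℕₚ.<-cmp (suc s) (suc n ℕ.* suc (suc n))
...   | tri< lt _ _ = n , ℕₚ.m≤n⇒m≤1+n low , lt
...   | tri≈ _ eq _ = suc n , ℕₚ.≤-reflexive (sym eq) ,
        subst (_< suc (suc n) ℕ.* suc (suc (suc n))) (sym eq) (ℕₚ.*-mono-< (ℕₚ.n<1+n (suc n)) (ℕₚ.n<1+n (suc (suc n))))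
...   | tri> _ _ gt = ⊥-elim (ℕₚ.<⇒≱ gt high)

-- With q + 2 = n(n+1) + t and t ≤ 2n + 1 the last hypothesis reads n d + 2 ≤ 2n² + n + t. So d ≤ 2n + 2,
-- where d = 2n + 1 forces t ≥ 2 and d = 2n + 2 forces t ≥ n + 2.
hasse-arithmetic : ∀ n q d → 0 < n → n ℕ.* suc n ≤ suc (suc q) → suc (suc q) < suc n ℕ.* suc (suc n) →
  n ℕ.* (suc q ℕ.+ d) ≤ suc n ℕ.* (q ℕ.+ n) → d ℕ.* d ≤ 4 ℕ.* suc q
hasse-arithmetic n q d 0<n low high bound with ℕₚ.m≤n⇒∃[o]m+o≡n low
... | t , t≡ = ℕₚ.+-cancelʳ-≤ 4 _ _ (subst (d ℕ.* d ℕ.+ 4 ≤_) 4p (cases (ℕₚ.<-cmp d (suc (n ℕ.+ n)))))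
  where
  4p : 4 ℕ.* (n ℕ.* suc n) ℕ.+ 4 ℕ.* t ≡ 4 ℕ.* suc q ℕ.+ 4
  4p = trans (sym (ℕₚ.*-distribˡ-+ 4 (n ℕ.* suc n) t)) (trans (cong (4 ℕ.*_) t≡) (arith q))
    where
    arith : ∀ q → 4 ℕ.* suc (suc q) ≡ 4 ℕ.* suc q ℕ.+ 4
    arith = solve-∀
  t≤ : t ≤ suc (n ℕ.+ n)
  t≤ = ℕₚ.+-cancelˡ-≤ (n ℕ.* suc n) _ _ (subst₂ _≤_ (sym t≡) (arith n) (ℕₚ.≤-pred high))
    where
    arith : ∀ n → suc n ℕ.+ n ℕ.* suc (suc n) ≡ n ℕ.* suc n ℕ.+ suc (n ℕ.+ n)
    arith = solve-∀
  reduced : n ℕ.* d ℕ.+ 2 ≤ n ℕ.* n ℕ.+ n ℕ.* suc n ℕ.+ t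
  reduced = ℕₚ.+-cancelʳ-≤ (n ℕ.* suc q) _ _ (begin
    n ℕ.* d ℕ.+ 2 ℕ.+ n ℕ.* suc q               ≡⟨ arith₁ n d q ⟩
    n ℕ.* (suc q ℕ.+ d) ℕ.+ 2                   ≤⟨ ℕₚ.+-monoˡ-≤ 2 bound ⟩
    suc n ℕ.* (q ℕ.+ n) ℕ.+ 2                   ≡⟨ arith₂ n q ⟩
    n ℕ.* n ℕ.+ suc (suc q) ℕ.+ n ℕ.* suc q     ≡⟨ cong (λ s → n ℕ.* n ℕ.+ s ℕ.+ n ℕ.* suc q) t≡ ⟨
    n ℕ.* n ℕ.+ (n ℕ.* suc n ℕ.+ t) ℕ.+ n ℕ.* suc q ≡⟨ cong (ℕ._+ n ℕ.* suc q) (ℕₚ.+-assoc (n ℕ.* n) _ t) ⟨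
    n ℕ.* n ℕ.+ n ℕ.* suc n ℕ.+ t ℕ.+ n ℕ.* suc q ∎)
    where
    open ℕₚ.≤-Reasoning
    arith₁ : ∀ n d q → n ℕ.* d ℕ.+ 2 ℕ.+ n ℕ.* suc q ≡ n ℕ.* (suc q ℕ.+ d) ℕ.+ 2
    arith₁ = solve-∀
    arith₂ : ∀ n q → suc n ℕ.* (q ℕ.+ n) ℕ.+ 2 ≡ n ℕ.* n ℕ.+ suc (suc q) ℕ.+ n ℕ.* suc q
    arith₂ = solve-∀
  atLeast : ∀ k e → d ≡ k ℕ.+ e → n ℕ.* k ℕ.+ 2 ≤ n ℕ.* n ℕ.+ n ℕ.* suc n ℕ.+ t
  atLeast k e eq = ℕₚ.≤-trans (ℕₚ.+-monoˡ-≤ 2 (ℕₚ.*-monoʳ-≤ n (subst (k ≤_) (sym eq) (ℕₚ.m≤m+n k e)))) reduced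
  cases : Tri (d < suc (n ℕ.+ n)) (d ≡ suc (n ℕ.+ n)) (suc (n ℕ.+ n) < d) →
    d ℕ.* d ℕ.+ 4 ≤ 4 ℕ.* (n ℕ.* suc n) ℕ.+ 4 ℕ.* t
  cases (tri< (s≤s d≤) _ _) = begin
    d ℕ.* d ℕ.+ 4                              ≤⟨ ℕₚ.+-mono-≤ (ℕₚ.*-mono-≤ d≤ d≤) (ℕₚ.*-monoʳ-≤ 4 0<n) ⟩
    (n ℕ.+ n) ℕ.* (n ℕ.+ n) ℕ.+ 4 ℕ.* n        ≡⟨ arith n ⟩
    4 ℕ.* (n ℕ.* suc n)                        ≤⟨ ℕₚ.m≤m+n _ (4 ℕ.* t) ⟩
    4 ℕ.* (n ℕ.* suc n) ℕ.+ 4 ℕ.* t            ∎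
    where
    open ℕₚ.≤-Reasoning
    arith : ∀ n → (n ℕ.+ n) ℕ.* (n ℕ.+ n) ℕ.+ 4 ℕ.* n ≡ 4 ℕ.* (n ℕ.* suc n)
    arith = solve-∀
  cases (tri≈ _ refl _) = begin
    d ℕ.* d ℕ.+ 4                              ≤⟨ ℕₚ.m≤m+n _ 3 ⟩
    d ℕ.* d ℕ.+ 4 ℕ.+ 3                        ≡⟨ arith n ⟩
    4 ℕ.* (n ℕ.* suc n) ℕ.+ 4 ℕ.* 2            ≤⟨ ℕₚ.+-monoʳ-≤ (4 ℕ.* (n ℕ.* suc n)) (ℕₚ.*-monoʳ-≤ 4 2≤t) ⟩
    4 ℕ.* (n ℕ.* suc n) ℕ.+ 4 ℕ.* t            ∎
    where
    open ℕₚ.≤-Reasoning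
    arith : ∀ n → suc (n ℕ.+ n) ℕ.* suc (n ℕ.+ n) ℕ.+ 4 ℕ.+ 3 ≡ 4 ℕ.* (n ℕ.* suc n) ℕ.+ 4 ℕ.* 2
    arith = solve-∀
    arith′ : ∀ n → n ℕ.* suc (n ℕ.+ n) ≡ n ℕ.* n ℕ.+ n ℕ.* suc n
    arith′ = solve-∀
    2≤t : 2 ≤ t
    2≤t = ℕₚ.+-cancelˡ-≤ (n ℕ.* n ℕ.+ n ℕ.* suc n) _ _
      (subst (λ s → s ℕ.+ 2 ≤ n ℕ.* n ℕ.+ n ℕ.* suc n ℕ.+ t) (arith′ n) (atLeast (suc (n ℕ.+ n)) 0 (sym (ℕₚ.+-identityʳ _))))
  cases (tri> _ _ gt) with ℕₚ.m≤n⇒∃[o]m+o≡n gt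
  ... | zero , d≡ = begin
    d ℕ.* d ℕ.+ 4                              ≡⟨ cong (λ d → d ℕ.* d ℕ.+ 4) (trans (sym d≡) (ℕₚ.+-identityʳ _)) ⟩
    suc (suc (n ℕ.+ n)) ℕ.* suc (suc (n ℕ.+ n)) ℕ.+ 4 ≡⟨ arith n ⟩
    4 ℕ.* (n ℕ.* suc n) ℕ.+ 4 ℕ.* (n ℕ.+ 2)    ≤⟨ ℕₚ.+-monoʳ-≤ (4 ℕ.* (n ℕ.* suc n)) (ℕₚ.*-monoʳ-≤ 4 n+2≤t) ⟩
    4 ℕ.* (n ℕ.* suc n) ℕ.+ 4 ℕ.* t            ∎
    where
    open ℕₚ.≤-Reasoning
    arith : ∀ n → suc (suc (n ℕ.+ n)) ℕ.* suc (suc (n ℕ.+ n)) ℕ.+ 4 ≡ 4 ℕ.* (n ℕ.* suc n) ℕ.+ 4 ℕ.* (n ℕ.+ 2)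
    arith = solve-∀
    arith′ : ∀ n → n ℕ.* suc (suc (n ℕ.+ n)) ℕ.+ 2 ≡ n ℕ.* n ℕ.+ n ℕ.* suc n ℕ.+ (n ℕ.+ 2)
    arith′ = solve-∀
    n+2≤t : n ℕ.+ 2 ≤ t
    n+2≤t = ℕₚ.+-cancelˡ-≤ (n ℕ.* n ℕ.+ n ℕ.* suc n) _ _
      (subst (_≤ n ℕ.* n ℕ.+ n ℕ.* suc n ℕ.+ t) (arith′ n) (atLeast (suc (suc (n ℕ.+ n))) 0 (sym d≡)))
  ... | suc e , d≡ = ⊥-elim (ℕₚ.<⇒≱ (s≤s t≤) (ℕₚ.+-cancelˡ-≤ (n ℕ.* n ℕ.+ n ℕ.* suc n) _ _
      (subst (_≤ n ℕ.* n ℕ.+ n ℕ.* suc n ℕ.+ t) (arith n)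
        (atLeast (3 ℕ.+ (n ℕ.+ n)) e (trans (sym d≡) (ℕₚ.+-suc _ e))))))
    where
    arith : ∀ n → n ℕ.* (3 ℕ.+ (n ℕ.+ n)) ℕ.+ 2 ≡ n ℕ.* n ℕ.+ n ℕ.* suc n ℕ.+ suc (suc (n ℕ.+ n))
    arith = solve-∀

module Hasse (h : ℕ) (prime : Prime (suc (h ℕ.+ h))) (a b : Fin (suc (h ℕ.+ h))) where

  open OddPrimeField h prime public
  open StepanovBound h prime a b public using (f; top-f; stepanov)

  Singular : F → Set
  Singular x = eval x f ≡ 0# × eval x (∂ f) ≡ 0#

  singular? : Dec (∃ Singular)
  singular? = Finₚ.any? (λ x → (eval x f ≟ 0#) ×-dec (eval x (∂ f) ≟ 0#))

  private
    module Solver = RingSolver scalars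

  -- The Taylor expansion of a monic cubic without quadratic term: the terms of order two and three
  -- are `3 x z²` and `z³`.
  taylor : ∀ x z → eval (z + x) f ≡ (eval x f + z * eval x (∂ f)) + (z * z) * (z + (x + (x + x)))
  taylor x z = Solver.solve 4 (λ a b x z →
      b :+ (z :+ x) :* (a :+ (z :+ x) :* (con 0 :+ (z :+ x) :* (con 1 :+ (z :+ x) :* con 0)))
      := ((b :+ x :* (a :+ x :* (con 0 :+ x :* (con 1 :+ x :* con 0))))
         :+ z :* ((a :+ con 0) :+ x :* ((con 0 :+ (con 0 :+ con 0)) :+ x :* ((con 1 :+ (con 1 :+ (con 1 :+ con 0))) :+ x :* (con 0 :+ x :* con 0)))))
         :+ (z :* z) :* (z :+ (x :+ (x :+ x)))) refl a b x z
    where open Solver using (_:+_; _:*_; _:=_; con)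

  private
    cancel : ∀ x y → (y + -1# * x) + x ≡ y
    cancel x y = trans (+-assoc y _ x) (trans (cong (y +_) (trans (+-comm _ x) (x+-1x≡0 x))) (S.+-identityʳ y))

    cancel′ : ∀ x y → (y + x) + -1# * x ≡ y
    cancel′ x y = trans (+-assoc y x _) (trans (cong (y +_) (x+-1x≡0 x)) (S.+-identityʳ y))

    translation : F → Permutation′ p
    translation c = permutation (_+ c) (_+ -1# * c) (cancel c) (cancel′ c)

    select-cong : ∀ {P P′ Q Q′ : Set} → (P → P′) → (P′ → P) → (Q → Q′) → (Q′ → Q) →
      (d : Dec P) (d′ : Dec P′) (e : Dec Q) (e′ : Dec Q′) → select d e ≡ select d′ e′
    select-cong f g i j (yes _)  (yes _)  _        _        = refl
    select-cong f g i j (yes x)  (no ¬x)  _        _        = ⊥-elim (¬x (f x))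
    select-cong f g i j (no ¬x)  (yes x)  _        _        = ⊥-elim (¬x (g x))
    select-cong f g i j (no _)   (no _)   (yes _)  (yes _)  = refl
    select-cong f g i j (no _)   (no _)   (yes x)  (no ¬x)  = ⊥-elim (¬x (i x))
    select-cong f g i j (no _)   (no _)   (no ¬x)  (yes x)  = ⊥-elim (¬x (j x))
    select-cong f g i j (no _)   (no _)   (no _)   (no _)   = refl

  -- `(z²)^h = z^(p-1) = 1`, so the factor `z²` does not affect the quadratic character.
  weight-square : ∀ ε {z} → z ≢ 0# → ∀ c → weight ε ((z * z) * c) ≡ weight ε c
  weight-square ε {z} z≢0 c = select-cong
    (λ e → [ (λ s → ⊥-elim (*-nonzero z≢0 z≢0 s)) , (λ s → s) ]′ (x*y≡0⇒x≡0⊎y≡0 (z * z) c e))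
    (λ e → trans (cong (z * z *_) e) (S.zeroʳ (z * z)))
    (λ e → trans (sym square) e) (λ e → trans square e)
    ((z * z) * c ≟ 0#) (c ≟ 0#) (((z * z) * c) ^ˢ h ≟ ε) (c ^ˢ h ≟ ε)
    where
    square : ((z * z) * c) ^ˢ h ≡ c ^ˢ h
    square = trans (*-^ (z * z) c h) (trans (cong (_* c ^ˢ h)
      (trans (*-^ z z h) (trans (sym (^-+ z h h)) (fermat z≢0)))) (*-identityˡ _))

  -- At a singular point x₀ one has f(x) = (x - x₀)² (x + 2x₀).
  singular-bound : ∀ x₀ → Singular x₀ → ∀ ε → sum (λ x → weight ε (eval x f)) ≤ suc p
  singular-bound x₀ (fx≡0 , f′x≡0) ε = begin
    sum (λ x → weight ε (eval x f))
      ≤⟨ sum-mono-≤ {p} (λ x → pointwise x (x₀ ≟ x)) ⟩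
    sum (λ x → indicator (x₀ ≟ x) ℕ.+ weight ε (x + (x₀ + x₀)))
      ≡⟨ ∑-distrib-+ {p} (λ x → indicator (x₀ ≟ x)) (λ x → weight ε (x + (x₀ + x₀))) ⟩
    sum (λ x → indicator (x₀ ≟ x)) ℕ.+ sum (λ x → weight ε (x + (x₀ + x₀)))
      ≡⟨ cong₂ ℕ._+_ (sum-indicator-≡ (x₀ ≟_)) (sym (sum-permute (weight ε) (translation (x₀ + x₀)))) ⟩
    suc (sum (weight ε))
      ≤⟨ s≤s (sum-weight≤p ε) ⟩
    suc p ∎
    where
    open ℕₚ.≤-Reasoning
    weight-zero : ∀ {c} → c ≡ 0# → weight ε c ≡ 1
    weight-zero {c} c≡0 = cases (c ≟ 0#) (c ^ˢ h ≟ ε)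
      where
      cases : ∀ (d : Dec (c ≡ 0#)) e → select {c ≡ 0#} {c ^ˢ h ≡ ε} d e ≡ 1
      cases (yes _)  _ = refl
      cases (no c≢0) _ = ⊥-elim (c≢0 c≡0)
    pointwise : ∀ x (d : Dec (x₀ ≡ x)) → weight ε (eval x f) ≤ indicator d ℕ.+ weight ε (x + (x₀ + x₀))
    pointwise x (yes x₀≡x) = ℕₚ.≤-trans (ℕₚ.≤-reflexive
      (weight-zero (trans (cong (λ s → eval s f) (sym x₀≡x)) fx≡0))) (s≤s z≤n)
    pointwise x (no x₀≢x) = ℕₚ.≤-reflexive (trans (cong (weight ε) factored)
      (weight-square ε (λ e → x₀≢x (sym (x+-1y≡0⇒x≡y e))) (x + (x₀ + x₀))))
      where
      z = x + -1# * x₀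
      factored : eval x f ≡ (z * z) * (x + (x₀ + x₀))
      factored = trans (cong (λ s → eval s f) (sym (cancel x₀ x))) (trans (taylor x₀ z)
        (trans (cong₂ (λ s t → (s + z * t) + (z * z) * (z + (x₀ + (x₀ + x₀)))) fx≡0 f′x≡0)
          (trans (cong (_+ (z * z) * (z + (x₀ + (x₀ + x₀)))) (trans (+-identityˡ _) (S.zeroʳ z)))
            (trans (+-identityˡ _) (cong (z * z *_) (trans (sym (+-assoc z x₀ (x₀ + x₀)))
              (cong (_+ (x₀ + x₀)) (cancel x₀ x))))))))

  -- Only an excess over `p` is bounded; a deficit of the curve is an excess of the twist.
  hasse : ∀ ε → ε * ε ≡ 1# → ∀ d → sum (λ x → weight ε (eval x f)) ≡ p ℕ.+ d → d ℕ.* d ≤ 4 ℕ.* p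
  hasse ε ε²≡1 d w≡ = cases singular?
    where
    cases : Dec (∃ Singular) → d ℕ.* d ≤ 4 ℕ.* p
    cases (yes (x₀ , s)) = ℕₚ.≤-trans (ℕₚ.*-mono-≤ d≤1 d≤1) (s≤s z≤n)
      where
      d≤1 : d ≤ 1
      d≤1 = ℕₚ.+-cancelˡ-≤ p d 1 (subst₂ _≤_ w≡ (ℕₚ.+-comm 1 p) (singular-bound x₀ s ε))
    cases (no nonsingular) = choose (pronic-floor (suc p))
      where
      choose : (∃ λ n → n ℕ.* suc n ≤ suc p × suc p < suc n ℕ.* suc (suc n)) → d ℕ.* d ≤ 4 ℕ.* p
      choose (zero  , low , s≤s (s≤s ()))
      choose (suc n , low , high) = hasse-arithmetic (suc n) q d (s≤s z≤n) low high
        (subst (λ s → suc n ℕ.* s ≤ suc (suc n) ℕ.* (q ℕ.+ suc n)) w≡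
          (stepanov (suc n) low n<p (λ x fx≡0 f′x≡0 → nonsingular (x , fx≡0 , f′x≡0)) ε ε²≡1))
        where
        -- If `p ≤ suc n`, then `low` would give `p (p + 1) ≤ p + 1`, contrary to `1 < p`.
        n<p : suc n < p
        n<p = ℕₚ.≰⇒> λ p≤n → ℕₚ.<⇒≱ (begin-strict
          suc p           <⟨ ℕₚ.+-monoˡ-< p 1<p ⟩
          p ℕ.+ p         ≤⟨ ℕₚ.m≤m+n (p ℕ.+ p) _ ⟩
          p ℕ.+ p ℕ.+ q ℕ.* p ≡⟨ ℕₚ.+-assoc p p (q ℕ.* p) ⟩
          p ℕ.+ p ℕ.* p   ≡⟨ ℕₚ.*-suc p p ⟨
          p ℕ.* suc p     ≤⟨ ℕₚ.*-mono-≤ p≤n (s≤s p≤n) ⟩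
          suc n ℕ.* suc (suc n) ∎) low
          where open ℕₚ.≤-Reasoning

-- Lengths of filtered lists as sums.

module _ {A : Set} {P : Pred A 0ℓ} (P? : Decidable P) where

  length-filter-tabulate : ∀ {B : Set} (g : B → A) {n} (k : Fin n → B) →
    length (filter P? (map g (tabulate k))) ≡ sum (λ i → indicator (P? (g (k i))))
  length-filter-tabulate g {zero}  k = refl
  length-filter-tabulate g {suc n} k with P? (g (k zero))
  ... | yes _ = cong suc (length-filter-tabulate g (k ∘ suc))
  ... | no  _ = length-filter-tabulate g (k ∘ suc)

module _ {A B : Set} {P : Pred (A × B) 0ℓ} (P? : Decidable P) where

  length-filter-cartesianProduct : ∀ {m n} (k : Fin m → A) (l : Fin n → B) →
    length (filter P? (cartesianProduct (tabulate k) (tabulate l))) ≡ sum (λ i → sum (λ j → indicator (P? (k i , l j))))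
  length-filter-cartesianProduct {zero}  k l = refl
  length-filter-cartesianProduct {suc m} k l = trans
    (cong length (filter-++ P? (map (k zero ,_) (tabulate l)) (cartesianProduct (tabulate (k ∘ suc)) (tabulate l))))
    (trans (length-++ (filter P? (map (k zero ,_) (tabulate l))))
      (cong₂ ℕ._+_ (length-filter-tabulate P? (k zero ,_) l) (length-filter-cartesianProduct (k ∘ suc) l)))

indicator-cong : ∀ {P Q : Set} → (P → Q) → (Q → P) → (d : Dec P) (e : Dec Q) → indicator d ≡ indicator e
indicator-cong f g (yes _) (yes _) = refl
indicator-cong f g (yes x) (no ¬y) = ⊥-elim (¬y (f x))
indicator-cong f g (no ¬x) (yes y) = ⊥-elim (¬x (g y))
indicator-cong f g (no _)  (no _)  = refl

-- Coefficients as digits in base 2^(p²).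

module ℕPoly = Polynomials ℕₚ.+-*-isCommutativeSemiring

private
  digit-suc : ∀ T .{{_ : NonZero T}} c e → c < T → (c ℕ.+ T ℕ.* e) / T ≡ e
  digit-suc T c e c<T = trans (+-distrib-/-∣ʳ c {T ℕ.* e} {T} (ℕᵈ.divides e (ℕₚ.*-comm T e)))
    (trans (cong₂ ℕ._+_ (m<n⇒m/n≡0 c<T) (trans (/-congˡ {o = T} (ℕₚ.*-comm T e)) (m*n/n≡m e T))) refl)

  digit-zero : ∀ T .{{_ : NonZero T}} c e → c < T → (c ℕ.+ T ℕ.* e) % T ≡ c
  digit-zero T c e c<T = trans (cong (λ s → (c ℕ.+ s) % T) (ℕₚ.*-comm T e))
    (trans ([m+kn]%n≡m%n c e T) (m<n⇒m%n≡m c<T))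

-- Evaluation at `T` writes the coefficients as base `T` digits, with no carries since all are below
-- `T`. The divisor is a variable with an equation because `residue` gives it as a single power of
-- 2.
digit : ∀ T .{{_ : NonZero T}} P → (∀ i → ℕPoly.coef P i < T) → ∀ k D .{{_ : NonZero D}} → D ≡ T ℕ.^ k →
  (ℕPoly.eval T P / D) % T ≡ ℕPoly.coef P k
digit T []      small k       D e    = trans (cong (_% T) (0/n≡0 D)) (0%n≡0 T)
  where
  0%n≡0 : ∀ n .{{_ : NonZero n}} → 0 % n ≡ 0
  0%n≡0 n = m<n⇒m%n≡m (ℕ.>-nonZero⁻¹ n)
digit T (c ∷ P) small zero    D refl = trans (cong (_% T) (n/1≡n (c ℕ.+ T ℕ.* ℕPoly.eval T P)))
  (digit-zero T c (ℕPoly.eval T P) (small 0))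
digit T (c ∷ P) small (suc k) D refl = trans (cong (_% T) (trans
    (sym (m/n/o≡m/[n*o] (c ℕ.+ T ℕ.* ℕPoly.eval T P) T (T ℕ.^ k) {{_}} {{T^k≢0}}))
    (cong (λ s → (s / (T ℕ.^ k)) {{T^k≢0}}) (digit-suc T c (ℕPoly.eval T P) (small 0)))))
  (digit T P (small ∘ suc) k (T ℕ.^ k) {{T^k≢0}} refl)
  where
  T^k≢0 : NonZero (T ℕ.^ k)
  T^k≢0 = ℕₚ.m^n≢0 T k

coef≤eval-1 : ∀ P i → ℕPoly.coef P i ≤ ℕPoly.eval 1 P
coef≤eval-1 []      i       = z≤n
coef≤eval-1 (c ∷ P) zero    = ℕₚ.m≤m+n c _
coef≤eval-1 (c ∷ P) (suc i) = ℕₚ.≤-trans (coef≤eval-1 P i)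
  (ℕₚ.≤-trans (ℕₚ.≤-reflexive (sym (ℕₚ.*-identityˡ _))) (ℕₚ.m≤n+m _ c))

cubic : ℕ → ℕ → List ℕ
cubic a b = b ∷ a ∷ 0 ∷ 1 ∷ []

private
  ^ˢ≡^ : ∀ x n → x ℕPoly.^ˢ n ≡ x ℕ.^ n
  ^ˢ≡^ x zero    = refl
  ^ˢ≡^ x (suc n) = cong (x ℕ.*_) (^ˢ≡^ x n)

  n<2^n : ∀ n → n < 2 ℕ.^ n
  n<2^n zero    = s≤s z≤n
  n<2^n (suc n) = ℕₚ.≤-trans (s≤s (n<2^n n)) (subst (suc (2 ℕ.^ n) ≤_) (cong (2 ℕ.^ n ℕ.+_) (sym (ℕₚ.+-identityʳ _)))
    (ℕₚ.+-monoˡ-≤ (2 ℕ.^ n) (ℕₚ.m^n>0 2 n)))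

eval-cubic : ∀ T a b → ℕPoly.eval T (cubic a b) ≡ T ℕ.^ 3 ℕ.+ a ℕ.* T ℕ.+ b
eval-cubic = arith
  where
  arith : ∀ T a b → b ℕ.+ T ℕ.* (a ℕ.+ T ℕ.* (0 ℕ.+ T ℕ.* (1 ℕ.+ T ℕ.* 0))) ≡ T ℕ.* (T ℕ.* (T ℕ.* 1)) ℕ.+ a ℕ.* T ℕ.+ b
  arith = solve-∀

-- Coefficients over ℕ are at most the value at 1, which is `(1 + a + b)^h`. As
-- `1 + a + b ≤ 2 p ≤ 2^p`, this is at most `2^(p h)`, and `h < p`.
coef-small : ∀ h a b → let p = suc (h ℕ.+ h) in a < p → b < p →
  ∀ i → ℕPoly.coef (cubic a b ℕPoly.^ h) i < 2 ℕ.^ (p ℕ.^ 2)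
coef-small h a b a<p b<p i = begin-strict
  ℕPoly.coef (cubic a b ℕPoly.^ h) i   ≤⟨ coef≤eval-1 (cubic a b ℕPoly.^ h) i ⟩
  ℕPoly.eval 1 (cubic a b ℕPoly.^ h)   ≡⟨ trans (ℕPoly.eval-^ 1 (cubic a b) h) (^ˢ≡^ _ h) ⟩
  ℕPoly.eval 1 (cubic a b) ℕ.^ h       ≤⟨ ℕₚ.^-monoˡ-≤ h base ⟩
  (2 ℕ.^ p) ℕ.^ h                      ≡⟨ ℕₚ.^-*-assoc 2 p h ⟩
  2 ℕ.^ (p ℕ.* h)                      <⟨ ℕₚ.^-monoʳ-< 2 (s≤s (s≤s z≤n)) (ℕₚ.*-monoʳ-< p (s≤s (ℕₚ.m≤m+n h h))) ⟩
  2 ℕ.^ (p ℕ.* p)                      ≡⟨ cong (λ s → 2 ℕ.^ (p ℕ.* s)) (ℕₚ.*-identityʳ p) ⟨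
  2 ℕ.^ (p ℕ.^ 2)                      ∎
  where
  open ℕₚ.≤-Reasoning
  p = suc (h ℕ.+ h)
  arith : ∀ q → suc ((q ℕ.+ q) ℕ.+ 1) ≡ 2 ℕ.* suc q
  arith = solve-∀
  base : ℕPoly.eval 1 (cubic a b) ≤ 2 ℕ.^ p
  base = begin
    ℕPoly.eval 1 (cubic a b)           ≡⟨ trans (eval-cubic 1 a b) (value a b) ⟩
    suc (a ℕ.+ b)                      ≤⟨ s≤s (ℕₚ.+-mono-≤ (ℕₚ.≤-pred a<p) (ℕₚ.≤-pred b<p)) ⟩
    suc ((h ℕ.+ h) ℕ.+ (h ℕ.+ h))      ≤⟨ s≤s (ℕₚ.m≤m+n _ 1) ⟩
    suc (((h ℕ.+ h) ℕ.+ (h ℕ.+ h)) ℕ.+ 1) ≡⟨ arith (h ℕ.+ h) ⟩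
    2 ℕ.* p                            ≤⟨ ℕₚ.*-monoʳ-≤ 2 (n<2^n (h ℕ.+ h)) ⟩
    2 ℕ.^ p                            ∎
    where
    value : ∀ a b → 1 ℕ.+ a ℕ.* 1 ℕ.+ b ≡ suc (a ℕ.+ b)
    value = solve-∀

residue≡coef : ∀ h a b → let p = suc (h ℕ.+ h) in a < p → b < p →
  residue p a b ≡ ℕPoly.coef (cubic a b ℕPoly.^ h) (h ℕ.+ h) % p
residue≡coef h a b a<p b<p = cong (_% p) (trans
  (cong (λ s → (s / D) % T) numerator) (digit T (cubic a b ℕPoly.^ h) (coef-small h a b a<p b<p) (h ℕ.+ h) D (sym (ℕₚ.^-*-assoc 2 (p ℕ.^ 2) (h ℕ.+ h)))))
  where
  p = suc (h ℕ.+ h)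
  T = 2 ℕ.^ (p ℕ.^ 2)
  D = 2 ℕ.^ (p ℕ.^ 2 ℕ.* (h ℕ.+ h))
  instance
    T≢0 : NonZero T
    T≢0 = ℕₚ.m^n≢0 2 (p ℕ.^ 2)
    D≢0 : NonZero D
    D≢0 = ℕₚ.m^n≢0 2 (p ℕ.^ 2 ℕ.* (h ℕ.+ h))
  half : ⌊ p /2⌋ ≡ h
  half = sym (ℕₚ.n≡⌈n+n/2⌉ h)
  numerator : (2 ℕ.^ (3 ℕ.* p ℕ.^ 2) ℕ.+ a ℕ.* T ℕ.+ b) ℕ.^ ⌊ p /2⌋ ≡ ℕPoly.eval T (cubic a b ℕPoly.^ h)
  numerator = trans (cong ((2 ℕ.^ (3 ℕ.* p ℕ.^ 2) ℕ.+ a ℕ.* T ℕ.+ b) ℕ.^_) half) (trans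
    (cong (ℕ._^ h) (trans (cong (λ s → s ℕ.+ a ℕ.* T ℕ.+ b) (trans (cong (2 ℕ.^_) (ℕₚ.*-comm 3 (p ℕ.^ 2)))
      (sym (ℕₚ.^-*-assoc 2 (p ℕ.^ 2) 3)))) (sym (eval-cubic T a b))))
    (sym (trans (ℕPoly.eval-^ T (cubic a b) h) (^ˢ≡^ (ℕPoly.eval T (cubic a b)) h))))

-- The residues of N and r modulo p.

module PointCount (h : ℕ) (prime : Prime (suc (h ℕ.+ h))) (A B : ℕ) where

  open PrimeField (h ℕ.+ h) prime using (ι)
  open Hasse h prime (ι A) (ι B) hiding (ι) public

  private
    module Solver = RingSolver scalars

  ι-^ : ∀ n k → ι (n ℕ.^ k) ≡ ι n ^ˢ k
  ι-^ n zero    = refl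
  ι-^ n (suc k) = trans (sym (ι-* n (n ℕ.^ k))) (cong (ι n *_) (ι-^ n k))

  ι-cubic : ∀ x → ι (toℕ x ℕ.^ 3 ℕ.+ A ℕ.* toℕ x ℕ.+ B) ≡ eval x f
  ι-cubic x = trans (sym (ι-+ (n ℕ.^ 3 ℕ.+ A ℕ.* n) B)) (trans (cong (_+ ι B)
      (trans (sym (ι-+ (n ℕ.^ 3) (A ℕ.* n))) (cong₂ _+_ (ι-^ n 3) (sym (ι-* A n)))))
    (trans (cong (λ y → (y ^ˢ 3 + ι A * y) + ι B) (ι-toℕ x))
      (Solver.solve 3 (λ a b x → (x :* (x :* (x :* con 1)) :+ a :* x) :+ b
        := b :+ x :* (a :+ x :* (con 0 :+ x :* (con 1 :+ x :* con 0)))) refl (ι A) (ι B) x)))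
    where
    open Solver using (_:+_; _:*_; _:=_; con)
    n = toℕ x

  ι-square : ∀ y → ι (toℕ y ℕ.^ 2) ≡ y * y
  ι-square y = trans (ι-^ (toℕ y) 2) (trans (cong (_^ˢ 2) (ι-toℕ y)) (cong (y *_) (S.*-identityʳ y)))

  onCurve⇒ : ∀ {x y} → OnCurve p A B (x , y) → y * y ≡ eval x f
  onCurve⇒ {x} {y} e = trans (sym (ι-square y)) (trans (ι-cong e) (ι-cubic x))

  ⇒onCurve : ∀ {x y} → y * y ≡ eval x f → OnCurve p A B (x , y)
  ⇒onCurve {x} {y} e = ι-injective (trans (ι-square y) (trans e (sym (ι-cubic x))))

  N : ℕ
  N = affineCount p A B

  N≡Σweight : N ≡ sum (λ x → weight 1# (eval x f))
  N≡Σweight = trans (length-filter-cartesianProduct (onCurve? p A B) {p} {p} (λ x → x) (λ y → y))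
    (sum-cong-≗ {p} λ x → trans
      (sum-cong-≗ {p} λ y → indicator-cong onCurve⇒ ⇒onCurve (onCurve? p A B (x , y)) (y * y ≟ eval x f))
      (squareRoots≡weight (eval x f)))

  N+twist≡2p : N ℕ.+ sum (λ x → weight -1# (eval x f)) ≡ p ℕ.+ p
  N+twist≡2p = trans (cong (ℕ._+ sum (λ x → weight -1# (eval x f))) N≡Σweight)
    (trans (sym (∑-distrib-+ {p} (λ x → weight 1# (eval x f)) (λ x → weight -1# (eval x f))))
      (trans (sum-cong-≗ {p} (λ x → weight-complement (eval x f)))
        (trans (sum-const p 2) (trans (ℕₚ.*-comm p 2) (cong (p ℕ.+_) (ℕₚ.+-identityʳ p))))))

  ι-sum : ∀ {n} (g : Fin n → ℕ) → ι (sum g) ≡ Σ (λ i → ι (g i))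
  ι-sum {zero}  g = ι-0
  ι-sum {suc n} g = trans (sym (ι-+ (g zero) _)) (cong (ι (g zero) +_) (ι-sum (g ∘ suc)))

  bounded-f^ : ∀ k → Bounded (suc (k ℕ.* 3)) (f ^ k)
  bounded-f^ k = bounded (top-^ top-f k)

  -- In the sum of `1 + f(x)^h` the ones add up to `p = 0`, and `f^h` has degree `3 h < 4 h = 2 q`,
  -- within the range of `Σ-eval-coef`.
  ι-N : ι N ≡ -1# * coef (f ^ h) q
  ι-N = trans (cong ι N≡Σweight) (trans (ι-sum {p} (λ x → weight 1# (eval x f)))
    (trans (Σ-cong {p} (λ x → trans (ι-weight (eval x f)) (cong (1# +_) (sym (eval-^ x f h)))))
      (trans (Σ-distrib-+ {p} (λ _ → 1#) (λ x → eval x (f ^ h)))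
        (trans (cong₂ _+_ powerSum-0 (Σ-eval-coef (f ^ h) (bounded-≤ (f ^ h) (bound 0<h) (bounded-f^ h))))
          (+-identityˡ _)))))
    where
    bound : ∀ {h} → 0 < h → suc (h ℕ.* 3) ≤ h ℕ.+ h ℕ.+ (h ℕ.+ h)
    bound {h} 0<h = subst (suc (h ℕ.* 3) ≤_) (arith h) (ℕₚ.+-monoˡ-≤ (h ℕ.* 3) 0<h)
      where
      arith : ∀ h → h ℕ.+ h ℕ.* 3 ≡ h ℕ.+ h ℕ.+ (h ℕ.+ h)
      arith = solve-∀

  map-ι-⊕ : ∀ P Q → map ι (P ℕPoly.⊕ Q) ≡ map ι P ⊕ map ι Q
  map-ι-⊕ []      Q       = refl
  map-ι-⊕ (c ∷ P) []      = refl
  map-ι-⊕ (c ∷ P) (d ∷ Q) = cong₂ _∷_ (sym (ι-+ c d)) (map-ι-⊕ P Q)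

  map-ι-· : ∀ c P → map ι (c ℕPoly.· P) ≡ ι c · map ι P
  map-ι-· c []      = refl
  map-ι-· c (d ∷ P) = cong₂ _∷_ (sym (ι-* c d)) (map-ι-· c P)

  map-ι-⊗ : ∀ P Q → map ι (P ℕPoly.⊗ Q) ≡ map ι P ⊗ map ι Q
  map-ι-⊗ []      Q = refl
  map-ι-⊗ (c ∷ P) Q = trans (map-ι-⊕ (c ℕPoly.· Q) (0 ∷ P ℕPoly.⊗ Q))
    (cong₂ _⊕_ (map-ι-· c Q) (cong₂ _∷_ ι-0 (map-ι-⊗ P Q)))

  map-ι-^ : ∀ P k → map ι (P ℕPoly.^ k) ≡ map ι P ^ k
  map-ι-^ P zero    = refl
  map-ι-^ P (suc k) = trans (map-ι-⊗ P (P ℕPoly.^ k)) (cong (map ι P ⊗_) (map-ι-^ P k))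

  coef-map-ι : ∀ P i → coef (map ι P) i ≡ ι (ℕPoly.coef P i)
  coef-map-ι []      i       = sym ι-0
  coef-map-ι (c ∷ P) zero    = refl
  coef-map-ι (c ∷ P) (suc i) = coef-map-ι P i

  r : ℕ
  r = residue p (A % p) (B % p)

  ι-% : ∀ n → ι (n % p) ≡ ι n
  ι-% n = ι-cong (m%n%n≡m%n n p)

  -- Reducing coefficients modulo `p` commutes with powers and carries the cubic over ℕ to `f`.
  ι-r : ι r ≡ coef (f ^ h) q
  ι-r = trans (cong ι (residue≡coef h (A % p) (B % p) (m%n<n A p) (m%n<n B p)))
    (trans (ι-% (ℕPoly.coef (cubic (A % p) (B % p) ℕPoly.^ h) q))
      (trans (sym (coef-map-ι (cubic (A % p) (B % p) ℕPoly.^ h) q))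
        (cong (λ P → coef P q) (trans (map-ι-^ (cubic (A % p) (B % p)) h) (cong (_^ h) reduced)))))
    where
    reduced : map ι (cubic (A % p) (B % p)) ≡ f
    reduced = cong₂ _∷_ (ι-% B) (cong₂ _∷_ (ι-% A) (cong (_∷ 1# ∷ []) ι-0))

  r<p : r < p
  r<p = subst (_< p) (sym (residue≡coef h (A % p) (B % p) (m%n<n A p) (m%n<n B p))) (m%n<n (ℕPoly.coef (cubic (A % p) (B % p) ℕPoly.^ h) q) p)

  p∣N+r : p ℕᵈ.∣ N ℕ.+ r
  p∣N+r = ι≡0⇒∣ (N ℕ.+ r) (trans (sym (ι-+ N r)) (trans (cong₂ _+_ ι-N ι-r)
    (trans (+-comm _ _) (x+-1x≡0 (coef (f ^ h) q)))))

-- Points of the projective closure.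

-- Without repetitions a value determines its position, whatever the membership proof; this makes
-- the numbering of points well defined on classes.
index-unique : ∀ {A : Set} {xs : List A} → Unique xs → ∀ {v} (m : v ∈ xs) i → lookup xs i ≡ v → index m ≡ i
index-unique (_ ∷ _)   (here _)  zero    e    = refl
index-unique (x∉ ∷ _)  (there m) zero    e    = ⊥-elim (All.lookup x∉ m e)
index-unique (x∉ ∷ _)  (here e′) (suc i) e    = ⊥-elim (All.lookup x∉ (∈-lookup i) (sym (trans e e′)))
index-unique (_ ∷ u)   (there m) (suc i) e    = cong suc (index-unique u m i e)

index-cong : ∀ {A : Set} {xs : List A} → Unique xs → ∀ {v w} (m : v ∈ xs) (m′ : w ∈ xs) → v ≡ w → index m ≡ index m′
index-cong u m m′ e = index-unique u m (index m′) (trans (sym (lookup-index m′)) (sym e))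

module ProjectiveCount (h : ℕ) (prime : Prime (suc (h ℕ.+ h))) (A B : ℕ) where

  open PointCount h prime A B hiding (X)
  open PrimeField (h ℕ.+ h) prime using (ι)

  private
    module Solver = RingSolver scalars
    open Solver using (_:+_; _:*_; _:=_; con)

  a b : F
  a = ι A
  b = ι B

  Point : Set
  Point = ProjectivePoint p (A % p) (B % p)

  open ProjectivePoint

  infix 4 _~_
  _~_ : Point → Point → Set
  _~_ = _∼_ p (A % p) (B % p)

  Homogeneous : F → F → F → Set
  Homogeneous x y z = (y * y) * z ≡ (x * (x * x) + (a * x) * (z * z)) + b * (z * (z * z))

  private
    ι-lhs : ∀ y z → ι (toℕ y ℕ.^ 2 ℕ.* toℕ z) ≡ (y * y) * z
    ι-lhs y z = trans (sym (ι-* (toℕ y ℕ.^ 2) (toℕ z))) (cong₂ _*_ (ι-square y) (ι-toℕ z))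

    ι-rhs : ∀ x z → ι (toℕ x ℕ.^ 3 ℕ.+ A % p ℕ.* toℕ x ℕ.* toℕ z ℕ.^ 2 ℕ.+ B % p ℕ.* toℕ z ℕ.^ 3)
      ≡ (x * (x * x) + (a * x) * (z * z)) + b * (z * (z * z))
    ι-rhs x z = trans (sym (ι-+ (toℕ x ℕ.^ 3 ℕ.+ A % p ℕ.* toℕ x ℕ.* toℕ z ℕ.^ 2) (B % p ℕ.* toℕ z ℕ.^ 3)))
      (cong₂ _+_ (trans (sym (ι-+ (toℕ x ℕ.^ 3) (A % p ℕ.* toℕ x ℕ.* toℕ z ℕ.^ 2)))
        (cong₂ _+_ (cube x) (trans (sym (ι-* (A % p ℕ.* toℕ x) (toℕ z ℕ.^ 2)))
          (cong₂ _*_ (trans (sym (ι-* (A % p) (toℕ x))) (cong₂ _*_ (ι-% A) (ι-toℕ x))) (ι-square z)))))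
        (trans (sym (ι-* (B % p) (toℕ z ℕ.^ 3))) (cong₂ _*_ (ι-% B) (cube z))))
      where
      cube : ∀ x → ι (toℕ x ℕ.^ 3) ≡ x * (x * x)
      cube x = trans (ι-^ (toℕ x) 3) (trans (cong (_^ˢ 3) (ι-toℕ x)) (cong (λ s → x * (x * s)) (S.*-identityʳ x)))

  homogeneous : ∀ (P : Point) → Homogeneous (X P) (Y P) (Z P)
  homogeneous P = trans (sym (ι-lhs (Y P) (Z P))) (trans (ι-cong (onCurve P)) (ι-rhs (X P) (Z P)))

  point : ∀ x y z → ¬ (toℕ x ≡ 0 × toℕ y ≡ 0 × toℕ z ≡ 0) → Homogeneous x y z → Point
  point x y z nz e = record { X = x ; Y = y ; Z = z ; nonzero = nz
    ; onCurve = ι-injective (trans (ι-lhs y z) (trans e (sym (ι-rhs x z)))) }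

  private
    toℕ≡0⇒≡0 : ∀ {x : F} → toℕ x ≡ 0 → x ≡ 0#
    toℕ≡0⇒≡0 e = toℕ-injective e

    Scaling : F → Point → Point → Set
    Scaling c P Q = X Q ≡ c * X P × Y Q ≡ c * Y P × Z Q ≡ c * Z P

  -- Equivalence of points is defined with natural numbers that are units modulo `p`; this lemma and
  -- the next one translate it to scaling by nonzero field elements.
  scale⇒~ : ∀ {P Q : Point} c → c ≢ 0# → Scaling c P Q → P ~ Q
  scale⇒~ {P} {Q} c c≢0 (x , y , z) = toℕ c , (toℕ (proj₁ (inverse c c≢0)) ,
      ι-injective (trans (sym (ι-* (toℕ c) _)) (trans (cong₂ _*_ (ι-toℕ c) (ι-toℕ _)) (proj₂ (inverse c c≢0))))) ,
    scaled x , scaled y , scaled z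
    where
    scaled : ∀ {s t} → t ≡ c * s → toℕ t % p ≡ (toℕ c ℕ.* toℕ s) % p
    scaled {s} {t} e = ι-injective (trans (ι-toℕ t) (trans e
      (trans (sym (cong₂ _*_ (ι-toℕ c) (ι-toℕ s))) (ι-* (toℕ c) (toℕ s)))))

  ~⇒scale : ∀ {P Q : Point} → P ~ Q → ∃ λ c → c ≢ 0# × Scaling c P Q
  ~⇒scale {P} {Q} (u , (v , uv) , x , y , z) = ι u ,
    (λ e → 1≢0 (trans (sym (ι-cong uv)) (trans (sym (ι-* u v)) (trans (cong (_* ι v) e) (*-zeroˡ _))))) ,
    scaled x , scaled y , scaled z
    where
    scaled : ∀ {s t : F} → toℕ t % p ≡ (u ℕ.* toℕ s) % p → t ≡ ι u * s
    scaled {s} {t} e = trans (sym (ι-toℕ t)) (trans (ι-cong e) (trans (sym (ι-* u (toℕ s))) (cong (ι u *_) (ι-toℕ s))))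

  opaque
    points : List (F × F)
    points = affinePoints p A B

    length-points : length points ≡ N
    length-points = refl

    unique : Unique points
    unique = Uniqueₚ.filter⁺ (onCurve? p A B) (Uniqueₚ.cartesianProduct⁺ (Uniqueₚ.allFin⁺ p) (Uniqueₚ.allFin⁺ p))

    ∈-points : ∀ {x y} → y * y ≡ eval x f → (x , y) ∈ points
    ∈-points {x} {y} e = ∈-filter⁺ (onCurve? p A B) (∈-cartesianProduct⁺ (∈-allFin x) (∈-allFin y)) (⇒onCurve e)

    on-f : ∀ {v} → v ∈ points → proj₂ v * proj₂ v ≡ eval (proj₁ v) f
    on-f m = onCurve⇒ (proj₂ (∈-filter⁻ (onCurve? p A B) {xs = cartesianProduct (allFin p) (allFin p)} m))

  M : ℕ
  M = length points

  infinity : Point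
  infinity = point 0# 1# 0# (λ (_ , e , _) → 1≢0 (toℕ≡0⇒≡0 e))
    (Solver.solve 2 (λ a b → (con 1 :* con 1) :* con 0 :=
      (con 0 :* (con 0 :* con 0) :+ (a :* con 0) :* (con 0 :* con 0)) :+ b :* (con 0 :* (con 0 :* con 0))) refl a b)

  affine : Fin M → Point
  affine j = point x y 1# (λ (_ , _ , e) → 1≢0 (toℕ≡0⇒≡0 e))
    (trans (S.*-identityʳ (y * y)) (trans (on-f (∈-lookup j))
      (Solver.solve 3 (λ a b x → b :+ x :* (a :+ x :* (con 0 :+ x :* (con 1 :+ x :* con 0)))
        := (x :* (x :* x) :+ (a :* x) :* (con 1 :* con 1)) :+ b :* (con 1 :* (con 1 :* con 1))) refl a b x)))
    where
    x = proj₁ (lookup points j)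
    y = proj₂ (lookup points j)

  module Affine (P : Point) (Z≢0 : Z P ≢ 0#) where

    w : F
    w = proj₁ (inverse (Z P) Z≢0)

    wZ : w * Z P ≡ 1#
    wZ = trans (*-comm w (Z P)) (proj₂ (inverse (Z P) Z≢0))

    Z*w* : ∀ s → Z P * (w * s) ≡ s
    Z*w* s = trans (sym (*-assoc (Z P) w s)) (trans (cong (_* s) (proj₂ (inverse (Z P) Z≢0))) (*-identityˡ s))

    x y : F
    x = w * X P
    y = w * Y P

    opaque
      member : (x , y) ∈ points
      -- The homogeneous equation is divided by `Z³`: factors `w Z = 1` are inserted until both
      -- sides are `w³` times the two sides of that equation.
      member = ∈-points (begin
        (w * Y P) * (w * Y P)
          ≡⟨ S.*-identityʳ _ ⟨
        ((w * Y P) * (w * Y P)) * 1#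
          ≡⟨ cong (((w * Y P) * (w * Y P)) *_) wZ ⟨
        ((w * Y P) * (w * Y P)) * (w * Z P)
          ≡⟨ Solver.solve 3 (λ w y z → ((w :* y) :* (w :* y)) :* (w :* z) := (w :* (w :* w)) :* ((y :* y) :* z)) refl w (Y P) (Z P) ⟩
        (w * (w * w)) * ((Y P * Y P) * Z P)
          ≡⟨ cong ((w * (w * w)) *_) (homogeneous P) ⟩
        (w * (w * w)) * ((X P * (X P * X P) + (a * X P) * (Z P * Z P)) + b * (Z P * (Z P * Z P)))
          ≡⟨ Solver.solve 5 (λ w a b x z → (w :* (w :* w)) :* ((x :* (x :* x) :+ (a :* x) :* (z :* z)) :+ b :* (z :* (z :* z)))
               := b :* ((w :* z) :* ((w :* z) :* (w :* z))) :+ (w :* x) :* (a :* ((w :* z) :* (w :* z))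
                  :+ (w :* x) :* (con 0 :+ (w :* x) :* (con 1 :+ (w :* x) :* con 0)))) refl w a b (X P) (Z P) ⟩
        b * (t * (t * t)) + (w * X P) * (a * (t * t) + (w * X P) * (0# + (w * X P) * (1# + (w * X P) * 0#)))
          ≡⟨ cong₂ (λ s s′ → b * s + (w * X P) * (a * s′ + (w * X P) * (0# + (w * X P) * (1# + (w * X P) * 0#)))) t³ t² ⟩
        b * 1# + (w * X P) * (a * 1# + (w * X P) * (0# + (w * X P) * (1# + (w * X P) * 0#)))
          ≡⟨ cong₂ (λ s s′ → s + (w * X P) * (s′ + (w * X P) * (0# + (w * X P) * (1# + (w * X P) * 0#)))) (S.*-identityʳ b) (S.*-identityʳ a) ⟩
        eval (w * X P) f ∎)
        where
        open ≡-Reasoning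
        t : F
        t = w * Z P
        t² : t * t ≡ 1#
        t² = trans (cong₂ _*_ wZ wZ) (*-identityˡ 1#)
        t³ : t * (t * t) ≡ 1#
        t³ = trans (cong₂ _*_ wZ t²) (*-identityˡ 1#)

  -- The last position is the point at infinity; other points are divided by `Z` and take their
  -- place in `points`. The decision is an argument, so results can be stated for every proof of it.
  toFin : ∀ (P : Point) → Dec (Z P ≡ 0#) → Fin (M ℕ.+ 1)
  toFin P (yes _)  = M ↑ʳ zero
  toFin P (no Z≢0) = index (Affine.member P Z≢0) ↑ˡ 1

  fromSplit : Fin M ⊎ Fin 1 → Point
  fromSplit (inj₁ j) = affine j
  fromSplit (inj₂ _) = infinity

  fromFin : Fin (M ℕ.+ 1) → Point
  fromFin i = fromSplit (splitAt M i)

  -- Multiplied by `Z Q`, both sides become `t`.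
  scale-coordinate : ∀ (P Q : Point) c → c ≢ 0# → Z Q ≡ c * Z P → ∀ nz nz′ s t → t ≡ c * s →
    Affine.w P nz * s ≡ Affine.w Q nz′ * t
  scale-coordinate P Q c c≢0 Z≡ nz nz′ s t e = sym (*-cancelˡ nz′ (trans (Affine.Z*w* Q nz′ t) (trans e (sym
    (trans (cong (_* (Affine.w P nz * s)) Z≡) (trans (*-assoc c (Z P) _) (cong (c *_) (Affine.Z*w* P nz s))))))))

  toFin-resp : ∀ (P Q : Point) → (Z P ≡ 0# → Z Q ≡ 0#) → (Z Q ≡ 0# → Z P ≡ 0#) →
    (∀ nz nz′ → _≡_ {A = F × F} (Affine.x P nz , Affine.y P nz) (Affine.x Q nz′ , Affine.y Q nz′)) →
    ∀ d e → toFin P d ≡ toFin Q e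
  toFin-resp P Q f g same (yes _)  (yes _)   = refl
  toFin-resp P Q f g same (yes z)  (no nz)   = ⊥-elim (nz (f z))
  toFin-resp P Q f g same (no nz)  (yes z)   = ⊥-elim (nz (g z))
  toFin-resp P Q f g same (no nz)  (no nz′)  =
    cong (_↑ˡ 1) (index-cong unique (Affine.member P nz) (Affine.member Q nz′) (same nz nz′))

  toFin-cong : ∀ (P Q : Point) → P ~ Q → ∀ d e → toFin P d ≡ toFin Q e
  toFin-cong P Q P~Q = toFin-resp P Q
    (λ z → trans Z≡ (trans (cong (c *_) z) (S.zeroʳ c)))
    (λ z → [ (λ e → ⊥-elim (c≢0 e)) , (λ e → e) ]′ (x*y≡0⇒x≡0⊎y≡0 c (Z P) (trans (sym Z≡) z)))
    (λ nz nz′ → cong₂ _,_ (scale-coordinate P Q c c≢0 Z≡ nz nz′ (X P) (X Q) X≡)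
                          (scale-coordinate P Q c c≢0 Z≡ nz nz′ (Y P) (Y Q) Y≡))
    where
    found = ~⇒scale {P} {Q} P~Q
    c = proj₁ found
    c≢0 = proj₁ (proj₂ found)
    X≡ = proj₁ (proj₂ (proj₂ found))
    Y≡ = proj₁ (proj₂ (proj₂ (proj₂ found)))
    Z≡ = proj₂ (proj₂ (proj₂ (proj₂ found)))

  -- For `Z = 0` the equation reads `X³ = 0`, so `X = 0`, `Y` is nonzero and the point is
  -- `(0 : 1 : 0)` scaled by `Y`. Otherwise scaling by `Z` undoes the division.
  from∘to : ∀ (P : Point) d → fromFin (toFin P d) ~ P
  from∘to P (yes Z≡0) = subst (_~ P) (cong fromSplit (sym (splitAt-↑ʳ M 1 zero)))
    (scale⇒~ {infinity} {P} (Y P) Y≢0 (trans X≡0 (sym (S.zeroʳ (Y P))) , sym (S.*-identityʳ (Y P)) , trans Z≡0 (sym (S.zeroʳ (Y P)))))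
    where
    X³≡0 : X P * (X P * X P) ≡ 0#
    X³≡0 = sym (begin
      0#                        ≡⟨ S.zeroʳ (Y P * Y P) ⟨
      (Y P * Y P) * 0#          ≡⟨ cong ((Y P * Y P) *_) Z≡0 ⟨
      (Y P * Y P) * Z P         ≡⟨ homogeneous P ⟩
      (X P * (X P * X P) + (a * X P) * (Z P * Z P)) + b * (Z P * (Z P * Z P))
        ≡⟨ cong (λ z → (X P * (X P * X P) + (a * X P) * (z * z)) + b * (z * (z * z))) Z≡0 ⟩
      (X P * (X P * X P) + (a * X P) * (0# * 0#)) + b * (0# * (0# * 0#))
        ≡⟨ Solver.solve 3 (λ a b x → (x :* (x :* x) :+ (a :* x) :* (con 0 :* con 0)) :+ b :* (con 0 :* (con 0 :* con 0))
             := x :* (x :* x)) refl a b (X P) ⟩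
      X P * (X P * X P)         ∎)
      where open ≡-Reasoning
    X≡0 : X P ≡ 0#
    X≡0 = [ (λ e → e) , (λ e → [ (λ e → e) , (λ e → e) ]′ (x*y≡0⇒x≡0⊎y≡0 (X P) (X P) e)) ]′
      (x*y≡0⇒x≡0⊎y≡0 (X P) (X P * X P) X³≡0)
    Y≢0 : Y P ≢ 0#
    Y≢0 e = nonzero P (cong toℕ X≡0 , cong toℕ e , cong toℕ Z≡0)
  from∘to P (no Z≢0) = subst (_~ P) (cong fromSplit (sym (splitAt-↑ˡ M (index member) 1)))
    (scale⇒~ {affine (index member)} {P} (Z P) Z≢0
      ( sym (trans (cong (λ v → Z P * proj₁ v) (sym (lookup-index member))) (Z*w* (X P)))
      , sym (trans (cong (λ v → Z P * proj₂ v) (sym (lookup-index member))) (Z*w* (Y P)))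
      , sym (S.*-identityʳ (Z P))))
    where open Affine P Z≢0 using (member; Z*w*)

  to∘from : ∀ i d → toFin (fromFin i) d ≡ i
  to∘from i d = trans (go (splitAt M i) d) (join-splitAt M 1 i)
    where
    go : ∀ s d → toFin (fromSplit s) d ≡ join M 1 s
    go (inj₁ j)    (yes e)  = ⊥-elim (1≢0 e)
    go (inj₁ j)    (no nz)  = cong (_↑ˡ 1) (index-unique unique (Affine.member (affine j) nz) j
      (cong₂ _,_ (unit _) (unit _)))
      where
      unit : ∀ s → s ≡ Affine.w (affine j) nz * s
      unit s = sym (trans (sym (*-identityˡ _)) (Affine.Z*w* (affine j) nz s))
    go (inj₂ zero) (yes _)  = refl
    go (inj₂ zero) (no nz)  = ⊥-elim (nz refl)

  hasCardinality : HasCardinality (projectivePoints p (A % p) (B % p)) (N ℕ.+ 1)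
  hasCardinality = subst (λ n → HasCardinality (projectivePoints p (A % p) (B % p)) (n ℕ.+ 1)) length-points record
    { to = λ P → toFin P (Z P ≟ 0#)
    ; from = fromFin
    ; to-cong = λ {P} {Q} e → toFin-cong P Q e (Z P ≟ 0#) (Z Q ≟ 0#)
    ; from-cong = λ { {i} refl → Setoid.refl (projectivePoints p (A % p) (B % p)) {fromFin i} }
    ; inverse =
        (λ {i} {P} e → trans (toFin-cong P (fromFin i) e (Z P ≟ 0#) (Z (fromFin i) ≟ 0#)) (to∘from i (Z (fromFin i) ≟ 0#))) ,
        (λ {P} {i} e → subst (λ i → fromFin i ~ P) (sym e) (from∘to P (Z P ≟ 0#)))
    }

open import Data.Nat using (_+_; _*_; _^_)
open import Data.Nat.Divisibility using (_∣_; ∣m+n∣m⇒∣n)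

-- Determination of the trace from its residue.

module TraceArithmetic (p N W r : ℕ) (17≤p : 17 ≤ p) (r<p : r < p)
  (N+W≡2p : N + W ≡ p + p) (p∣N+r : p ∣ N + r)
  (hasse-N : ∀ d → N ≡ p + d → d * d ≤ 4 * p) (hasse-W : ∀ d → W ≡ p + d → d * d ≤ 4 * p) where

  private
    -- The constant 17 comes from here: two numbers with squares at most `4 p` cannot have the sum
    -- `p`, since `p² ≤ 16 p` would follow.
    16p<p² : 16 * p < p * p
    16p<p² = ℕₚ.*-monoˡ-< p {{ℕ.>-nonZero (ℕₚ.≤-trans (s≤s z≤n) 17≤p)}} 17≤p

    small : ∀ d → d * d ≤ 4 * p → d < p
    small d d² = ℕₚ.≰⇒> λ p≤d → ℕₚ.<⇒≱ 16p<p² (ℕₚ.≤-trans (ℕₚ.*-mono-≤ p≤d p≤d)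
      (ℕₚ.≤-trans d² (ℕₚ.*-monoˡ-≤ p {4} {16} (s≤s (s≤s (s≤s (s≤s z≤n)))))))

    ∣-small : ∀ {e} → p ∣ e → e < p → e ≡ 0
    ∣-small {zero}  _ _   = refl
    ∣-small {suc e} d e<p = ⊥-elim (ℕₚ.<⇒≱ e<p (ℕᵈ.∣⇒≤ d))

    -- The two sides differ by `(m - n)²`.
    cauchy : ∀ m n → (m + n) * (m + n) ≤ 2 * (m * m + n * n)
    cauchy m n = [ ordered m n , (λ n≤m → subst₂ _≤_ (cong (λ s → s * s) (ℕₚ.+-comm n m))
      (cong (2 *_) (ℕₚ.+-comm (n * n) (m * m))) (ordered n m n≤m)) ]′ (ℕₚ.≤-total m n)
      where
      ordered : ∀ m n → m ≤ n → (m + n) * (m + n) ≤ 2 * (m * m + n * n)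
      ordered m n m≤n with ℕₚ.m≤n⇒∃[o]m+o≡n m≤n
      ... | e , refl = subst ((m + (m + e)) * (m + (m + e)) ≤_) (arith m e) (ℕₚ.m≤m+n _ (e * e))
        where
        arith : ∀ m e → (m + (m + e)) * (m + (m + e)) + e * e ≡ 2 * (m * m + (m + e) * (m + e))
        arith = solve-∀

    -- Here `W = p + d`, so the twist bounds `d`. As `p` divides `N + r = p + (r - d)` while `r` and
    -- `d` are both below `p`, they agree.
    below-p : ∀ d → p ≡ N + d → r * r ≤ 4 * p × N + r ≡ p
    below-p d p≡ = subst (λ s → s * s ≤ 4 * p × N + s ≡ p) (sym r≡d) (d² , sym p≡)
      where
      d² : d * d ≤ 4 * p
      d² = hasse-W d (ℕₚ.+-cancelˡ-≡ N W (p + d) (trans N+W≡2p (trans (cong (λ s → p + s) p≡) (arith p N d))))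
        where
        arith : ∀ p N d → p + (N + d) ≡ N + (p + d)
        arith = solve-∀
      greater : ∀ e → d + e ≡ r → e ≡ 0
      greater e eq = ∣-small (∣m+n∣m⇒∣n (subst (p ∣_) (trans (cong (N +_) (sym eq))
        (trans (sym (ℕₚ.+-assoc N d e)) (cong (_+ e) (sym p≡)))) p∣N+r) ℕᵈ.∣-refl)
        (ℕₚ.≤-<-trans (subst (e ≤_) eq (ℕₚ.m≤n+m e d)) r<p)
      less : ∀ e → r + e ≡ d → e ≡ 0
      less e eq = ∣-small (∣m+n∣m⇒∣n (subst (p ∣_) (trans p≡ (trans (cong (N +_) (sym eq)) (sym (ℕₚ.+-assoc N r e)))) ℕᵈ.∣-refl) p∣N+r)
        (ℕₚ.≤-<-trans (subst (e ≤_) eq (ℕₚ.m≤n+m e r)) (small d d²))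
      r≡d : r ≡ d
      r≡d = [ (λ d≤r → let e , eq = ℕₚ.m≤n⇒∃[o]m+o≡n d≤r in
                trans (sym eq) (trans (cong (d +_) (greater e eq)) (ℕₚ.+-identityʳ d)))
            , (λ r≤d → let e , eq = ℕₚ.m≤n⇒∃[o]m+o≡n r≤d in
                sym (trans (sym eq) (trans (cong (r +_) (less e eq)) (ℕₚ.+-identityʳ r)))) ]′ (ℕₚ.≤-total d r)

    -- `p` divides `d + 1 + r`, which is positive and below `2 p`, so this sum is `p`. Its two parts
    -- cannot both have squares at most `4 p`.
    above-p : ∀ d → N ≡ p + suc d → ¬ (r * r ≤ 4 * p) × N + r ≡ p + p
    above-p d N≡ = large , N+r
      where
      d² : suc d * suc d ≤ 4 * p
      d² = hasse-N (suc d) N≡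
      p∣d+r : p ∣ suc d + r
      p∣d+r = ∣m+n∣m⇒∣n (subst (p ∣_) (trans (cong (_+ r) N≡) (ℕₚ.+-assoc p (suc d) r)) p∣N+r) ℕᵈ.∣-refl
      d+r≡p : suc d + r ≡ p
      d+r≡p with ℕₚ.m≤n⇒∃[o]m+o≡n (ℕᵈ.∣⇒≤ p∣d+r)
      ... | e , eq = trans (sym eq) (trans (cong (p +_) (∣-small (∣m+n∣m⇒∣n (subst (p ∣_) (sym eq) p∣d+r) ℕᵈ.∣-refl) e<p))
          (ℕₚ.+-identityʳ p))
        where
        e<p : e < p
        e<p = ℕₚ.+-cancelˡ-< p e p (subst (_< p + p) (sym eq) (ℕₚ.+-mono-< (small (suc d) d²) r<p))
      N+r : N + r ≡ p + p
      N+r = trans (cong (_+ r) N≡) (trans (ℕₚ.+-assoc p (suc d) r) (cong (p +_) d+r≡p))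
      large : ¬ (r * r ≤ 4 * p)
      large r² = ℕₚ.<⇒≱ 16p<p² (subst₂ _≤_ (cong (λ s → s * s) d+r≡p) (arith p)
        (ℕₚ.≤-trans (cauchy (suc d) r) (ℕₚ.*-monoʳ-≤ 2 (ℕₚ.+-mono-≤ d² r²))))
        where
        arith : ∀ p → 2 * (4 * p + 4 * p) ≡ 16 * p
        arith = solve-∀

  dichotomy : (r * r ≤ 4 * p × N + r ≡ p) ⊎ (¬ (r * r ≤ 4 * p) × N + r ≡ p + p)
  dichotomy with ℕₚ.≤-total N p
  ... | inj₁ N≤p = let d , eq = ℕₚ.m≤n⇒∃[o]m+o≡n N≤p in inj₁ (below-p d (sym eq))
  ... | inj₂ p≤N with ℕₚ.m≤n⇒∃[o]m+o≡n p≤N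
  ...   | zero  , eq = inj₁ (below-p 0 (trans (sym (ℕₚ.+-identityʳ p)) (trans eq (sym (ℕₚ.+-identityʳ N)))))
  ...   | suc d , eq = inj₂ (above-p d (sym eq))

  private
    r^2 : r ^ 2 ≡ r * r
    r^2 = cong (r *_) (ℕₚ.*-identityʳ r)

  -- The factor of `p` is the indicator of `r² > 4 p`: the inner truncated difference is 0 in that
  -- case and at least 1 otherwise.
  count-formula : N ≡ (p ∸ r) + p * (1 ∸ ((4 * p + 1) ∸ r ^ 2))
  count-formula = [ in-range , out-of-range ]′ dichotomy
    where
    in-range : r * r ≤ 4 * p × N + r ≡ p → N ≡ (p ∸ r) + p * (1 ∸ ((4 * p + 1) ∸ r ^ 2))
    in-range (r² , e) = sym (trans (cong₂ _+_ (trans (cong (_∸ r) (sym e)) (ℕₚ.m+n∸n≡m N r))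
      (trans (cong (p *_) (ℕₚ.m≤n⇒m∸n≡0 (ℕₚ.m<n⇒0<n∸m (subst₂ _<_ (sym r^2) (ℕₚ.+-comm 1 (4 * p)) (s≤s r²))))) (ℕₚ.*-zeroʳ p)))
      (ℕₚ.+-identityʳ N))
    out-of-range : ¬ (r * r ≤ 4 * p) × N + r ≡ p + p → N ≡ (p ∸ r) + p * (1 ∸ ((4 * p + 1) ∸ r ^ 2))
    out-of-range (r² , e) = ℕₚ.+-cancelʳ-≡ r N _ (trans e (sym (trans
      (cong (λ s → (p ∸ r) + p * (1 ∸ s) + r) (ℕₚ.m≤n⇒m∸n≡0 (subst₂ _≤_ (ℕₚ.+-comm 1 (4 * p)) (sym r^2) (ℕₚ.≰⇒> r²))))
      (trans (arith (p ∸ r) p r) (cong (_+ p) (ℕₚ.m∸n+n≡m (ℕₚ.<⇒≤ r<p)))))))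
      where
      arith : ∀ s p r → s + p * 1 + r ≡ s + r + p
      arith = solve-∀

  in-range : r ^ 2 ≤ 4 * p → N + r ≡ p
  in-range r² = [ proj₂ , (λ (¬r² , _) → ⊥-elim (¬r² (subst (_≤ 4 * p) r^2 r²))) ]′ dichotomy

  out-of-range : ¬ (r ^ 2 ≤ 4 * p) → N + r ≡ p + p
  out-of-range ¬r² = [ (λ (r² , _) → ⊥-elim (¬r² (subst (_≤ 4 * p) (sym r^2) r²))) , proj₂ ]′ dichotomy

-- Odd primes, the trace as an integer, and the assembled result.

half-parity : ∀ n → (∃ λ h → n ≡ h + h) ⊎ (∃ λ h → n ≡ suc (h + h))
half-parity zero    = inj₁ (0 , refl)
half-parity (suc n) with half-parity n
... | inj₁ (h , e) = inj₂ (h , cong suc e)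
... | inj₂ (h , e) = inj₁ (suc h , trans (cong suc e) (cong suc (sym (ℕₚ.+-suc h h))))

odd-prime : ∀ {p} → Prime p → 17 ≤ p → ∃ λ h → p ≡ suc (h + h)
odd-prime {p} isPrime 17≤p with half-parity p
... | inj₂ odd      = odd
... | inj₁ (h , e) with prime⇒irreducible isPrime (ℕᵈ.divides h (trans e (trans (cong (h +_) (sym (ℕₚ.+-identityʳ h))) (ℕₚ.*-comm 2 h))))
...   | inj₂ refl with s≤s (s≤s ()) ← 17≤p

open import Data.Integer as ℤ using (ℤ; +_; _-_)
import Data.Integer.Properties as ℤₚ
import Data.Integer.Tactic.RingSolver as ℤSolver

trace≡r : ∀ p N r → N + r ≡ p → + p - + N ≡ + r
trace≡r p N r e = trans (cong (λ s → + s - + N) (sym e)) (trans (cong (_- + N) (ℤₚ.pos-+ N r)) (arith (+ N) (+ r)))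
  where
  arith : ∀ n r → (n ℤ.+ r) - n ≡ r
  arith = ℤSolver.solve-∀

trace≡r-p : ∀ p N r → N + r ≡ p + p → + p - + N ≡ + r - + p
trace≡r-p p N r e = trans (arith₁ (+ p) (+ N)) (trans (cong (λ s → s - + N - + p)
  (trans (sym (ℤₚ.pos-+ p p)) (trans (cong (λ s → + s) (sym e)) (ℤₚ.pos-+ N r)))) (arith₂ (+ N) (+ r) (+ p)))
  where
  arith₁ : ∀ p n → p - n ≡ (p ℤ.+ p) - n - p
  arith₁ = ℤSolver.solve-∀
  arith₂ : ∀ n r p → (n ℤ.+ r) - n - p ≡ r - p
  arith₂ = ℤSolver.solve-∀

trace-suc : ∀ p n → + p - + n ≡ + (p + 1) - + (n + 1)
trace-suc p n = trans (arith (+ p) (+ n)) (cong₂ _-_ (sym (ℤₚ.pos-+ p 1)) (sym (ℤₚ.pos-+ n 1)))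
  where
  arith : ∀ p n → p - n ≡ (p ℤ.+ + 1) - (n ℤ.+ + 1)
  arith = ℤSolver.solve-∀

theorem6 : (p : ℕ) .{{_ : NonZero p}} → Prime p → 17 ≤ p → (A B : ℕ) →
    let Ā  = A % p
        B̄  = B % p
        r  = residue p Ā B̄
        N  = affineCount p A B
        aₚ = + p - + N
    in
      N ≡ (p ∸ r) + p * (1 ∸ ((4 * p + 1) ∸ r ^ 2))
      × (r ^ 2 ≤ 4 * p → aₚ ≡ + r)
      × (¬ (r ^ 2 ≤ 4 * p) → aₚ ≡ + r - + p)
      × (Nonsingular p Ā B̄ → IsTraceOfFrobenius p Ā B̄ aₚ)
      × HasCardinality (projectivePoints p Ā B̄) (N + 1)
theorem6 p isPrime 17≤p A B with odd-prime isPrime 17≤p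
... | h , refl = count-formula ,
    (λ r² → trace≡r p N r (in-range r²)) , (λ ¬r² → trace≡r-p p N r (out-of-range ¬r²)) ,
    (λ _ → N + 1 , hasCardinality , trace-suc (suc (h + h)) N) , hasCardinality
  where
  open PointCount h isPrime A B using (N; r; r<p; p∣N+r; N≡Σweight; N+twist≡2p; weight; eval; f; 1#; -1#; hasse; -1*-1≡1; *-identityˡ)
  open ProjectiveCount h isPrime A B using (hasCardinality)
  -- The weights for `ε = -1` add up to the point count of the twist, and `hasse` bounds the excess
  -- over `p` for both counts.
  open TraceArithmetic (suc (h + h)) N (sum (λ x → weight -1# (eval x f))) r 17≤p r<p N+twist≡2p p∣N+r
    (λ d e → hasse 1# (*-identityˡ 1#) d (trans (sym N≡Σweight) e)) (hasse -1# -1*-1≡1)
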